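{- Let $1<k\le n$ be integers. The poset $\mathrm{Poset}(\mathrm{PF}_{n,k})$ is locally self-dual; that is, every interval $[\sigma,\tau]$ (with $\sigma\le\tau$) in $\mathrm{Poset}(\mathrm{PF}_{n,k})$ is isomorphic to its own order dual.
   Context: Write $[n]=\{1,\dots,n\}$. A parking function of length $n$ is an $n$-tuple $(a_1,\dots,a_n)$ of positive integers whose weakly increasing rearrangement $b_1\le\dots\le b_n$ satisfies $b_i\le i$ for all $i$; $\mathrm{PF}_n$ is the set of these. For $1<k\le n$, $\mathrm{PF}_{n,k}$ is the set of $a\in\mathrm{PF}_n$ such that $k$ is not an entry of $a$ but each of $k+1,\dots,n$ is an entry of $a$. $\mathrm{NC}_m$ is the lattice of noncrossing partitions of $[m]$ (partitions for which, placing $1,\dots,m$ in clockwise order on a circle, the convex hulls of the blocks are pairwise disjoint), ordered by refinement, with the finer partition being smaller. Each covering relation $\sigma<\tau$ in $\mathrm{NC}_{n+1}$ merges two blocks $B_1,B_2$ of $\sigma$ into one block $B=B_1\cup B_2$ of $\tau$; name them so that $\min B\in B_1$, and label the covering relation by the largest element of $B_1$ that is less than every element of $B_2$. Reading the labels of a maximal chain of $\mathrm{NC}_{n+1}$ from bottom to top gives a parking function of length $n$, and this is a (known) bijection from maximal chains of $\mathrm{NC}_{n+1}$ to $\mathrm{PF}_n$. $\mathrm{Poset}(\mathrm{PF}_{n,k})$ is the poset whose Hasse diagram is the union of the maximal chains of $\mathrm{NC}_{n+1}$ corresponding to elements of $\mathrm{PF}_{n,k}$: its elements are the noncrossing partitions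 lying on at least one of these chains, and its order is the reflexive-transitive closure of the covering relations occurring in these chains (it need not be an induced subposet of $\mathrm{NC}_{n+1}$). -}

module Defs where

open import Data.Fin.Base as Fin using (Fin; zero; suc; toℕ; inject₁)
open import Data.Fin.Permutation using (Permutation′; _⟨$⟩ʳ_)
open import Data.Integer.Base as ℤ using (+_)
open import Data.Nat.Base as ℕ using (ℕ; suc)
open import Data.Product.Base using (∃; _×_; _,_; proj₁; proj₂; swap)
open import Data.Rational.Base as ℚ using (ℚ; 0ℚ; 1ℚ; _/_)
open import Data.Sum.Base using (_⊎_)
open import Data.Vec.Functional using (Vector)
open import Function.Base using (id)
open import Function.Bundles using () renaming (_⇔_ to _⟺_)
open import Level using (Level; 0ℓ; _⊔_) renaming (suc to lsuc)
open import Relation.Binary.Bundles using (Poset)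
open import Relation.Binary.Construct.Closure.Transitive using (TransClosure; [_]; _∷_; _++_)
import Relation.Binary.Construct.Flip.EqAndOrd as Flip
import Relation.Binary.Construct.On as On
import Relation.Binary.Construct.StrictToNonStrict as StrictToNonStrict
open import Relation.Binary.Core using (Rel; _⇒_; _⇔_)
open import Relation.Binary.Morphism.Structures using (IsOrderIsomorphism)
import Relation.Binary.Properties.Poset as PosetProperties
open import Relation.Binary.Structures using (IsDecEquivalence; IsStrictPartialOrder)
open import Relation.Binary.PropositionalEquality.Core using (_≡_)
open import Relation.Nullary.Negation.Core using (¬_)
open import Relation.Unary using (Pred; _∈_; _∉_; _∪_; _⊥_)

private
  variable
    c ℓ₁ ℓ₂ c′ ℓ₁′ ℓ₂′ : Level
    m n : ℕ

module _ (P : Poset c ℓ₁ ℓ₂) where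
  open Poset P
  open PosetProperties P using (_<_)

  Covers : Rel Carrier (c ⊔ ℓ₁ ⊔ ℓ₂)
  Covers x y = x < y × (∀ z → ¬ (x < z × z < y))

  interval : Carrier → Carrier → Poset (c ⊔ ℓ₂) ℓ₁ ℓ₂
  interval x y = On.poset P (proj₁ {B = λ z → x ≤ z × z ≤ y})

infix 4 _≅_

_≅_ : Poset c ℓ₁ ℓ₂ → Poset c′ ℓ₁′ ℓ₂′ → Set _
P ≅ Q = ∃ (IsOrderIsomorphism P._≈_ Q._≈_ P._≤_ Q._≤_)
  where
  module P = Poset P
  module Q = Poset Q

SelfDual : Poset c ℓ₁ ℓ₂ → Set _
SelfDual P = P ≅ Flip.poset P

LocallySelfDual : Poset c ℓ₁ ℓ₂ → Set _
LocallySelfDual P = ∀ x y → x ≤ y → SelfDual (interval P x y)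
  where open Poset P

-- The entry a_j of a tuple is a i for the index i with toℕ i = j − 1.

IsParkingFunction : Pred (Vector ℕ n) 0ℓ
IsParkingFunction {n} a =
  (∀ i → 1 ℕ.≤ a i) ×
  ∃ λ (π : Permutation′ n) → let b = λ i → a (π ⟨$⟩ʳ i) in
    (∀ i j → i Fin.≤ j → b i ℕ.≤ b j) ×
    (∀ i → b i ℕ.≤ suc (toℕ i))

IsEntryOf : Vector ℕ n → Pred ℕ 0ℓ
IsEntryOf a v = ∃ λ i → a i ≡ v

PF : ∀ n → ℕ → Pred (Vector ℕ n) 0ℓ
PF n k a =
  a ∈ IsParkingFunction ×
  k ∉ IsEntryOf a ×
  (∀ j → k ℕ.< j → j ℕ.≤ n → j ∈ IsEntryOf a)

-- The plane is ℚ², there being no real numbers available.  Two finite sets of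
-- rational points have hulls that meet over ℝ exactly when they meet over ℚ,
-- since feasibility of a rational linear program does not depend on the field.

Point : Set
Point = ℚ × ℚ

segment : ℚ → Point → Point → Point
segment t (x , y) (x′ , y′) =
  ((1ℚ ℚ.- t) ℚ.* x ℚ.+ t ℚ.* x′) , ((1ℚ ℚ.- t) ℚ.* y ℚ.+ t ℚ.* y′)

-- The smallest convex set containing S.

data ConvexHull (S : Pred Point 0ℓ) : Pred Point 0ℓ where
  point  : ∀ {p} → p ∈ S → p ∈ ConvexHull S
  convex : ∀ {p q} t → 0ℚ ℚ.≤ t → t ℚ.≤ 1ℚ →
           p ∈ ConvexHull S → q ∈ ConvexHull S →
           segment t p q ∈ ConvexHull S

-- The points ((1 − t²) / (1 + t²) , − 2t / (1 + t²)) for t = 0, 1, 2, …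
-- run clockwise along the unit circle, from (1 , 0) towards (−1 , 0).

circlePoint : Fin m → Point
circlePoint i =
  ((+ 1 ℤ.- + (t ℕ.* t)) / suc (t ℕ.* t)) ,
  ((ℤ.- + (2 ℕ.* t)) / suc (t ℕ.* t))
  where t = toℕ i

hull : Pred (Fin m) 0ℓ → Pred Point 0ℓ
hull B = ConvexHull (λ p → ∃ λ i → i ∈ B × p ≡ circlePoint i)

-- A partition of [m] is given by the relation "lies in the same block as",
-- whose decidability is automatic classically.
-- The number i of [m] is represented by the element of Fin m whose toℕ is
-- i − 1.

record Partition (m : ℕ) : Set₁ where
  infix 4 _∼_
  field
    _∼_              : Rel (Fin m) 0ℓ
    isDecEquivalence : IsDecEquivalence _∼_

  open IsDecEquivalence isDecEquivalence public

  block : Fin m → Pred (Fin m) 0ℓ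
  block x i = x ∼ i

IsNoncrossing : Pred (Partition m) 0ℓ
IsNoncrossing σ = ∀ x y → ¬ x ∼ y → hull (block x) ⊥ hull (block y)
  where open Partition σ

record NoncrossingPartition (m : ℕ) : Set₁ where
  field
    partition     : Partition m
    isNoncrossing : IsNoncrossing partition

  open Partition partition public

NC : ℕ → Poset (lsuc 0ℓ) 0ℓ 0ℓ
NC m = record
  { Carrier        = NoncrossingPartition m
  ; _≈_            = λ σ τ → _∼_ σ ⇔ _∼_ τ
  ; _≤_            = λ σ τ → _∼_ σ ⇒ _∼_ τ
  ; isPartialOrder = record
    { isPreorder = record
      { isEquivalence = record
        { refl  = id , id
        ; sym   = swap
        ; trans = λ (f , f⁻¹) (g , g⁻¹) → (λ r → g (f r)) , (λ r → f⁻¹ (g⁻¹ r))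
        }
      ; reflexive = proj₁
      ; trans     = λ f g r → g (f r)
      }
    ; antisym = _,_
    }
  }
  where open NoncrossingPartition

_≈ₙ_ _<ₙ_ : Rel (NoncrossingPartition m) 0ℓ
_≈ₙ_ {m} = Poset._≈_ (NC m)
_<ₙ_ {m} = PosetProperties._<_ (NC m)

-- The block B₁ is represented by p = min (B₁ ∪ B₂), and B₂ by q.

record HasLabel (σ τ : NoncrossingPartition m) (label : ℕ) : Set where
  module σ = NoncrossingPartition σ
  module τ = NoncrossingPartition τ
  field
    p q : Fin m

  B₁ : Pred (Fin m) 0ℓ
  B₁ = σ.block p

  B₂ : Pred (Fin m) 0ℓ
  B₂ = σ.block q

  B : Pred (Fin m) 0ℓ
  B = B₁ ∪ B₂

  BelowB₂ : Pred (Fin m) 0ℓ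
  BelowB₂ i = ∀ j → j ∈ B₂ → i Fin.< j

  field
    distinct  : ¬ p σ.∼ q
    merged    : ∀ i j → i τ.∼ j ⟺ (i σ.∼ j ⊎ (i ∈ B × j ∈ B))
    p-minimum : ∀ i → i ∈ B → p Fin.≤ i
    l         : Fin m
    l∈B₁      : l ∈ B₁
    l-below   : l ∈ BelowB₂
    l-largest : ∀ i → i ∈ B₁ → i ∈ BelowB₂ → i Fin.≤ l
    label≡l   : label ≡ suc (toℕ l)

record MaximalChain (n : ℕ) : Set₁ where
  open Poset (NC (suc n)) using (_≤_)
  field
    element : Vector (NoncrossingPartition (suc n)) (suc n)
    bottom  : ∀ ρ → element zero ≤ ρ
    top     : ∀ ρ → ρ ≤ element (Fin.fromℕ n)
    covers  : ∀ i → Covers (NC (suc n)) (element (inject₁ i)) (element (suc i))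

_HasLabels_ : MaximalChain n → Vector ℕ n → Set
C HasLabels a = ∀ i → HasLabel (element (inject₁ i)) (element (suc i)) (a i)
  where open MaximalChain C

module _ {n : ℕ} (S : Pred (Vector ℕ n) 0ℓ) where
  open MaximalChain using (element; covers)

  ChainOf : Pred (MaximalChain n) 0ℓ
  ChainOf C = ∃ λ a → a ∈ S × C HasLabels a

  OnChain : Pred (NoncrossingPartition (suc n)) (lsuc 0ℓ)
  OnChain ρ = ∃ λ C → C ∈ ChainOf × ∃ λ i → element C i ≈ₙ ρ

  ChainCover : Rel (NoncrossingPartition (suc n)) (lsuc 0ℓ)
  ChainCover σ τ = ∃ λ C → C ∈ ChainOf ×
    ∃ λ i → element C (inject₁ i) ≈ₙ σ × element C (suc i) ≈ₙ τ

  private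
    module N = Poset (NC (suc n))
    module N< = PosetProperties (NC (suc n))

    _<⁺_ : Rel (NoncrossingPartition (suc n)) (lsuc 0ℓ)
    _<⁺_ = TransClosure ChainCover

    cover⇒< : ∀ {σ τ} → ChainCover σ τ → σ <ₙ τ
    cover⇒< {σ} {τ} (C , _ , i , x≈σ , y≈τ) =
      N<.<-respˡ-≈ {τ} {x} {σ} x≈σ
        (N<.<-respʳ-≈ {x} {y} {τ} y≈τ (proj₁ (covers C i)))
      where
      x = element C (inject₁ i)
      y = element C (suc i)

    <⁺⇒< : ∀ {σ τ} → σ <⁺ τ → σ <ₙ τ
    <⁺⇒< {σ} {τ} [ e ] = cover⇒< {σ} {τ} e
    <⁺⇒< {σ} {τ} (_∷_ {y = ρ} e r) =
      N<.<-trans {σ} {ρ} {τ} (cover⇒< {σ} {ρ} e) (<⁺⇒< {ρ} {τ} r)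

    cover-respʳ : ∀ {σ τ τ′} → τ ≈ₙ τ′ → ChainCover σ τ → ChainCover σ τ′
    cover-respʳ {σ} {τ} {τ′} τ≈τ′ (C , C∈ , i , x≈σ , y≈τ) =
      C , C∈ , i , x≈σ , N.Eq.trans {element C (suc i)} {τ} {τ′} y≈τ τ≈τ′

    cover-respˡ : ∀ {σ σ′ τ} → σ ≈ₙ σ′ → ChainCover σ τ → ChainCover σ′ τ
    cover-respˡ {σ} {σ′} {τ} σ≈σ′ (C , C∈ , i , x≈σ , y≈τ) =
      C , C∈ , i , N.Eq.trans {element C (inject₁ i)} {σ} {σ′} x≈σ σ≈σ′ , y≈τ

    <⁺-respʳ : ∀ {σ τ τ′} → τ ≈ₙ τ′ → σ <⁺ τ → σ <⁺ τ′
    <⁺-respʳ {σ} {τ} {τ′} eq [ e ] = [ cover-respʳ {σ} {τ} {τ′} eq e ]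
    <⁺-respʳ {σ} {τ} {τ′} eq (e ∷ r) = e ∷ <⁺-respʳ {_} {τ} {τ′} eq r

    <⁺-respˡ : ∀ {σ σ′ τ} → σ ≈ₙ σ′ → σ <⁺ τ → σ′ <⁺ τ
    <⁺-respˡ {σ} {σ′} {τ} eq [ e ] = [ cover-respˡ {σ} {σ′} {τ} eq e ]
    <⁺-respˡ {σ} {σ′} {τ} eq (_∷_ {y = ρ} e r) =
      cover-respˡ {σ} {σ′} {ρ} eq e ∷ r

    <⁺-isStrictPartialOrder : IsStrictPartialOrder _≈ₙ_ _<⁺_
    <⁺-isStrictPartialOrder = record
      { isEquivalence = N.isEquivalence
      ; irrefl        = λ {σ} {τ} eq r → N<.<-irrefl {σ} {τ} eq (<⁺⇒< {σ} {τ} r)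
      ; trans         = _++_
      ; <-resp-≈      = (λ {σ} {τ} {τ′} → <⁺-respʳ {σ} {τ} {τ′})
                      , (λ {τ} {σ} {σ′} → <⁺-respˡ {σ} {σ′} {τ})
      }

  -- The order is the reflexive closure, with respect to equality of
  -- partitions, of the transitive closure of ChainCover.

  PosetOf : Poset (lsuc 0ℓ) 0ℓ (lsuc 0ℓ)
  PosetOf = On.poset
    (record { isPartialOrder =
        StrictToNonStrict.isPartialOrder _≈ₙ_ _<⁺_ <⁺-isStrictPartialOrder })
    (proj₁ {B = OnChain})

{-# OPTIONS --safe #-}

-- Index the elements of [n+1] from 0, and let P and Q be the indices k − 1 and
-- k.  A step of a maximal chain merges a block with minimum q into one
-- containing l < q, and has label l + 1; each q > 0 occurs once as such a
-- minimum.  By downward induction on the labels, the chain belongs to PF n k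
-- exactly when l = q − 1 for all q > Q, and l ≠ P for q = Q.
--
-- Hence the partitions on these chains are the admissible ones, in which each
-- y > Q is minimal in its block or lies in the block of y − 1, and σ ⪯ τ holds
-- when σ refines τ and, should Q be minimal in its block of σ while P and Q
-- share a block of τ, some admissible partition in between has neither property.
--
-- An admissible partition amounts to a noncrossing partition of {0, …, Q} and
-- the set of those y > Q which are linked to y − 1.  In an interval [σ, τ] the
-- set of links is complemented.  On {0, …, Q} one composes the Kreweras
-- complement K in τ, the inverse complement in κ = K σ, an automorphism of
-- [⊥, κ], and the inverse complement in τ.  The result reverses refinement on
-- [σ, τ].  In the exceptional case P and Q lie in one block of κ, and the
-- automorphism is the reflection of that block (in its cyclic order) that swaps
-- P and Q; the composite then exchanges the two properties above.

module Submission where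

open import Defs
open import Data.Nat.Base using (ℕ; _<_; _≤_)

open import Data.Fin.Base as Fin using (Fin; zero; suc; toℕ; inject₁; fromℕ)
open import Data.Fin.Permutation as Perm using (Permutation′; _⟨$⟩ʳ_; _⟨$⟩ˡ_)
import Data.Fin.Properties as Fin
import Data.Integer.Base as ℤ
import Data.Integer.Properties as ℤ
open import Data.Nat.Base as ℕ using (suc; zero)
import Data.Nat.Properties as ℕ
open import Data.Product.Base using (∃; ∃₂; _×_; _,_; proj₁; proj₂; swap)
open import Data.Rational.Base as ℚ using (ℚ; 0ℚ; 1ℚ)
import Data.Rational.Properties as ℚ
open import Data.Rational.Solver using (module +-*-Solver)
import Data.Rational.Unnormalised.Base as ℚᵘ
import Data.Rational.Unnormalised.Properties as ℚᵘ
open import Data.Sum.Base using (_⊎_; inj₁; inj₂; [_,_]′)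
open import Data.Unit.Base using (⊤; tt)
open import Data.Vec.Functional using (Vector)
open import Function.Base using (id; _∘_; case_of_)
open import Function.Bundles using (Equivalence; mk⇔) renaming (_⇔_ to _⟺_)
open import Level using (0ℓ) renaming (suc to lsuc)
open import Relation.Binary.Bundles using (Poset)
open import Relation.Binary.Construct.Closure.Transitive using (TransClosure; [_]; _∷_)
open import Relation.Binary.Core using (Rel; _⇒_)
open import Relation.Binary.Definitions using (Decidable; Transitive; Trichotomous; Tri; tri<; tri≈; tri>)
open import Relation.Binary.PropositionalEquality
open import Relation.Binary.Structures using (IsEquivalence)
open import Relation.Nullary.Decidable using (Dec; yes; no; _×-dec_; _⊎-dec_; _→-dec_; ¬?; decidable-stable)
open import Relation.Nullary.Negation using (¬_; contradiction)
open import Relation.Unary using (Pred; _∈_; _∉_)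

private
  variable
    m : ℕ

-- The extra clause in `⪯` is the trace of the single merge forbidden at Q, the one with l = P. When
-- Q stops being minimal it is attached to a block without P, so P and Q can meet only at a later
-- merge, and in between Q is neither minimal nor together with P. An antitone bijection respects
-- the clause as soon as it exchanges "Q is minimal" and "P and Q share a block", since it then
-- sends intermediate partitions to intermediate ones. On {0, ..., Q} the first property says that
-- {Q} is a block. The obstacle is a shift by one: P and Q share a block of K ρ when {Q} is a block
-- of ρ, but they share a block of the inverse complement of ρ when {P} is. With three complements
-- and nothing else, P and Q would share a block of the image of ρ when {P}, and not {Q}, is a block
-- of the partition in the middle. The reflection turns one condition into the other. As P and Q are
-- the last two elements of their block of κ, it exchanges them and reverses the elements before
-- them.

CrossingFree : Rel (Fin m) 0ℓ → Set
CrossingFree _∼_ = ∀ {a b c d} → a Fin.< b → b Fin.< c → c Fin.< d → a ∼ c → b ∼ d → a ∼ b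

-- Convex geometry of the points on the circle

fromℤ : ℤ.ℤ → ℚ
fromℤ i = i ℚ./ 1

private
  toℚᵘ-/ : ∀ i n → ℚ.toℚᵘ (i ℚ./ suc n) ℚᵘ.≃ ℚᵘ.mkℚᵘ i n
  toℚᵘ-/ i n = ℚ.toℚᵘ-fromℚᵘ (ℚᵘ.mkℚᵘ i n)

/-*-cancel : ∀ i n → (i ℚ./ suc n) ℚ.* fromℤ (ℤ.+ suc n) ≡ fromℤ i
/-*-cancel i n = ℚ.toℚᵘ-injective (begin
  ℚ.toℚᵘ ((i ℚ./ suc n) ℚ.* fromℤ (ℤ.+ suc n))
    ≈⟨ ℚ.toℚᵘ-homo-* (i ℚ./ suc n) (fromℤ (ℤ.+ suc n)) ⟩
  ℚ.toℚᵘ (i ℚ./ suc n) ℚᵘ.* ℚ.toℚᵘ (fromℤ (ℤ.+ suc n))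
    ≈⟨ ℚᵘ.*-cong (toℚᵘ-/ i n) (toℚᵘ-/ (ℤ.+ suc n) 0) ⟩
  ℚᵘ.mkℚᵘ i n ℚᵘ.* ℚᵘ.mkℚᵘ (ℤ.+ suc n) 0
    ≈⟨ ℚᵘ.*≡* (trans (ℤ.*-assoc i (ℤ.+ suc n) (ℤ.+ 1))
                 (cong (λ k → i ℤ.* (ℤ.+ k)) (trans (ℕ.*-identityʳ (suc n)) (sym (ℕ.*-identityʳ (suc n)))))) ⟩
  ℚᵘ.mkℚᵘ i 0
    ≈⟨ toℚᵘ-/ i 0 ⟨
  ℚ.toℚᵘ (fromℤ i) ∎)
  where open ℚᵘ.≃-Reasoning

fromℤ-homo-+ : ∀ i j → fromℤ (i ℤ.+ j) ≡ fromℤ i ℚ.+ fromℤ j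
fromℤ-homo-+ i j = ℚ.toℚᵘ-injective (begin
  ℚ.toℚᵘ (fromℤ (i ℤ.+ j))
    ≈⟨ toℚᵘ-/ (i ℤ.+ j) 0 ⟩
  ℚᵘ.mkℚᵘ (i ℤ.+ j) 0
    ≈⟨ ℚᵘ.*≡* (cong (ℤ._* ℤ.+ 1) (cong₂ ℤ._+_ (sym (ℤ.*-identityʳ i)) (sym (ℤ.*-identityʳ j)))) ⟩
  ℚᵘ.mkℚᵘ i 0 ℚᵘ.+ ℚᵘ.mkℚᵘ j 0
    ≈⟨ ℚᵘ.+-cong (toℚᵘ-/ i 0) (toℚᵘ-/ j 0) ⟨
  ℚ.toℚᵘ (fromℤ i) ℚᵘ.+ ℚ.toℚᵘ (fromℤ j)
    ≈⟨ ℚ.toℚᵘ-homo-+ (fromℤ i) (fromℤ j) ⟨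
  ℚ.toℚᵘ (fromℤ i ℚ.+ fromℤ j) ∎)
  where open ℚᵘ.≃-Reasoning

fromℤ-homo-* : ∀ i j → fromℤ (i ℤ.* j) ≡ fromℤ i ℚ.* fromℤ j
fromℤ-homo-* i j = ℚ.toℚᵘ-injective (begin
  ℚ.toℚᵘ (fromℤ (i ℤ.* j))
    ≈⟨ toℚᵘ-/ (i ℤ.* j) 0 ⟩
  ℚᵘ.mkℚᵘ i 0 ℚᵘ.* ℚᵘ.mkℚᵘ j 0
    ≈⟨ ℚᵘ.*-cong (toℚᵘ-/ i 0) (toℚᵘ-/ j 0) ⟨
  ℚ.toℚᵘ (fromℤ i) ℚᵘ.* ℚ.toℚᵘ (fromℤ j)
    ≈⟨ ℚ.toℚᵘ-homo-* (fromℤ i) (fromℤ j) ⟨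
  ℚ.toℚᵘ (fromℤ i ℚ.* fromℤ j) ∎)
  where open ℚᵘ.≃-Reasoning

fromℤ-homo-neg : ∀ i → fromℤ (ℤ.- i) ≡ ℚ.- fromℤ i
fromℤ-homo-neg i = ℚ.toℚᵘ-injective (begin
  ℚ.toℚᵘ (fromℤ (ℤ.- i))  ≈⟨ toℚᵘ-/ (ℤ.- i) 0 ⟩
  ℚᵘ.- ℚᵘ.mkℚᵘ i 0        ≈⟨ ℚᵘ.-‿cong (toℚᵘ-/ i 0) ⟨
  ℚᵘ.- ℚ.toℚᵘ (fromℤ i)   ≈⟨ ℚ.toℚᵘ-homo‿- (fromℤ i) ⟨
  ℚ.toℚᵘ (ℚ.- fromℤ i)    ∎)
  where open ℚᵘ.≃-Reasoning

fromℤ-mono-< : ∀ {i j} → i ℤ.< j → fromℤ i ℚ.< fromℤ j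
fromℤ-mono-< {i} {j} i<j = ℚ.toℚᵘ-cancel-<
  (ℚᵘ.<-respʳ-≃ (ℚᵘ.≃-sym (toℚᵘ-/ j 0)) (ℚᵘ.<-respˡ-≃ (ℚᵘ.≃-sym (toℚᵘ-/ i 0))
    (ℚᵘ.*<* (subst₂ ℤ._<_ (sym (ℤ.*-identityʳ i)) (sym (ℤ.*-identityʳ j)) i<j))))

fromℕℚ : ℕ → ℚ
fromℕℚ t = fromℤ (ℤ.+ t)

fromℕℚ-mono-< : ∀ {s t} → s < t → fromℕℚ s ℚ.< fromℕℚ t
fromℕℚ-mono-< s<t = fromℤ-mono-< (ℤ.+<+ s<t)

fromℕℚ-mono-≤ : ∀ {s t} → s ≤ t → fromℕℚ s ℚ.≤ fromℕℚ t
fromℕℚ-mono-≤ s≤t with ℕ.m≤n⇒m<n∨m≡n s≤t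
... | inj₁ s<t  = ℚ.<⇒≤ (fromℕℚ-mono-< s<t)
... | inj₂ refl = ℚ.≤-refl

private
  2ℚ : ℚ
  2ℚ = 1ℚ ℚ.+ 1ℚ

-- This is 1 + t², the common denominator of the two coordinates of `circlePoint`. Multiplying by it
-- makes the identities below polynomial in t, within reach of the ring solver.
norm² : ℕ → ℚ
norm² t = fromℕℚ (suc (t ℕ.* t))

fromℕℚ-*-homo : ∀ s t → fromℕℚ (s ℕ.* t) ≡ fromℕℚ s ℚ.* fromℕℚ t
fromℕℚ-*-homo s t = trans (cong fromℤ (ℤ.pos-* s t)) (fromℤ-homo-* (ℤ.+ s) (ℤ.+ t))

norm²-def : ∀ t → norm² t ≡ 1ℚ ℚ.+ fromℕℚ t ℚ.* fromℕℚ t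
norm²-def t = trans (fromℤ-homo-+ (ℤ.+ 1) (ℤ.+ (t ℕ.* t))) (cong (1ℚ ℚ.+_) (fromℕℚ-*-homo t t))

norm²-pos : ∀ t → 0ℚ ℚ.< norm² t
norm²-pos t = fromℕℚ-mono-< {0} {suc (t ℕ.* t)} (ℕ.s≤s ℕ.z≤n)

circlePoint-x : ∀ (i : Fin m) → let t = fromℕℚ (toℕ i) in
  proj₁ (circlePoint i) ℚ.* norm² (toℕ i) ≡ 1ℚ ℚ.- t ℚ.* t
circlePoint-x i = trans (/-*-cancel (ℤ.+ 1 ℤ.- ℤ.+ (t ℕ.* t)) (t ℕ.* t))
  (trans (fromℤ-homo-+ (ℤ.+ 1) (ℤ.- ℤ.+ (t ℕ.* t)))
    (cong (1ℚ ℚ.+_) (trans (fromℤ-homo-neg (ℤ.+ (t ℕ.* t))) (cong ℚ.-_ (fromℕℚ-*-homo t t)))))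
  where t = toℕ i

circlePoint-y : ∀ (i : Fin m) → let t = fromℕℚ (toℕ i) in
  proj₂ (circlePoint i) ℚ.* norm² (toℕ i) ≡ ℚ.- (2ℚ ℚ.* t)
circlePoint-y i = trans (/-*-cancel (ℤ.- ℤ.+ (2 ℕ.* t)) (t ℕ.* t))
  (trans (fromℤ-homo-neg (ℤ.+ (2 ℕ.* t))) (cong ℚ.-_ (fromℕℚ-*-homo 2 t)))
  where t = toℕ i

-- An affine function whose zero line is the chord through the circle points
-- with parameters s and s′.
chord : ℚ → ℚ → Point → ℚ
chord s s′ (x , y) = ((1ℚ ℚ.- x) ℚ.+ (s ℚ.+ s′) ℚ.* y) ℚ.+ (s ℚ.* s′) ℚ.* (1ℚ ℚ.+ x)

chord-segment : ∀ s s′ t p q →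
  chord s s′ (segment t p q) ≡ (1ℚ ℚ.- t) ℚ.* chord s s′ p ℚ.+ t ℚ.* chord s s′ q
chord-segment s s′ t (x , y) (x′ , y′) =
  solve 7 (λ s s′ t x y x′ y′ →
    ((con 1ℚ :- ((con 1ℚ :- t) :* x :+ t :* x′)) :+ (s :+ s′) :* ((con 1ℚ :- t) :* y :+ t :* y′))
      :+ (s :* s′) :* (con 1ℚ :+ ((con 1ℚ :- t) :* x :+ t :* x′))
    := (con 1ℚ :- t) :* (((con 1ℚ :- x) :+ (s :+ s′) :* y) :+ (s :* s′) :* (con 1ℚ :+ x))
      :+ t :* (((con 1ℚ :- x′) :+ (s :+ s′) :* y′) :+ (s :* s′) :* (con 1ℚ :+ x′)))
    refl s s′ t x y x′ y′
  where open +-*-Solver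

-- Along the parametrised circle the chord function is, up to a positive factor, the quadratic in t
-- with roots s and s′. Its sign therefore tells whether t lies between them.
chord-circlePoint : ∀ s s′ (i : Fin m) → let t = fromℕℚ (toℕ i) in
  chord s s′ (circlePoint i) ℚ.* norm² (toℕ i) ≡ 2ℚ ℚ.* ((t ℚ.- s) ℚ.* (t ℚ.- s′))
chord-circlePoint s s′ i = begin
  chord s s′ (x , y) ℚ.* w
    ≡⟨ solve 5 (λ s s′ x y w →
         (((con 1ℚ :- x) :+ (s :+ s′) :* y) :+ (s :* s′) :* (con 1ℚ :+ x)) :* w
         := ((w :- x :* w) :+ (s :+ s′) :* (y :* w)) :+ (s :* s′) :* (w :+ x :* w)) refl s s′ x y w ⟩
  ((w ℚ.- x ℚ.* w) ℚ.+ (s ℚ.+ s′) ℚ.* (y ℚ.* w)) ℚ.+ (s ℚ.* s′) ℚ.* (w ℚ.+ x ℚ.* w)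
    ≡⟨ cong₂ (λ u v → ((w ℚ.- u) ℚ.+ (s ℚ.+ s′) ℚ.* v) ℚ.+ (s ℚ.* s′) ℚ.* (w ℚ.+ u)) (circlePoint-x i) (circlePoint-y i) ⟩
  ((w ℚ.- (1ℚ ℚ.- t ℚ.* t)) ℚ.+ (s ℚ.+ s′) ℚ.* (ℚ.- (2ℚ ℚ.* t))) ℚ.+ (s ℚ.* s′) ℚ.* (w ℚ.+ (1ℚ ℚ.- t ℚ.* t))
    ≡⟨ cong (λ w → ((w ℚ.- (1ℚ ℚ.- t ℚ.* t)) ℚ.+ (s ℚ.+ s′) ℚ.* (ℚ.- (2ℚ ℚ.* t))) ℚ.+ (s ℚ.* s′) ℚ.* (w ℚ.+ (1ℚ ℚ.- t ℚ.* t))) (norm²-def (toℕ i)) ⟩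
  (((1ℚ ℚ.+ t ℚ.* t) ℚ.- (1ℚ ℚ.- t ℚ.* t)) ℚ.+ (s ℚ.+ s′) ℚ.* (ℚ.- (2ℚ ℚ.* t)))
      ℚ.+ (s ℚ.* s′) ℚ.* ((1ℚ ℚ.+ t ℚ.* t) ℚ.+ (1ℚ ℚ.- t ℚ.* t))
    ≡⟨ solve 3 (λ s s′ t →
         (((con 1ℚ :+ t :* t) :- (con 1ℚ :- t :* t)) :+ (s :+ s′) :* (:- (con 2ℚ :* t)))
           :+ (s :* s′) :* ((con 1ℚ :+ t :* t) :+ (con 1ℚ :- t :* t))
         := con 2ℚ :* ((t :- s) :* (t :- s′))) refl s s′ t ⟩
  2ℚ ℚ.* ((t ℚ.- s) ℚ.* (t ℚ.- s′)) ∎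
  where
  open ≡-Reasoning
  open +-*-Solver
  x = proj₁ (circlePoint i)
  y = proj₂ (circlePoint i)
  w = norm² (toℕ i)
  t = fromℕℚ (toℕ i)

private
  interpolate-≤ : ∀ {t a b} → 0ℚ ℚ.≤ t → t ℚ.≤ 1ℚ → a ℚ.≤ b →
    a ℚ.≤ (1ℚ ℚ.- t) ℚ.* a ℚ.+ t ℚ.* b × (1ℚ ℚ.- t) ℚ.* a ℚ.+ t ℚ.* b ℚ.≤ b
  interpolate-≤ {t} {a} {b} 0≤t t≤1 a≤b =
    ℚ.≤-trans (ℚ.≤-reflexive (same a)) (ℚ.+-monoʳ-≤ ((1ℚ ℚ.- t) ℚ.* a) (ℚ.*-monoˡ-≤-nonNeg t {{ℚ.nonNegative 0≤t}} a≤b)) ,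
    ℚ.≤-trans (ℚ.+-monoˡ-≤ (t ℚ.* b) (ℚ.*-monoˡ-≤-nonNeg (1ℚ ℚ.- t) {{ℚ.nonNegative 0≤1-t}} a≤b)) (ℚ.≤-reflexive (sym (same b)))
    where
    open +-*-Solver
    same : ∀ a → a ≡ (1ℚ ℚ.- t) ℚ.* a ℚ.+ t ℚ.* a
    same a = solve 2 (λ t a → a := (con 1ℚ :- t) :* a :+ t :* a) refl t a
    0≤1-t : 0ℚ ℚ.≤ 1ℚ ℚ.- t
    0≤1-t = subst (ℚ._≤ 1ℚ ℚ.- t) (ℚ.+-inverseʳ t) (ℚ.+-monoˡ-≤ (ℚ.- t) t≤1)

  interpolate-between : ∀ {t} a b → 0ℚ ℚ.≤ t → t ℚ.≤ 1ℚ → let c = (1ℚ ℚ.- t) ℚ.* a ℚ.+ t ℚ.* b in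
    (a ℚ.≤ c ⊎ b ℚ.≤ c) × (c ℚ.≤ a ⊎ c ℚ.≤ b)
  interpolate-between {t} a b 0≤t t≤1 with ℚ.≤-total a b
  ... | inj₁ a≤b = let l , u = interpolate-≤ 0≤t t≤1 a≤b in inj₁ l , inj₂ u
  ... | inj₂ b≤a = inj₂ (subst (b ℚ.≤_) flip l) , inj₁ (subst (ℚ._≤ a) flip u)
    where
    open +-*-Solver
    0≤1-t : 0ℚ ℚ.≤ 1ℚ ℚ.- t
    0≤1-t = subst (ℚ._≤ 1ℚ ℚ.- t) (ℚ.+-inverseʳ t) (ℚ.+-monoˡ-≤ (ℚ.- t) t≤1)
    1-t≤1 : 1ℚ ℚ.- t ℚ.≤ 1ℚ
    1-t≤1 = subst (1ℚ ℚ.- t ℚ.≤_) (ℚ.+-identityʳ 1ℚ) (ℚ.+-monoʳ-≤ 1ℚ (ℚ.neg-antimono-≤ 0≤t))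
    flip : (1ℚ ℚ.- (1ℚ ℚ.- t)) ℚ.* b ℚ.+ (1ℚ ℚ.- t) ℚ.* a ≡ (1ℚ ℚ.- t) ℚ.* a ℚ.+ t ℚ.* b
    flip = solve 3 (λ t a b → (con 1ℚ :- (con 1ℚ :- t)) :* b :+ (con 1ℚ :- t) :* a := (con 1ℚ :- t) :* a :+ t :* b) refl t a b
    l = proj₁ (interpolate-≤ 0≤1-t 1-t≤1 b≤a)
    u = proj₂ (interpolate-≤ 0≤1-t 1-t≤1 b≤a)

chord-nonneg : ∀ {S : Pred Point 0ℓ} s s′ → (∀ {p} → S p → 0ℚ ℚ.≤ chord s s′ p) →
  ∀ {p} → ConvexHull S p → 0ℚ ℚ.≤ chord s s′ p
chord-nonneg s s′ h (point p∈) = h p∈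
chord-nonneg s s′ h (convex {p} {q} t 0≤t t≤1 hp hq) =
  subst (0ℚ ℚ.≤_) (sym (chord-segment s s′ t p q))
    ([ ℚ.≤-trans (chord-nonneg s s′ h hp) , ℚ.≤-trans (chord-nonneg s s′ h hq) ]′
      (proj₁ (interpolate-between (chord s s′ p) (chord s s′ q) 0≤t t≤1)))

chord-neg : ∀ {S : Pred Point 0ℓ} s s′ → (∀ {p} → S p → chord s s′ p ℚ.< 0ℚ) →
  ∀ {p} → ConvexHull S p → chord s s′ p ℚ.< 0ℚ
chord-neg s s′ h (point p∈) = h p∈
chord-neg s s′ h (convex {p} {q} t 0≤t t≤1 hp hq) =
  subst (ℚ._< 0ℚ) (sym (chord-segment s s′ t p q))
    ([ (λ c≤ → ℚ.≤-<-trans c≤ (chord-neg s s′ h hp)) , (λ c≤ → ℚ.≤-<-trans c≤ (chord-neg s s′ h hq)) ]′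
      (proj₂ (interpolate-between (chord s s′ p) (chord s s′ q) 0≤t t≤1)))

private
  0<2ℚ : 0ℚ ℚ.< 2ℚ
  0<2ℚ = ℚ.positive⁻¹ 2ℚ

  p<q⇒0<q-p : ∀ {p q} → p ℚ.< q → 0ℚ ℚ.< q ℚ.- p
  p<q⇒0<q-p {p} {q} p<q = subst (ℚ._< q ℚ.- p) (ℚ.+-inverseʳ p) (ℚ.+-monoˡ-< (ℚ.- p) p<q)

  p≤q⇒0≤q-p : ∀ {p q} → p ℚ.≤ q → 0ℚ ℚ.≤ q ℚ.- p
  p≤q⇒0≤q-p {p} {q} p≤q = subst (ℚ._≤ q ℚ.- p) (ℚ.+-inverseʳ p) (ℚ.+-monoˡ-≤ (ℚ.- p) p≤q)

  *-nonneg : ∀ {p q} → 0ℚ ℚ.≤ p → 0ℚ ℚ.≤ q → 0ℚ ℚ.≤ p ℚ.* q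
  *-nonneg {p} {q} 0≤p 0≤q = ℚ.nonNegative⁻¹ _
    {{ℚ.nonNeg*nonNeg⇒nonNeg p {{ℚ.nonNegative 0≤p}} q {{ℚ.nonNegative 0≤q}}}}

  *-positive : ∀ {p q} → 0ℚ ℚ.< p → 0ℚ ℚ.< q → 0ℚ ℚ.< p ℚ.* q
  *-positive {p} {q} 0<p 0<q = ℚ.positive⁻¹ _
    {{ℚ.pos*pos⇒pos p {{ℚ.positive 0<p}} q {{ℚ.positive 0<q}}}}

  nonneg-cancel : ∀ {p w} → 0ℚ ℚ.< w → 0ℚ ℚ.≤ p ℚ.* w → 0ℚ ℚ.≤ p
  nonneg-cancel {p} {w} 0<w h = ℚ.*-cancelʳ-≤-pos w {{ℚ.positive 0<w}} (subst (ℚ._≤ p ℚ.* w) (sym (ℚ.*-zeroˡ w)) h)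

  neg-cancel : ∀ {p w} → 0ℚ ℚ.< w → p ℚ.* w ℚ.< 0ℚ → p ℚ.< 0ℚ
  neg-cancel {p} {w} 0<w h = ℚ.*-cancelʳ-<-nonNeg w {{ℚ.nonNegative (ℚ.<⇒≤ 0<w)}} (subst (p ℚ.* w ℚ.<_) (sym (ℚ.*-zeroˡ w)) h)

chord-outside : ∀ s s′ (i : Fin m) → s ≤ s′ → toℕ i ≤ s ⊎ s′ ≤ toℕ i →
  0ℚ ℚ.≤ chord (fromℕℚ s) (fromℕℚ s′) (circlePoint i)
chord-outside s s′ i s≤s′ out = nonneg-cancel (norm²-pos (toℕ i))
  (subst (0ℚ ℚ.≤_) (sym (chord-circlePoint (fromℕℚ s) (fromℕℚ s′) i)) (*-nonneg (ℚ.<⇒≤ 0<2ℚ) (prod out)))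
  where
  open +-*-Solver
  prod : toℕ i ≤ s ⊎ s′ ≤ toℕ i → 0ℚ ℚ.≤ (fromℕℚ (toℕ i) ℚ.- fromℕℚ s) ℚ.* (fromℕℚ (toℕ i) ℚ.- fromℕℚ s′)
  prod (inj₁ t≤s) = subst (0ℚ ℚ.≤_)
    (solve 3 (λ t s s′ → (s :- t) :* (s′ :- t) := (t :- s) :* (t :- s′)) refl (fromℕℚ (toℕ i)) (fromℕℚ s) (fromℕℚ s′))
    (*-nonneg (p≤q⇒0≤q-p (fromℕℚ-mono-≤ t≤s)) (p≤q⇒0≤q-p (fromℕℚ-mono-≤ (ℕ.≤-trans t≤s s≤s′))))
  prod (inj₂ s′≤t) = *-nonneg (p≤q⇒0≤q-p (fromℕℚ-mono-≤ (ℕ.≤-trans s≤s′ s′≤t))) (p≤q⇒0≤q-p (fromℕℚ-mono-≤ s′≤t))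

chord-inside : ∀ s s′ (i : Fin m) → s < toℕ i → toℕ i < s′ →
  chord (fromℕℚ s) (fromℕℚ s′) (circlePoint i) ℚ.< 0ℚ
chord-inside s s′ i s<t t<s′ = neg-cancel (norm²-pos (toℕ i))
  (subst (ℚ._< 0ℚ) (sym eq) (ℚ.neg-antimono-< (*-positive 0<2ℚ
    (*-positive (p<q⇒0<q-p (fromℕℚ-mono-< s<t)) (p<q⇒0<q-p (fromℕℚ-mono-< t<s′))))))
  where
  open +-*-Solver
  t = fromℕℚ (toℕ i)
  eq : chord (fromℕℚ s) (fromℕℚ s′) (circlePoint i) ℚ.* norm² (toℕ i)
       ≡ ℚ.- (2ℚ ℚ.* ((t ℚ.- fromℕℚ s) ℚ.* (fromℕℚ s′ ℚ.- t)))
  eq = trans (chord-circlePoint (fromℕℚ s) (fromℕℚ s′) i)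
    (solve 3 (λ t s s′ → con 2ℚ :* ((t :- s) :* (t :- s′)) := :- (con 2ℚ :* ((t :- s) :* (s′ :- t)))) refl t (fromℕℚ s) (fromℕℚ s′))

private
  -- Masses u and v are put at the two points and normalised by w⁻¹, the inverse of u + v. As X, Y
  -- and w⁻¹ are arguments of their own, two different pairs of masses can be shown to have
  -- literally the same centre.
  weighted : ∀ {S : Pred Point 0ℓ} {x y x′ y′} u v w⁻¹ X Y →
    0ℚ ℚ.≤ u → 0ℚ ℚ.≤ v → 0ℚ ℚ.≤ w⁻¹ → (u ℚ.+ v) ℚ.* w⁻¹ ≡ 1ℚ →
    ConvexHull S (x , y) → ConvexHull S (x′ , y′) →
    u ℚ.* x ℚ.+ v ℚ.* x′ ≡ X → u ℚ.* y ℚ.+ v ℚ.* y′ ≡ Y →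
    ConvexHull S (X ℚ.* w⁻¹ , Y ℚ.* w⁻¹)
  weighted {S} {x} {y} {x′} {y′} u v i X Y 0≤u 0≤v 0≤i ui p q refl refl =
    subst (ConvexHull S) (cong₂ _,_ (coord x x′) (coord y y′))
      (convex (v ℚ.* i) (*-nonneg 0≤v 0≤i) t≤1 p q)
    where
    open +-*-Solver
    open ≡-Reasoning
    t≤1 : v ℚ.* i ℚ.≤ 1ℚ
    t≤1 = subst₂ ℚ._≤_ (ℚ.+-identityˡ _) (trans (sym (ℚ.*-distribʳ-+ i u v)) ui)
      (ℚ.+-monoˡ-≤ (v ℚ.* i) (*-nonneg 0≤u 0≤i))
    coord : ∀ a b → (1ℚ ℚ.- v ℚ.* i) ℚ.* a ℚ.+ (v ℚ.* i) ℚ.* b ≡ (u ℚ.* a ℚ.+ v ℚ.* b) ℚ.* i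
    coord a b = begin
      (1ℚ ℚ.- v ℚ.* i) ℚ.* a ℚ.+ (v ℚ.* i) ℚ.* b
        ≡⟨ cong (λ o → (o ℚ.- v ℚ.* i) ℚ.* a ℚ.+ (v ℚ.* i) ℚ.* b) ui ⟨
      ((u ℚ.+ v) ℚ.* i ℚ.- v ℚ.* i) ℚ.* a ℚ.+ (v ℚ.* i) ℚ.* b
        ≡⟨ solve 5 (λ u v i a b → ((u :+ v) :* i :- v :* i) :* a :+ (v :* i) :* b := (u :* a :+ v :* b) :* i) refl u v i a b ⟩
      (u ℚ.* a ℚ.+ v ℚ.* b) ℚ.* i ∎

-- The four points (1 , t , t²) are linearly dependent, with Vandermonde
-- determinants as coefficients, and 1 + t², 1 − t² and t are linear in them.
crossing-hulls-meet : ∀ {S S′ : Pred Point 0ℓ} {a b c d : Fin m} →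
  a Fin.< b → b Fin.< c → c Fin.< d →
  S (circlePoint a) → S (circlePoint c) → S′ (circlePoint b) → S′ (circlePoint d) →
  ∃ λ p → ConvexHull S p × ConvexHull S′ p
crossing-hulls-meet {S = S} {S′} {a} {b} {c} {d} a<b b<c c<d Sa Sc S′b S′d =
  _ , weighted ua uc i (va ℚ.* ξ A ℚ.+ vc ℚ.* ξ C) (va ℚ.* η A ℚ.+ vc ℚ.* η C)
        (ℚ.<⇒≤ 0<ua) (ℚ.<⇒≤ 0<uc) 0≤i (ℚ.*-inverseʳ w {{w≠0}}) (point Sa) (point Sc)
        (cong₂ ℚ._+_ (scale-x va a) (scale-x vc c)) (cong₂ ℚ._+_ (scale-y va a) (scale-y vc c)) ,
      weighted ub ud i (va ℚ.* ξ A ℚ.+ vc ℚ.* ξ C) (va ℚ.* η A ℚ.+ vc ℚ.* η C)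
        (ℚ.<⇒≤ 0<ub) (ℚ.<⇒≤ 0<ud) 0≤i (trans (cong (ℚ._* i) (sym w-eq)) (ℚ.*-inverseʳ w {{w≠0}})) (point S′b) (point S′d)
        (trans (cong₂ ℚ._+_ (scale-x vb b) (scale-x vd d)) (sym ξ-eq))
        (trans (cong₂ ℚ._+_ (scale-y vb b) (scale-y vd d)) (sym η-eq))
  where
  open +-*-Solver
  A = fromℕℚ (toℕ a)
  B = fromℕℚ (toℕ b)
  C = fromℕℚ (toℕ c)
  D = fromℕℚ (toℕ d)
  ξ η : ℚ → ℚ
  ξ t = 1ℚ ℚ.- t ℚ.* t
  η t = ℚ.- (2ℚ ℚ.* t)
  0<b-a = p<q⇒0<q-p (fromℕℚ-mono-< a<b)
  0<c-b = p<q⇒0<q-p (fromℕℚ-mono-< b<c)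
  0<d-c = p<q⇒0<q-p (fromℕℚ-mono-< c<d)
  0<c-a = p<q⇒0<q-p (fromℕℚ-mono-< (ℕ.<-trans a<b b<c))
  0<d-b = p<q⇒0<q-p (fromℕℚ-mono-< (ℕ.<-trans b<c c<d))
  0<d-a = p<q⇒0<q-p (fromℕℚ-mono-< (ℕ.<-trans a<b (ℕ.<-trans b<c c<d)))
  -- Each coefficient is the Vandermonde product of the other three parameters. Signs in the linear
  -- relation alternate, so a and c fall on one side, b and d on the other, with all four
  -- coefficients positive.
  va = (C ℚ.- B) ℚ.* ((D ℚ.- B) ℚ.* (D ℚ.- C))
  vb = (C ℚ.- A) ℚ.* ((D ℚ.- A) ℚ.* (D ℚ.- C))
  vc = (B ℚ.- A) ℚ.* ((D ℚ.- A) ℚ.* (D ℚ.- B))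
  vd = (B ℚ.- A) ℚ.* ((C ℚ.- A) ℚ.* (C ℚ.- B))
  ua = va ℚ.* norm² (toℕ a)
  ub = vb ℚ.* norm² (toℕ b)
  uc = vc ℚ.* norm² (toℕ c)
  ud = vd ℚ.* norm² (toℕ d)
  0<ua : 0ℚ ℚ.< ua
  0<ua = *-positive (*-positive 0<c-b (*-positive 0<d-b 0<d-c)) (norm²-pos (toℕ a))
  0<ub : 0ℚ ℚ.< ub
  0<ub = *-positive (*-positive 0<c-a (*-positive 0<d-a 0<d-c)) (norm²-pos (toℕ b))
  0<uc : 0ℚ ℚ.< uc
  0<uc = *-positive (*-positive 0<b-a (*-positive 0<d-a 0<d-b)) (norm²-pos (toℕ c))
  0<ud : 0ℚ ℚ.< ud
  0<ud = *-positive (*-positive 0<b-a (*-positive 0<c-a 0<c-b)) (norm²-pos (toℕ d))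
  w = ua ℚ.+ uc
  0<w : 0ℚ ℚ.< w
  0<w = ℚ.+-mono-< 0<ua 0<uc
  w≠0 : ℚ.NonZero w
  w≠0 = ℚ.pos⇒nonZero w {{ℚ.positive 0<w}}
  i = (ℚ.1/ w) {{w≠0}}
  0≤i : 0ℚ ℚ.≤ i
  0≤i = ℚ.<⇒≤ (ℚ.positive⁻¹ i {{ℚ.1/pos⇒pos w {{ℚ.positive 0<w}}}})
  scale-x : ∀ v (e : Fin _) → (v ℚ.* norm² (toℕ e)) ℚ.* proj₁ (circlePoint e) ≡ v ℚ.* ξ (fromℕℚ (toℕ e))
  scale-x v e = trans (solve 3 (λ v n x → (v :* n) :* x := v :* (x :* n)) refl v (norm² (toℕ e)) (proj₁ (circlePoint e)))
    (cong (v ℚ.*_) (circlePoint-x e))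
  scale-y : ∀ v (e : Fin _) → (v ℚ.* norm² (toℕ e)) ℚ.* proj₂ (circlePoint e) ≡ v ℚ.* η (fromℕℚ (toℕ e))
  scale-y v e = trans (solve 3 (λ v n x → (v :* n) :* x := v :* (x :* n)) refl v (norm² (toℕ e)) (proj₂ (circlePoint e)))
    (cong (v ℚ.*_) (circlePoint-y e))
  w-eq : w ≡ ub ℚ.+ ud
  w-eq rewrite norm²-def (toℕ a) | norm²-def (toℕ b) | norm²-def (toℕ c) | norm²-def (toℕ d) =
    solve 4 (λ A B C D →
      ((C :- B) :* ((D :- B) :* (D :- C))) :* (con 1ℚ :+ A :* A) :+ ((B :- A) :* ((D :- A) :* (D :- B))) :* (con 1ℚ :+ C :* C)
      := ((C :- A) :* ((D :- A) :* (D :- C))) :* (con 1ℚ :+ B :* B) :+ ((B :- A) :* ((C :- A) :* (C :- B))) :* (con 1ℚ :+ D :* D))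
      refl A B C D
  ξ-eq : va ℚ.* ξ A ℚ.+ vc ℚ.* ξ C ≡ vb ℚ.* ξ B ℚ.+ vd ℚ.* ξ D
  ξ-eq = solve 4 (λ A B C D →
      ((C :- B) :* ((D :- B) :* (D :- C))) :* (con 1ℚ :- A :* A) :+ ((B :- A) :* ((D :- A) :* (D :- B))) :* (con 1ℚ :- C :* C)
      := ((C :- A) :* ((D :- A) :* (D :- C))) :* (con 1ℚ :- B :* B) :+ ((B :- A) :* ((C :- A) :* (C :- B))) :* (con 1ℚ :- D :* D))
      refl A B C D
  η-eq : va ℚ.* η A ℚ.+ vc ℚ.* η C ≡ vb ℚ.* η B ℚ.+ vd ℚ.* η D
  η-eq = solve 4 (λ A B C D →
      ((C :- B) :* ((D :- B) :* (D :- C))) :* (:- (con 2ℚ :* A)) :+ ((B :- A) :* ((D :- A) :* (D :- B))) :* (:- (con 2ℚ :* C))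
      := ((C :- A) :* ((D :- A) :* (D :- C))) :* (:- (con 2ℚ :* B)) :+ ((B :- A) :* ((C :- A) :* (C :- B))) :* (:- (con 2ℚ :* D)))
      refl A B C D

-- Finite search and the combinatorial form of the noncrossing condition

-- The order lives on A and is pulled back along f, so that one search yields maxima, minima (by
-- `flip-cmp`), extrema in a `CircularOrder` and least entries of vectors.
module Extremum {A : Set} {_⊏_ : Rel A 0ℓ}
  (⊏-trans : Transitive _⊏_) (⊏-cmp : Trichotomous _≡_ _⊏_) where

  ⊏-irrefl : ∀ {x} → ¬ x ⊏ x
  ⊏-irrefl {x} r with ⊏-cmp x x
  ... | tri< _ x≢x _ = x≢x refl
  ... | tri≈ ¬r _ _  = ¬r r
  ... | tri> _ x≢x _ = x≢x refl

  private
    search : ∀ {n} (f : Fin n → A) {P : Pred (Fin n) 0ℓ} → (∀ i → Dec (P i)) →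
      (∀ i → ¬ P i) ⊎ (∃ λ i → P i × ∀ j → P j → ¬ (f i ⊏ f j))
    search {zero} f P? = inj₁ λ ()
    search {suc n} f P? with P? zero | search (f ∘ suc) (P? ∘ suc)
    ... | no ¬p₀ | inj₁ none = inj₁ λ { zero → ¬p₀ ; (suc i) → none i }
    ... | no ¬p₀ | inj₂ (i , pᵢ , max) =
      inj₂ (suc i , pᵢ , λ { zero p₀ → contradiction p₀ ¬p₀ ; (suc j) → max j })
    ... | yes p₀ | inj₁ none =
      inj₂ (zero , p₀ , λ { zero _ → ⊏-irrefl ; (suc j) pⱼ → contradiction pⱼ (none j) })
    ... | yes p₀ | inj₂ (i , pᵢ , max) with ⊏-cmp (f zero) (f (suc i))
    ...   | tri< f₀<fᵢ _ ¬fᵢ<f₀ = inj₂ (suc i , pᵢ , λ { zero _ → ¬fᵢ<f₀ ; (suc j) → max j })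
    ...   | tri≈ _ f₀≡fᵢ _ = inj₂ (zero , p₀ , λ
            { zero _ → ⊏-irrefl ; (suc j) pⱼ f₀<fⱼ → max j pⱼ (subst (_⊏ f (suc j)) f₀≡fᵢ f₀<fⱼ) })
    ...   | tri> _ _ fᵢ<f₀ = inj₂ (zero , p₀ , λ
            { zero _ → ⊏-irrefl ; (suc j) pⱼ f₀<fⱼ → max j pⱼ (⊏-trans fᵢ<f₀ f₀<fⱼ) })

  maximal : ∀ {n} (f : Fin n → A) {P : Pred (Fin n) 0ℓ} → (∀ i → Dec (P i)) → ∀ {w} → P w →
    ∃ λ i → P i × ∀ j → P j → ¬ (f i ⊏ f j)
  maximal f P? {w} pw with search f P?
  ... | inj₁ none = contradiction pw (none w)
  ... | inj₂ r    = r

maximum : ∀ {P : Pred (Fin m) 0ℓ} → (∀ i → Dec (P i)) → ∀ {w} → P w →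
  ∃ λ i → P i × ∀ j → P j → j Fin.≤ i
maximum P? pw =
  let i , pᵢ , max = Extremum.maximal Fin.<-trans Fin.<-cmp id P? pw
  in i , pᵢ , λ j pⱼ → ℕ.≮⇒≥ (max j pⱼ)

flip-cmp : ∀ {A : Set} {_⊏_ : Rel A 0ℓ} → Trichotomous _≡_ _⊏_ → Trichotomous _≡_ (λ x y → y ⊏ x)
flip-cmp cmp x y with cmp x y
... | tri< a b c = tri> c b a
... | tri≈ a b c = tri≈ c b a
... | tri> a b c = tri< c b a

minimum : ∀ {P : Pred (Fin m) 0ℓ} → (∀ i → Dec (P i)) → ∀ {w} → P w →
  ∃ λ i → P i × ∀ j → P j → i Fin.≤ j
minimum P? pw =
  let i , pᵢ , min = Extremum.maximal (λ p q → Fin.<-trans q p) (flip-cmp Fin.<-cmp) id P? pw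
  in i , pᵢ , λ j pⱼ → ℕ.≮⇒≥ (min j pⱼ)

-- Were a and b in different blocks, the crossing chords from a to c and from b to d would give the
-- two hulls a common point.
noncrossing⇒crossingFree : (π : Partition m) → IsNoncrossing π → CrossingFree (Partition._∼_ π)
noncrossing⇒crossingFree π nc {a} {b} {c} {d} a<b b<c c<d a∼c b∼d with a ≟ b
  where open Partition π
... | yes a∼b = a∼b
... | no a≁b = contradiction (proj₂ meet) (nc a b a≁b)
  where
  open Partition π using (block) renaming (refl to ∼-refl)
  meet = crossing-hulls-meet {S = λ p → ∃ λ i → block a i × p ≡ circlePoint i}
    {S′ = λ p → ∃ λ i → block b i × p ≡ circlePoint i} a<b b<c c<d
    (a , ∼-refl , refl) (c , a∼c , refl) (b , ∼-refl , refl) (d , b∼d , refl)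

-- Of two distinct blocks take the one whose minimum b is larger, with maximum e. Crossing-freeness
-- keeps the other block out of the range from b to e, so the chord with parameters b - 1 and e + 1
-- has that block weakly on one side and the chosen block strictly on the other.
crossingFree⇒noncrossing : (π : Partition m) → CrossingFree (Partition._∼_ π) → IsNoncrossing π
crossingFree⇒noncrossing {m} π cf x y x≁y {p} (x∈ , y∈) with minimum (x ≟_) (∼-refl {x}) | minimum (y ≟_) (∼-refl {y})
  where open Partition π renaming (refl to ∼-refl)
... | a , x∼a , a-min | b , y∼b , b-min = main
  where
  open Partition π renaming (refl to ∼-refl; sym to ∼-sym; trans to ∼-trans)
  separate : ∀ {x y a b} → x ∼ a → y ∼ b → ¬ x ∼ y → (∀ j → y ∼ j → b Fin.≤ j) →
    a Fin.< b → ¬ (hull (block x) p × hull (block y) p)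
  separate {x} {y} {a} {suc b} x∼a y∼b x≁y b-min a<b (x∈ , y∈) with maximum (y ≟_) y∼b
  ... | e , y∼e , e-max = ℚ.<-irrefl refl (ℚ.<-≤-trans
      (chord-neg (fromℕℚ s) (fromℕℚ s′)
        (λ { (i , y∼i , refl) → chord-inside s s′ i (ℕ.s<s⁻¹ (ℕ.s≤s (b-min i y∼i))) (ℕ.s≤s (e-max i y∼i)) }) y∈)
      (chord-nonneg (fromℕℚ s) (fromℕℚ s′)
        (λ { (i , x∼i , refl) → chord-outside s s′ i (ℕ.≤-trans (ℕ.n≤1+n s) (ℕ.≤-trans (e-max _ y∼b) (ℕ.n≤1+n _))) (outside x∼i) }) x∈))
    where
    -- The minimum is matched as `suc b`, being greater than a, so s is one below it. The parameter
    -- s′ may equal m and belong to no point, which the chord allows.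
    s = toℕ b
    s′ = suc (toℕ e)
    outside : ∀ {i} → x ∼ i → toℕ i ≤ s ⊎ s′ ≤ toℕ i
    outside {i} x∼i with Fin.<-cmp i (suc b) | Fin.<-cmp e i
    ... | tri< i<b _ _    | _ = inj₁ (ℕ.s≤s⁻¹ i<b)
    ... | tri≈ _ refl _   | _ = contradiction (∼-trans x∼i (∼-sym y∼b)) x≁y
    ... | tri> _ _ _      | tri< e<i _ _  = inj₂ e<i
    ... | tri> _ _ _      | tri≈ _ refl _ = contradiction (∼-trans x∼i (∼-sym y∼e)) x≁y
    ... | tri> _ _ b<i    | tri> _ _ i<e  = contradiction
      (∼-trans x∼a (∼-trans (cf a<b b<i i<e (∼-trans (∼-sym x∼a) x∼i) (∼-trans (∼-sym y∼b) y∼e)) (∼-sym y∼b))) x≁y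
  main : _
  main with Fin.<-cmp a b
  ... | tri< a<b _ _  = separate x∼a y∼b x≁y b-min a<b (x∈ , y∈)
  ... | tri≈ _ refl _ = x≁y (∼-trans x∼a (∼-sym y∼b))
  ... | tri> _ _ b<a  = separate y∼b x∼a (x≁y ∘ ∼-sym) a-min b<a (y∈ , x∈)

module NCP {m} (ρ : NoncrossingPartition m) where
  open NoncrossingPartition ρ public
    renaming (refl to ∼-refl; sym to ∼-sym; trans to ∼-trans; _≟_ to _∼?_; reflexive to ∼-reflexive)
    using (_∼_; partition; isNoncrossing; block)

  crossingFree : CrossingFree _∼_
  crossingFree = noncrossing⇒crossingFree partition isNoncrossing

mkNCP : (_∼_ : Rel (Fin m) 0ℓ) → IsEquivalence _∼_ → Decidable _∼_ → CrossingFree _∼_ → NoncrossingPartition m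
mkNCP _∼_ eq dec cf = record { partition = π ; isNoncrossing = crossingFree⇒noncrossing π cf }
  where π = record { _∼_ = _∼_ ; isDecEquivalence = record { isEquivalence = eq ; _≟_ = dec } }

rel : NoncrossingPartition m → Rel (Fin m) 0ℓ
rel = NoncrossingPartition._∼_

infix 4 _⊑_

_⊑_ : Rel (NoncrossingPartition m) 0ℓ
ρ ⊑ ρ′ = rel ρ ⇒ rel ρ′

-- Kreweras complements

-- A linear order whose noncrossing relations are those of `CrossingFree`. The complement uses
-- nothing more, so `ascending` gives K, its opposite gives the inverse, and one proof shows them
-- inverse to each other in both directions.
record CircularOrder (m : ℕ) : Set₁ where
  infix 4 _⊏_
  field
    _⊏_     : Rel (Fin m) 0ℓ
    ⊏-trans : Transitive _⊏_
    ⊏-cmp   : Trichotomous _≡_ _⊏_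

  Planar : Rel (Fin m) 0ℓ → Set
  Planar _∼_ = ∀ {a b c d} → a ⊏ b → b ⊏ c → c ⊏ d → a ∼ c → b ∼ d → a ∼ b

  field
    planar⇒crossingFree : ∀ {_∼_} → IsEquivalence _∼_ → Planar _∼_ → CrossingFree _∼_
    crossingFree⇒planar : ∀ {_∼_} → IsEquivalence _∼_ → CrossingFree _∼_ → Planar _∼_

  open Extremum ⊏-trans ⊏-cmp public using (⊏-irrefl; maximal)

  _⊏?_ : Decidable _⊏_
  x ⊏? y with ⊏-cmp x y
  ... | tri< x⊏y _ _ = yes x⊏y
  ... | tri≈ x⊏̸y _ _ = no x⊏̸y
  ... | tri> x⊏̸y _ _ = no x⊏̸y

  ⊏-⋣-trans : ∀ {x y z} → x ⊏ y → ¬ (z ⊏ y) → x ⊏ z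
  ⊏-⋣-trans {x} {y} {z} x⊏y z⊏̸y with ⊏-cmp x z
  ... | tri< x⊏z _ _  = x⊏z
  ... | tri≈ _ refl _ = contradiction x⊏y z⊏̸y
  ... | tri> _ _ z⊏x  = contradiction (⊏-trans z⊏x x⊏y) z⊏̸y

  ⋣-⊏-trans : ∀ {x y z} → ¬ (y ⊏ x) → y ⊏ z → x ⊏ z
  ⋣-⊏-trans {x} {y} {z} y⊏̸x y⊏z with ⊏-cmp x z
  ... | tri< x⊏z _ _  = x⊏z
  ... | tri≈ _ refl _ = contradiction y⊏z y⊏̸x
  ... | tri> _ _ z⊏x  = contradiction (⊏-trans y⊏z z⊏x) y⊏̸x

  -- A point x stands here for the gap just after it, which the arc from z to w
  -- covers when z ≤ x < w.
  Under : Fin m → Fin m → Pred (Fin m) 0ℓ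
  Under z w x = ¬ (x ⊏ z) × x ⊏ w

  under? : ∀ z w x → Dec (Under z w x)
  under? z w x = ¬? (x ⊏? z) ×-dec (x ⊏? w)

ascending : CircularOrder m
ascending = record
  { _⊏_ = Fin._<_
  ; ⊏-trans = Fin.<-trans
  ; ⊏-cmp = Fin.<-cmp
  ; planar⇒crossingFree = λ _ → id
  ; crossingFree⇒planar = λ _ → id
  }

opposite : CircularOrder m → CircularOrder m
opposite O = record
  { _⊏_ = λ x y → y ⊏ x
  ; ⊏-trans = λ p q → ⊏-trans q p
  ; ⊏-cmp = flip-cmp ⊏-cmp
  ; planar⇒crossingFree = λ eq → planar⇒crossingFree eq ∘ reverse eq
  ; crossingFree⇒planar = λ eq → reverse eq ∘ crossingFree⇒planar eq
  }
  where
  open CircularOrder O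
  reverse : ∀ {m} {_⊏_ _∼_ : Rel (Fin m) 0ℓ} → IsEquivalence _∼_ →
    (∀ {a b c d} → a ⊏ b → b ⊏ c → c ⊏ d → a ∼ c → b ∼ d → a ∼ b) →
    ∀ {a b c d} → b ⊏ a → c ⊏ b → d ⊏ c → a ∼ c → b ∼ d → a ∼ b
  reverse eq planar b⊏a c⊏b d⊏c a∼c b∼d =
    E.trans a∼c (E.trans (E.sym (planar d⊏c c⊏b b⊏a (E.sym b∼d) (E.sym a∼c))) (E.sym b∼d))
    where module E = IsEquivalence eq

descending : CircularOrder m
descending = opposite ascending

module _ (O : CircularOrder m) where
  open CircularOrder O

  -- The Kreweras complement of ρ relative to τ, expressed by arcs: two gaps are joined when they
  -- lie in one block of τ and under the same arcs of ρ. In this form antitonicity in ρ is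
  -- immediate.
  complement : NoncrossingPartition m → NoncrossingPartition m → NoncrossingPartition m
  complement τ ρ = mkNCP _∼_ isEq dec (planar⇒crossingFree isEq planar)
    where
    module τ = NCP τ
    _∼_ : Rel (Fin m) 0ℓ
    x ∼ y = x τ.∼ y × (∀ z w → rel ρ z w → (Under z w x → Under z w y) × (Under z w y → Under z w x))
    isEq : IsEquivalence _∼_
    isEq = record
      { refl  = τ.∼-refl , λ z w _ → id , id
      ; sym   = λ (p , f) → τ.∼-sym p , λ z w r → swap (f z w r)
      ; trans = λ (p , f) (q , g) → τ.∼-trans p q ,
          λ z w r → proj₁ (g z w r) ∘ proj₁ (f z w r) , proj₂ (f z w r) ∘ proj₂ (g z w r)
      }
    dec : Decidable _∼_
    dec x y = (x τ.∼? y) ×-dec Fin.all? λ z → Fin.all? λ w → NCP._∼?_ ρ z w →-dec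
      ((under? z w x →-dec under? z w y) ×-dec (under? z w y →-dec under? z w x))
    planar : Planar _∼_
    planar {a} {b} {c} {d} a⊏b b⊏c c⊏d (a∼c , ac) (b∼d , bd) =
      crossingFree⇒planar (Partition.isEquivalence τ.partition) τ.crossingFree a⊏b b⊏c c⊏d a∼c b∼d ,
      λ z w r →
        (λ (a⊏̸z , a⊏w) → (λ b⊏z → a⊏̸z (⊏-trans a⊏b b⊏z)) ,
          ⊏-trans b⊏c (proj₂ (proj₁ (ac z w r) (a⊏̸z , a⊏w)))) ,
        (λ (b⊏̸z , b⊏w) → proj₁ (proj₂ (ac z w r)
            ((λ c⊏z → b⊏̸z (⊏-trans b⊏c c⊏z)) , ⊏-trans c⊏d (proj₂ (proj₁ (bd z w r) (b⊏̸z , b⊏w))))) ,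
          ⊏-trans a⊏b b⊏w)

  complement-⊑ : ∀ τ ρ → complement τ ρ ⊑ τ
  complement-⊑ τ ρ = proj₁

  complement-antitone : ∀ τ {ρ ρ′} → ρ ⊑ ρ′ → complement τ ρ′ ⊑ complement τ ρ
  complement-antitone τ ρ⊑ρ′ (p , f) = p , λ z w r → f z w (ρ⊑ρ′ r)

module _ (O : CircularOrder m) (τ ρ : NoncrossingPartition m) (ρ⊑τ : ρ ⊑ τ) where
  open CircularOrder O

  private
    module τ = NCP τ
    module ρ = NCP ρ
    κ = complement O τ ρ
    κ′ = complement (opposite O) τ κ
    module κ′ = NCP κ′

    planarρ : Planar ρ._∼_
    planarρ = crossingFree⇒planar (Partition.isEquivalence ρ.partition) ρ.crossingFree

    planarτ : Planar τ._∼_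
    planarτ = crossingFree⇒planar (Partition.isEquivalence τ.partition) τ.crossingFree

  -- In the opposite order a point stands for the gap just before it, which is the side on which a
  -- point of ρ lies from the gap of κ with the same index. An arc z-w of κ separating x from y
  -- would make the arc of ρ between x and y cover just one of the gaps z and w.
  complement-inverse⁻ : ρ ⊑ complement (opposite O) τ (complement O τ ρ)
  complement-inverse⁻ {x} {y} x∼y = ρ⊑τ x∼y , λ z w z∼w → dir x∼y z∼w , dir (ρ.∼-sym x∼y) z∼w
    where
    dir : ∀ {x y z w} → x ρ.∼ y → rel κ z w →
      ¬ (z ⊏ x) × w ⊏ x → ¬ (z ⊏ y) × w ⊏ y
    dir {x} {y} {z} {w} x∼y (_ , f) (z⊏̸x , w⊏x) = z⊏̸y , w⊏y
      where
      z⊏̸y : ¬ (z ⊏ y)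
      z⊏̸y z⊏y = proj₁ (proj₁ (f x y x∼y) (z⊏̸x , z⊏y)) w⊏x
      w⊏y : w ⊏ y
      w⊏y with w ⊏? y
      ... | yes w⊏y = w⊏y
      ... | no w⊏̸y = contradiction (proj₂ (proj₂ (f y x (ρ.∼-sym x∼y)) (w⊏̸y , w⊏x))) z⊏̸x

  -- If p is the last point before a block of ρ in its block of τ, then p and
  -- the last point of the block of ρ stand for gaps that no arc of ρ separates.
  private
    around : ∀ {p b e} → p τ.∼ b → p ⊏ b → (∀ j → j τ.∼ b → j ⊏ b → ¬ (p ⊏ j)) →
      b ρ.∼ e → (∀ j → b ρ.∼ j → ¬ (j ⊏ b)) → (∀ j → b ρ.∼ j → ¬ (e ⊏ j)) → rel κ p e
    around {p} {b} {e} p∼b p⊏b p-max b∼e b-min e-max = τ.∼-trans p∼b (ρ⊑τ b∼e) , λ z w z∼w → fwd z∼w , bwd z∼w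
      where
      p⊏e : p ⊏ e
      p⊏e = ⊏-⋣-trans p⊏b (b-min e b∼e)
      fwd : ∀ {z w} → z ρ.∼ w → Under z w p → Under z w e
      fwd {z} {w} z∼w (p⊏̸z , p⊏w) = (λ e⊏z → p⊏̸z (⊏-trans p⊏e e⊏z)) , e⊏w
        where
        z⊏b : z ⊏ b
        z⊏b = ⋣-⊏-trans p⊏̸z p⊏b
        z∉ : ¬ (b ρ.∼ z)
        z∉ b∼z = b-min z b∼z z⊏b
        e⊏w : e ⊏ w
        e⊏w with ⊏-cmp e w | ⊏-cmp w b | ⊏-cmp z p
        ... | tri< e⊏w _ _  | _ | _ = e⊏w
        ... | tri≈ _ refl _ | _ | _ = contradiction (ρ.∼-trans b∼e (ρ.∼-sym z∼w)) z∉
        ... | tri> _ _ w⊏e  | tri≈ _ refl _ | _ = contradiction (ρ.∼-sym z∼w) z∉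
        ... | tri> _ _ w⊏e  | tri> _ _ b⊏w | _ = contradiction (ρ.∼-sym (planarρ z⊏b b⊏w w⊏e z∼w b∼e)) z∉
        ... | tri> _ _ w⊏e  | tri< w⊏b _ _ | tri> _ _ p⊏z = contradiction p⊏z p⊏̸z
        ... | tri> _ _ w⊏e  | tri< w⊏b _ _ | tri≈ _ refl _ =
          contradiction p⊏w (p-max w (τ.∼-trans (τ.∼-sym (ρ⊑τ z∼w)) p∼b) w⊏b)
        ... | tri> _ _ w⊏e  | tri< w⊏b _ _ | tri< z⊏p _ _ =
          contradiction p⊏w (p-max w (τ.∼-trans (τ.∼-sym (ρ⊑τ z∼w)) (τ.∼-trans (planarτ z⊏p p⊏w w⊏b (ρ⊑τ z∼w) p∼b) p∼b)) w⊏b)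
      bwd : ∀ {z w} → z ρ.∼ w → Under z w e → Under z w p
      bwd {z} {w} z∼w (e⊏̸z , e⊏w) = p⊏̸z , ⊏-trans p⊏e e⊏w
        where
        w∉ : ¬ (b ρ.∼ w)
        w∉ b∼w = e-max w b∼w e⊏w
        p⊏̸z : ¬ (p ⊏ z)
        p⊏̸z p⊏z with ⊏-cmp z b | ⊏-cmp z e
        ... | tri≈ _ refl _ | _ = w∉ z∼w
        ... | tri> _ _ b⊏z  | tri< z⊏e _ _ = w∉ (ρ.∼-trans (planarρ b⊏z z⊏e e⊏w b∼e z∼w) z∼w)
        ... | tri> _ _ b⊏z  | tri≈ _ refl _ = w∉ (ρ.∼-trans b∼e z∼w)
        ... | tri> _ _ b⊏z  | tri> _ _ e⊏z = e⊏̸z e⊏z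
        ... | tri< z⊏b _ _  | _ = p-max z (τ.∼-trans (τ.∼-sym (planarτ p⊏z z⊏b (⋣-⊏-trans (b-min e b∼e) e⊏w) p∼b (ρ⊑τ z∼w))) p∼b) z⊏b p⊏z

  -- Let a ⊏ b be the first points of two blocks of ρ inside one block of τ. By `around` the
  -- predecessor of b in that block of τ and the last point of the block of b are joined in κ. This
  -- arc covers b but not a, as a comes no later than the predecessor.
  complement-inverse : complement (opposite O) τ (complement O τ ρ) ⊑ ρ
  complement-inverse {x} {y} x∼y = main (first x) (first y)
    where
    First : Fin m → Set
    First x = ∃ λ a → x ρ.∼ a × ∀ j → x ρ.∼ j → ¬ (j ⊏ a)
    first : ∀ x → First x
    first x = CircularOrder.maximal (opposite O) id (x ρ.∼?_) ρ.∼-refl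
    separated : ∀ {x y a b} → x ρ.∼ a → y ρ.∼ b → (∀ j → y ρ.∼ j → ¬ (j ⊏ b)) → a ⊏ b → ¬ rel κ′ x y
    separated {x} {y} {a} {b} x∼a y∼b b-min a⊏b x∼y = p-max a (a∼τb , a⊏b) (proj₂ (proj₂ (proj₂ a∼b p e′ p∼e) e-under))
      where
      a∼b : rel κ′ a b
      a∼b = κ′.∼-trans (κ′.∼-sym (complement-inverse⁻ x∼a)) (κ′.∼-trans x∼y (complement-inverse⁻ y∼b))
      a∼τb : a τ.∼ b
      a∼τb = proj₁ a∼b
      last = maximal id (b ρ.∼?_) {b} ρ.∼-refl
      pred = maximal id (λ j → (j τ.∼? b) ×-dec (j ⊏? b)) (a∼τb , a⊏b)
      p = proj₁ last
      e′ = proj₁ pred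
      b-min′ : ∀ j → b ρ.∼ j → ¬ (j ⊏ b)
      b-min′ j b∼j = b-min j (ρ.∼-trans y∼b b∼j)
      p-max : ∀ j → j τ.∼ b × j ⊏ b → ¬ (e′ ⊏ j)
      p-max = proj₂ (proj₂ pred)
      p∼e : rel κ p e′
      p∼e = NCP.∼-sym κ (around (proj₁ (proj₁ (proj₂ pred))) (proj₂ (proj₁ (proj₂ pred))) (λ j q r → p-max j (q , r))
        (proj₁ (proj₂ last)) b-min′ (proj₂ (proj₂ last)))
      e-under : ¬ (p ⊏ b) × e′ ⊏ b
      e-under = b-min′ p (proj₁ (proj₂ last)) , proj₂ (proj₁ (proj₂ pred))
    main : First x → First y → x ρ.∼ y
    main (a , x∼a , a-min) (b , y∼b , b-min) with ⊏-cmp a b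
    ... | tri< a⊏b _ _  = contradiction x∼y (separated x∼a y∼b b-min a⊏b)
    ... | tri≈ _ refl _ = ρ.∼-trans x∼a (ρ.∼-sym y∼b)
    ... | tri> _ _ b⊏a  = contradiction (κ′.∼-sym x∼y) (separated y∼b x∼a a-min b⊏a)

-- Reflections

record Mirror {m} (U : Pred (Fin m) 0ℓ) : Set where
  field
    mirror     : Fin m → Fin m
    involutive : ∀ x → mirror (mirror x) ≡ x
    preserves  : ∀ {x} → U x → U (mirror x)
    fixes      : ∀ {x} → ¬ U x → mirror x ≡ x
    antitone   : ∀ {x y} → U x → U y → x Fin.< y → mirror y Fin.< mirror x

module SwapEnds {m} (a b : Fin m) (r : Fin m → Fin m) where
  swapEnds : Fin m → Fin m
  swapEnds x with x Fin.≟ a | x Fin.≟ b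
  ... | yes _ | _     = b
  ... | no _  | yes _ = a
  ... | no _  | no _  = r x

  swapEnds-a : swapEnds a ≡ b
  swapEnds-a with a Fin.≟ a | a Fin.≟ b
  ... | yes _ | _ = refl
  ... | no ¬p | _ = contradiction refl ¬p

  swapEnds-b : swapEnds b ≡ a
  swapEnds-b with b Fin.≟ a | b Fin.≟ b
  ... | yes p | _     = p
  ... | no _  | yes _ = refl
  ... | no _  | no ¬p = contradiction refl ¬p

  swapEnds-else : ∀ {x} → x ≢ a → x ≢ b → swapEnds x ≡ r x
  swapEnds-else {x} x≢a x≢b with x Fin.≟ a | x Fin.≟ b
  ... | yes p | _     = contradiction p x≢a
  ... | no _  | yes p = contradiction p x≢b
  ... | no _  | no _  = refl

  swapEnds-involutive : (∀ x → r (r x) ≡ x) → (∀ {x} → x ≢ a → x ≢ b → r x ≢ a × r x ≢ b) →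
    ∀ x → swapEnds (swapEnds x) ≡ x
  swapEnds-involutive inv avoid x with x Fin.≟ a | x Fin.≟ b
  ... | yes refl | _        = swapEnds-b
  ... | no _     | yes refl = swapEnds-a
  ... | no x≢a   | no x≢b   = trans (swapEnds-else (proj₁ (avoid x≢a x≢b)) (proj₂ (avoid x≢a x≢b))) (inv x)

-- Exchange the extremes and reverse the interior recursively. The bound is the fuel: U starts at m
-- - len or later, and removing the least element raises its start; for len = 0 the set is empty.
mirror-on : ∀ len (U : Pred (Fin m) 0ℓ) → (∀ x → Dec (U x)) → (∀ x → U x → m ≤ len ℕ.+ toℕ x) → Mirror U
mirror-on zero U U? bound = record
  { mirror = id ; involutive = λ _ → refl ; preserves = id ; fixes = λ _ → refl
  ; antitone = λ {x} Ux _ _ → contradiction (Fin.toℕ<n x) (ℕ.≤⇒≯ (bound x Ux)) }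
mirror-on {m} (suc len) U U? bound with Fin.any? U?
... | no ¬∃U = record
  { mirror = id ; involutive = λ _ → refl ; preserves = id ; fixes = λ _ → refl
  ; antitone = λ {x} Ux _ _ → contradiction (x , Ux) ¬∃U }
... | yes (w , Uw) with minimum U? Uw | maximum U? Uw
...   | a , Ua , a-min | b , Ub , b-max = record
  { mirror = swapEnds ; involutive = swapEnds-involutive M.involutive avoid
  ; preserves = preserves ; fixes = fixes ; antitone = antitone }
  where
  U′ : Pred (Fin m) 0ℓ
  U′ x = U x × x ≢ a × x ≢ b
  above : ∀ {x} → U′ x → a Fin.< x
  above (Ux , x≢a , _) = ℕ.≤∧≢⇒< (a-min _ Ux) (λ eq → x≢a (Fin.toℕ-injective (sym eq)))
  below : ∀ {x} → U′ x → x Fin.< b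
  below (Ux , _ , x≢b) = ℕ.≤∧≢⇒< (b-max _ Ux) (λ eq → x≢b (Fin.toℕ-injective eq))
  bound′ : ∀ x → U′ x → m ≤ len ℕ.+ toℕ x
  bound′ x U′x = ℕ.≤-trans (bound a Ua) (subst (_≤ len ℕ.+ toℕ x) (ℕ.+-suc len (toℕ a)) (ℕ.+-monoʳ-≤ len (above U′x)))
  module M = Mirror (mirror-on len U′ (λ x → U? x ×-dec (¬? (x Fin.≟ a) ×-dec ¬? (x Fin.≟ b))) bound′)
  open SwapEnds a b M.mirror
  avoid : ∀ {x} → x ≢ a → x ≢ b → M.mirror x ≢ a × M.mirror x ≢ b
  avoid {x} x≢a x≢b with U? x
  ... | yes Ux = proj₂ (M.preserves (Ux , x≢a , x≢b))
  ... | no ¬Ux = subst (λ y → y ≢ a × y ≢ b) (sym (M.fixes (¬Ux ∘ proj₁))) (x≢a , x≢b)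
  preserves : ∀ {x} → U x → U (swapEnds x)
  preserves {x} Ux with x Fin.≟ a | x Fin.≟ b
  ... | yes _  | _      = Ub
  ... | no _   | yes _  = Ua
  ... | no x≢a | no x≢b = proj₁ (M.preserves (Ux , x≢a , x≢b))
  fixes : ∀ {x} → ¬ U x → swapEnds x ≡ x
  fixes {x} ¬Ux = trans (swapEnds-else (λ { refl → ¬Ux Ua }) (λ { refl → ¬Ux Ub })) (M.fixes (¬Ux ∘ proj₁))
  antitone : ∀ {x y} → U x → U y → x Fin.< y → swapEnds y Fin.< swapEnds x
  antitone {x} {y} Ux Uy x<y = main (x Fin.≟ a) (y Fin.≟ b)
    where
    x≢b : x ≢ b
    x≢b refl = ℕ.<⇒≱ x<y (b-max y Uy)
    y≢a : y ≢ a
    y≢a refl = ℕ.<⇒≱ x<y (a-min x Ux)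
    main : Dec (x ≡ a) → Dec (y ≡ b) → swapEnds y Fin.< swapEnds x
    main (yes refl) (yes refl) = subst₂ Fin._<_ (sym swapEnds-b) (sym swapEnds-a) x<y
    main (yes refl) (no y≢b) = subst₂ Fin._<_ (sym (swapEnds-else y≢a y≢b)) (sym swapEnds-a)
      (below (M.preserves (Uy , y≢a , y≢b)))
    main (no x≢a) (yes refl) = subst₂ Fin._<_ (sym swapEnds-b) (sym (swapEnds-else x≢a x≢b))
      (above (M.preserves (Ux , x≢a , x≢b)))
    main (no x≢a) (no y≢b) = subst₂ Fin._<_ (sym (swapEnds-else y≢a y≢b)) (sym (swapEnds-else x≢a x≢b))
      (M.antitone (Ux , x≢a , x≢b) (Uy , y≢a , y≢b) x<y)

Alone : Fin m → Pred (NoncrossingPartition m) 0ℓ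
Alone x ρ = ∀ z → rel ρ x z → z ≡ x

module Reflect (P Q : Fin m) (Q≡1+P : toℕ Q ≡ suc (toℕ P)) (κ : NoncrossingPartition m)
  (κ≤Q : ∀ {x} → rel κ Q x → x Fin.≤ Q) (P∼Q : rel κ P Q) where

  private
    module κ = NCP κ

    P<Q : P Fin.< Q
    P<Q = ℕ.≤-reflexive (sym Q≡1+P)

    U : Pred (Fin m) 0ℓ
    U x = x Fin.< P × x κ.∼ Q

    U? : ∀ x → Dec (U x)
    U? x = (x Fin.<? P) ×-dec (x κ.∼? Q)

    module M = Mirror (mirror-on m U U? (λ x _ → ℕ.m≤m+n m (toℕ x)))
    open SwapEnds P Q M.mirror

    U⇒≢ : ∀ {x} → U x → x ≢ P × x ≢ Q
    U⇒≢ (x<P , _) = (λ { refl → ℕ.<-irrefl refl x<P }) , (λ { refl → ℕ.<-asym x<P P<Q })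

    avoid : ∀ {x} → x ≢ P → x ≢ Q → M.mirror x ≢ P × M.mirror x ≢ Q
    avoid {x} x≢P x≢Q with U? x
    ... | yes Ux = U⇒≢ (M.preserves Ux)
    ... | no ¬Ux = subst (λ y → y ≢ P × y ≢ Q) (sym (M.fixes ¬Ux)) (x≢P , x≢Q)

    s : Fin m → Fin m
    s = swapEnds

    s-involutive : ∀ x → s (s x) ≡ x
    s-involutive = swapEnds-involutive M.involutive avoid

    s-U : ∀ {x} → U x → s x ≡ M.mirror x
    s-U Ux = swapEnds-else (proj₁ (U⇒≢ Ux)) (proj₂ (U⇒≢ Ux))

    s-fix : ∀ {x} → ¬ x κ.∼ Q → s x ≡ x
    s-fix x≁Q = trans (swapEnds-else (λ { refl → x≁Q P∼Q }) (λ { refl → x≁Q κ.∼-refl })) (M.fixes (x≁Q ∘ proj₂))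

    ∼s : ∀ x → x κ.∼ s x
    ∼s x with x Fin.≟ P | x Fin.≟ Q
    ... | yes refl | _        = P∼Q
    ... | no _     | yes refl = κ.∼-sym P∼Q
    ... | no _     | no _ with U? x
    ...   | yes Ux = κ.∼-trans (proj₂ Ux) (κ.∼-sym (proj₂ (M.preserves Ux)))
    ...   | no ¬Ux = κ.∼-reflexive (sym (M.fixes ¬Ux))

    ≤P : ∀ {x : Fin m} → x Fin.< Q → x Fin.≤ P
    ≤P {x} x<Q = ℕ.s≤s⁻¹ (subst (suc (toℕ x) ≤_) Q≡1+P x<Q)

  -- Requiring x and y to be related in κ as well puts the result below κ for every π and confines
  -- crossings to one block of κ. Outside the block of Q nothing moves; inside it the cyclic order
  -- is reversed.
  reflect : NoncrossingPartition m → NoncrossingPartition m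
  reflect π = mkNCP _∼_ isEq (λ x y → (x κ.∼? y) ×-dec (s x π.∼? s y)) cf
    where
    module π = NCP π
    _∼_ : Rel (Fin m) 0ℓ
    x ∼ y = x κ.∼ y × s x π.∼ s y
    isEq : IsEquivalence _∼_
    isEq = record
      { refl  = κ.∼-refl , π.∼-refl
      ; sym   = λ (p , q) → κ.∼-sym p , π.∼-sym q
      ; trans = λ (p , q) (p′ , q′) → κ.∼-trans p p′ , π.∼-trans q q′
      }
    cf : CrossingFree _∼_
    cf {a} {b} {c} {d} a<b b<c c<d (a∼c , sa∼sc) (b∼d , sb∼sd) = a∼b , main (a κ.∼? Q)
      where
      a∼b : a κ.∼ b
      a∼b = κ.crossingFree a<b b<c c<d a∼c b∼d
      main : Dec (a κ.∼ Q) → s a π.∼ s b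
      main (no a≁Q) = subst₂ π._∼_ (sym (s-fix a≁Q)) (sym (s-fix b≁Q))
        (π.crossingFree a<b b<c c<d (subst₂ π._∼_ (s-fix a≁Q) (s-fix c≁Q) sa∼sc) (subst₂ π._∼_ (s-fix b≁Q) (s-fix d≁Q) sb∼sd))
        where
        b≁Q = λ b∼Q → a≁Q (κ.∼-trans a∼b b∼Q)
        c≁Q = λ c∼Q → a≁Q (κ.∼-trans a∼c c∼Q)
        d≁Q = λ d∼Q → b≁Q (κ.∼-trans b∼d d∼Q)
      main (yes a∼Q) = position (Fin.<-cmp d P) (Fin.<-cmp c P)
        where
        b∼Q = κ.∼-trans (κ.∼-sym a∼b) a∼Q
        c∼Q = κ.∼-trans (κ.∼-sym a∼c) a∼Q
        d∼Q = κ.∼-trans (κ.∼-sym b∼d) b∼Q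
        c≤P : c Fin.≤ P
        c≤P = ≤P {c} (ℕ.<-≤-trans c<d (κ≤Q (κ.∼-sym d∼Q)))
        Ub : U b
        Ub = ℕ.<-≤-trans b<c c≤P , b∼Q
        Ua : U a
        Ua = ℕ.<-trans a<b (proj₁ Ub) , a∼Q
        antitone : ∀ {x y} → U x → U y → x Fin.< y → s y Fin.< s x
        antitone Ux Uy x<y = subst₂ Fin._<_ (sym (s-U Uy)) (sym (s-U Ux)) (M.antitone Ux Uy x<y)
        s<P : ∀ {x} → U x → s x Fin.< P
        s<P {x} Ux = subst (λ y → y Fin.< P) (sym (s-U Ux)) (proj₁ (M.preserves Ux))
        beyond : U c → s a Fin.< s d → s a π.∼ s b
        beyond Uc sa<sd = π.∼-trans sa∼sc (π.crossingFree (antitone Ub Uc b<c) (antitone Ua Ub a<b) sa<sd (π.∼-sym sa∼sc) sb∼sd)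
        -- The images of a, b, c, d always come in a rotation of the order d, c, b, a: s reverses
        -- the elements below P and exchanges P and Q, which stay above those. Which rotation it is
        -- depends on how many of c and d are P or Q.
        position : Tri (d Fin.< P) (d ≡ P) (P Fin.< d) → Tri (c Fin.< P) (c ≡ P) (P Fin.< c) → s a π.∼ s b
        position _ (tri> _ _ P<c) = contradiction P<c (ℕ.≤⇒≯ c≤P)
        position (tri< d<P _ _) _ = π.∼-trans sa∼sc (π.∼-trans
          (π.∼-sym (π.crossingFree (antitone Uc Ud c<d) (antitone Ub Uc b<c) (antitone Ua Ub a<b) (π.∼-sym sb∼sd) (π.∼-sym sa∼sc)))
          (π.∼-sym sb∼sd))
          where
          Uc : U c
          Uc = ℕ.<-trans c<d d<P , c∼Q
          Ud : U d
          Ud = d<P , d∼Q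
        position (tri≈ _ refl _) _ = beyond (c<d , c∼Q) (subst (s a Fin.<_) (sym swapEnds-a) (ℕ.<-trans (s<P Ua) P<Q))
        position (tri> _ _ P<d) (tri< c<P _ _) = beyond (c<P , c∼Q) (subst (s a Fin.<_) (sym sd≡P) (s<P Ua))
          where
          sd≡P : s d ≡ P
          sd≡P = trans (cong s (Fin.toℕ-injective (ℕ.≤-antisym (κ≤Q (κ.∼-sym d∼Q)) (subst (_≤ toℕ d) (sym Q≡1+P) P<d)))) swapEnds-b
        position (tri> _ _ P<d) (tri≈ _ refl _) =
          π.∼-sym (π.crossingFree (antitone Ua Ub a<b) (subst (s a Fin.<_) (sym sd≡P) (s<P Ua))
            (subst₂ Fin._<_ (sym sd≡P) (sym swapEnds-a) P<Q) sb∼sd sa∼sc)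
          where
          sd≡P : s d ≡ P
          sd≡P = trans (cong s (Fin.toℕ-injective (ℕ.≤-antisym (κ≤Q (κ.∼-sym d∼Q)) (subst (_≤ toℕ d) (sym Q≡1+P) P<d)))) swapEnds-b

  reflect-⊑ : ∀ π → reflect π ⊑ κ
  reflect-⊑ π = proj₁

  reflect-monotone : ∀ {π π′} → π ⊑ π′ → reflect π ⊑ reflect π′
  reflect-monotone π⊑π′ (p , q) = p , π⊑π′ q

  reflect-involutive : ∀ {π} → π ⊑ κ → reflect (reflect π) ⊑ π × π ⊑ reflect (reflect π)
  reflect-involutive {π} π⊑κ =
    (λ {x} {y} (_ , _ , q) → subst₂ (rel π) (s-involutive x) (s-involutive y) q) ,
    (λ {x} {y} x∼y → π⊑κ x∼y , κ.∼-trans (κ.∼-sym (∼s x)) (κ.∼-trans (π⊑κ x∼y) (∼s y)) ,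
      subst₂ (rel π) (sym (s-involutive x)) (sym (s-involutive y)) x∼y)

  reflect-joined : ∀ {π} → rel (reflect π) P Q ⟺ rel π P Q
  reflect-joined {π} = mk⇔
    (λ (_ , q) → π.∼-sym (subst₂ π._∼_ swapEnds-a swapEnds-b q))
    (λ q → P∼Q , subst₂ π._∼_ (sym swapEnds-a) (sym swapEnds-b) (π.∼-sym q))
    where module π = NCP π

  reflect-alone : ∀ {π} → π ⊑ κ → Alone P (reflect π) ⟺ Alone Q π
  reflect-alone {π} π⊑κ = mk⇔
    (λ alone z Q∼z → trans (sym (s-involutive z)) (trans (cong s (alone (s z)
      (κ.∼-trans P∼Q (κ.∼-trans (π⊑κ Q∼z) (∼s z)) , subst₂ (rel π) (sym swapEnds-a) (sym (s-involutive z)) Q∼z))) swapEnds-a))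
    (λ alone z (_ , q) → trans (sym (s-involutive z)) (trans (cong s (alone (s z) (subst (λ y → rel π y (s z)) swapEnds-a q))) swapEnds-b))

-- Duality of intervals of noncrossing partitions

⊑-trans : ∀ (ρ₁ ρ₂ ρ₃ : NoncrossingPartition m) → ρ₁ ⊑ ρ₂ → ρ₂ ⊑ ρ₃ → ρ₁ ⊑ ρ₃
⊑-trans _ _ _ f g r = g (f r)

≈-sym : ∀ (ρ₁ ρ₂ : NoncrossingPartition m) → ρ₁ ≈ₙ ρ₂ → ρ₂ ≈ₙ ρ₁
≈-sym _ _ = swap

≈-trans : ∀ (ρ₁ ρ₂ ρ₃ : NoncrossingPartition m) → ρ₁ ≈ₙ ρ₂ → ρ₂ ≈ₙ ρ₃ → ρ₁ ≈ₙ ρ₃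
≈-trans _ _ _ (f , f′) (g , g′) = (λ r → g (f r)) , (λ r → f′ (g′ r))

Antitone Monotone : (NoncrossingPartition m → NoncrossingPartition m) → Set₁
Antitone f = ∀ {ρ ρ′} → ρ ⊑ ρ′ → f ρ′ ⊑ f ρ
Monotone f = ∀ {ρ ρ′} → ρ ⊑ ρ′ → f ρ ⊑ f ρ′

antitone-cong : ∀ {f : NoncrossingPartition m → NoncrossingPartition m} → Antitone f →
  ∀ ρ ρ′ → ρ ≈ₙ ρ′ → f ρ ≈ₙ f ρ′
antitone-cong anti ρ ρ′ (p , q) = anti {ρ′} {ρ} q , anti {ρ} {ρ′} p

monotone-cong : ∀ {f : NoncrossingPartition m → NoncrossingPartition m} → Monotone f →
  ∀ ρ ρ′ → ρ ≈ₙ ρ′ → f ρ ≈ₙ f ρ′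
monotone-cong mono ρ ρ′ (p , q) = mono {ρ} {ρ′} p , mono {ρ′} {ρ} q

record Automorphism (κ : NoncrossingPartition m) : Set₁ where
  field
    to from       : NoncrossingPartition m → NoncrossingPartition m
    to-monotone   : Monotone to
    from-monotone : Monotone from
    to-⊑          : ∀ π → π ⊑ κ → to π ⊑ κ
    from-⊑        : ∀ π → π ⊑ κ → from π ⊑ κ
    from-to       : ∀ π → π ⊑ κ → from (to π) ≈ₙ π
    to-from       : ∀ π → π ⊑ κ → to (from π) ≈ₙ π

identity : (κ : NoncrossingPartition m) → Automorphism κ
identity κ = record
  { to = id ; from = id ; to-monotone = id ; from-monotone = id ; to-⊑ = λ _ → id ; from-⊑ = λ _ → id
  ; from-to = λ _ _ → id , id ; to-from = λ _ _ → id , id }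

module _ (τ : NoncrossingPartition m) where
  K K′ : NoncrossingPartition m → NoncrossingPartition m
  K = complement ascending τ
  K′ = complement descending τ

  K-antitone : Antitone K
  K-antitone {ρ} {ρ′} = complement-antitone ascending τ {ρ} {ρ′}

  K′-antitone : Antitone K′
  K′-antitone {ρ} {ρ′} = complement-antitone descending τ {ρ} {ρ′}

  K′K : ∀ ρ → ρ ⊑ τ → K′ (K ρ) ≈ₙ ρ
  K′K ρ ρ⊑τ = complement-inverse ascending τ ρ ρ⊑τ , complement-inverse⁻ ascending τ ρ ρ⊑τ

  KK′ : ∀ ρ → ρ ⊑ τ → K (K′ ρ) ≈ₙ ρ
  KK′ ρ ρ⊑τ = complement-inverse descending τ ρ ρ⊑τ , complement-inverse⁻ descending τ ρ ρ⊑τ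

module Dual (σ τ : NoncrossingPartition m) (σ⊑τ : σ ⊑ τ) (A : Automorphism (K τ σ)) where
  open Automorphism A

  κ : NoncrossingPartition m
  κ = K τ σ

  κ⊑τ : κ ⊑ τ
  κ⊑τ = complement-⊑ ascending τ σ

  private
    π-of : NoncrossingPartition m → NoncrossingPartition m
    π-of ρ = to (K′ κ (K τ ρ))

    π-of-⊑ : ∀ ρ → π-of ρ ⊑ κ
    π-of-⊑ ρ = to-⊑ (K′ κ (K τ ρ)) (complement-⊑ descending κ (K τ ρ))

  -- `K τ` and `K′ τ` invert each other below τ, so φ and ψ both start with `K τ` and end with
  -- `K′ τ`. In between ψ undoes the automorphism first and then `K′ κ`.
  φ ψ : NoncrossingPartition m → NoncrossingPartition m
  φ ρ = K′ τ (to (K′ κ (K τ ρ)))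
  ψ ρ = K′ τ (K κ (from (K τ ρ)))

  φ-antitone : Antitone φ
  φ-antitone {ρ} {ρ′} ρ⊑ρ′ = K′-antitone τ {π-of ρ} {π-of ρ′} (to-monotone {K′ κ (K τ ρ)} {K′ κ (K τ ρ′)}
    (K′-antitone κ {K τ ρ′} {K τ ρ} (K-antitone τ {ρ} {ρ′} ρ⊑ρ′)))

  ψ-antitone : Antitone ψ
  ψ-antitone {ρ} {ρ′} ρ⊑ρ′ = K′-antitone τ {K κ (from (K τ ρ))} {K κ (from (K τ ρ′))}
    (K-antitone κ {from (K τ ρ′)} {from (K τ ρ)} (from-monotone {K τ ρ′} {K τ ρ} (K-antitone τ {ρ} {ρ′} ρ⊑ρ′)))

  φ-⊑ : ∀ ρ → φ ρ ⊑ τ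
  φ-⊑ ρ = complement-⊑ descending τ (π-of ρ)

  ψ-⊑ : ∀ ρ → ψ ρ ⊑ τ
  ψ-⊑ ρ = complement-⊑ descending τ (K κ (from (K τ ρ)))

  private
    σ⊑K′ : ∀ π → π ⊑ κ → σ ⊑ K′ τ π
    σ⊑K′ π π⊑κ = ⊑-trans σ (K′ τ κ) (K′ τ π) (proj₂ (K′K τ σ σ⊑τ)) (K′-antitone τ {π} {κ} π⊑κ)

  φ-⊒ : ∀ ρ → σ ⊑ φ ρ
  φ-⊒ ρ = σ⊑K′ (π-of ρ) (π-of-⊑ ρ)

  ψ-⊒ : ∀ ρ → σ ⊑ ψ ρ
  ψ-⊒ ρ = σ⊑K′ (K κ (from (K τ ρ))) (complement-⊑ ascending κ (from (K τ ρ)))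

  ψφ : ∀ ρ → σ ⊑ ρ → ρ ⊑ τ → ψ (φ ρ) ≈ₙ ρ
  ψφ ρ σ⊑ρ ρ⊑τ = ≈-trans (ψ (φ ρ)) (K′ τ (K τ ρ)) ρ
    (antitone-cong {f = K′ τ} (λ {a} {b} → K′-antitone τ {a} {b}) (K κ (from (K τ (φ ρ)))) (K τ ρ) inner)
    (K′K τ ρ ρ⊑τ)
    where
    Kρ⊑κ : K τ ρ ⊑ κ
    Kρ⊑κ = K-antitone τ {σ} {ρ} σ⊑ρ
    y = K′ κ (K τ ρ)
    y⊑κ : y ⊑ κ
    y⊑κ = complement-⊑ descending κ (K τ ρ)
    inner : K κ (from (K τ (φ ρ))) ≈ₙ K τ ρ
    inner = ≈-trans (K κ (from (K τ (φ ρ)))) (K κ y) (K τ ρ)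
      (antitone-cong {f = K κ} (λ {a} {b} → K-antitone κ {a} {b}) (from (K τ (φ ρ))) y
        (≈-trans (from (K τ (φ ρ))) (from (to y)) y
          (monotone-cong {f = from} (λ {a} {b} → from-monotone {a} {b}) (K τ (φ ρ)) (to y)
            (KK′ τ (to y) (⊑-trans (to y) κ τ (to-⊑ y y⊑κ) κ⊑τ)))
          (from-to y y⊑κ)))
      (KK′ κ (K τ ρ) Kρ⊑κ)

  φψ : ∀ ρ → σ ⊑ ρ → ρ ⊑ τ → φ (ψ ρ) ≈ₙ ρ
  φψ ρ σ⊑ρ ρ⊑τ = ≈-trans (φ (ψ ρ)) (K′ τ (K τ ρ)) ρ
    (antitone-cong {f = K′ τ} (λ {a} {b} → K′-antitone τ {a} {b}) (π-of (ψ ρ)) (K τ ρ) inner)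
    (K′K τ ρ ρ⊑τ)
    where
    Kρ⊑κ : K τ ρ ⊑ κ
    Kρ⊑κ = K-antitone τ {σ} {ρ} σ⊑ρ
    y = from (K τ ρ)
    y⊑κ : y ⊑ κ
    y⊑κ = from-⊑ (K τ ρ) Kρ⊑κ
    Kκy⊑κ : K κ y ⊑ κ
    Kκy⊑κ = complement-⊑ ascending κ y
    inner : π-of (ψ ρ) ≈ₙ K τ ρ
    inner = ≈-trans (π-of (ψ ρ)) (to y) (K τ ρ)
      (monotone-cong {f = to} (λ {a} {b} → to-monotone {a} {b}) (K′ κ (K τ (ψ ρ))) y
        (≈-trans (K′ κ (K τ (ψ ρ))) (K′ κ (K κ y)) y
          (antitone-cong {f = K′ κ} (λ {a} {b} → K′-antitone κ {a} {b}) (K τ (ψ ρ)) (K κ y)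
            (KK′ τ (K κ y) (⊑-trans (K κ y) κ τ Kκy⊑κ κ⊑τ)))
          (K′K κ y y⊑κ)))
      (to-from (K τ ρ) Kρ⊑κ)

-- The two properties at P and Q, and their behaviour under complements

module Consecutive (P Q : Fin m) (Q≡1+P : toℕ Q ≡ suc (toℕ P)) where
  private
    P<Q : P Fin.< Q
    P<Q = ℕ.≤-reflexive (sym Q≡1+P)

    <Q⇒≤P : ∀ (x : Fin m) → x Fin.< Q → x Fin.≤ P
    <Q⇒≤P x x<Q = ℕ.s≤s⁻¹ (subst (suc (toℕ x) ≤_) Q≡1+P x<Q)

    P<⇒Q≤ : ∀ (x : Fin m) → P Fin.< x → Q Fin.≤ x
    P<⇒Q≤ x P<x = subst (_≤ toℕ x) (sym Q≡1+P) P<x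

  Joined : Pred (NoncrossingPartition m) 0ℓ
  Joined ρ = rel ρ P Q

  Supported : Pred (NoncrossingPartition m) 0ℓ
  Supported ρ = ∀ {x y} → rel ρ x y → x ≡ y ⊎ (x Fin.≤ Q × y Fin.≤ Q)

  -- Only the point Q lies between the gaps after P and after Q, so an arc of ρ over exactly one of
  -- them has Q as an endpoint. In a supported ρ the other end cannot be above Q.
  joined-K : ∀ τ ρ → Supported ρ → Joined τ → Joined (K τ ρ) ⟺ Alone Q ρ
  joined-K τ ρ supp P∼Q = mk⇔ fwd λ alone → P∼Q , λ z w z∼w → ltr alone z∼w , rtl z∼w
    where
    module ρ = NCP ρ
    fwd : Joined (K τ ρ) → Alone Q ρ
    fwd (_ , f) z Q∼z with Fin.<-cmp z Q
    ... | tri≈ _ z≡Q _ = z≡Q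
    ... | tri< z<Q _ _ = contradiction
      (proj₂ (proj₁ (f z Q (ρ.∼-sym Q∼z)) (ℕ.≤⇒≯ (<Q⇒≤P z z<Q) , P<Q))) (ℕ.<-irrefl refl)
    ... | tri> _ _ Q<z with supp Q∼z
    ...   | inj₁ Q≡z       = sym Q≡z
    ...   | inj₂ (_ , z≤Q) = contradiction Q<z (ℕ.≤⇒≯ z≤Q)
    ltr : Alone Q ρ → ∀ {z w} → z ρ.∼ w → ¬ (P Fin.< z) × P Fin.< w → ¬ (Q Fin.< z) × Q Fin.< w
    ltr alone {z} {w} z∼w (P≮z , P<w) = (λ Q<z → P≮z (ℕ.<-trans P<Q Q<z)) , Q<w
      where
      Q<w : Q Fin.< w
      Q<w with Fin.<-cmp Q w
      ... | tri< Q<w _ _  = Q<w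
      ... | tri≈ _ refl _ = contradiction (subst (P Fin.<_) (sym (alone z (ρ.∼-sym z∼w))) P<Q) P≮z
      ... | tri> _ _ w<Q  = contradiction P<w (ℕ.≤⇒≯ (<Q⇒≤P w w<Q))
    rtl : ∀ {z w} → z ρ.∼ w → ¬ (Q Fin.< z) × Q Fin.< w → ¬ (P Fin.< z) × P Fin.< w
    rtl z∼w (Q≮z , Q<w) with supp z∼w
    ... | inj₁ refl      = contradiction Q<w Q≮z
    ... | inj₂ (_ , w≤Q) = contradiction Q<w (ℕ.≤⇒≯ w≤Q)

  -- The descending order speaks of the gaps before P and before Q, with only the point P between
  -- them; hence the condition moves from Q to P.
  joined-K′ : ∀ τ ρ → Joined τ → Joined (K′ τ ρ) ⟺ Alone P ρ
  joined-K′ τ ρ P∼Q = mk⇔ fwd λ alone → P∼Q , λ z w z∼w → ltr alone z∼w , rtl alone z∼w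
    where
    module ρ = NCP ρ
    fwd : Joined (K′ τ ρ) → Alone P ρ
    fwd (_ , f) z P∼z with Fin.<-cmp z P
    ... | tri≈ _ z≡P _ = z≡P
    ... | tri< z<P _ _ = contradiction P<Q (proj₁ (proj₁ (f P z P∼z) (ℕ.<-irrefl refl , z<P)))
    ... | tri> _ _ P<z = contradiction
      (proj₂ (proj₂ (f z P (ρ.∼-sym P∼z)) (ℕ.≤⇒≯ (P<⇒Q≤ z P<z) , P<Q))) (ℕ.<-irrefl refl)
    ltr : Alone P ρ → ∀ {z w} → z ρ.∼ w → ¬ (z Fin.< P) × w Fin.< P → ¬ (z Fin.< Q) × w Fin.< Q
    ltr alone {z} {w} z∼w (z≮P , w<P) = z≮Q , ℕ.<-trans w<P P<Q
      where
      z≮Q : ¬ (z Fin.< Q)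
      z≮Q z<Q with Fin.toℕ-injective (ℕ.≤-antisym (<Q⇒≤P z z<Q) (ℕ.≮⇒≥ z≮P))
      ... | refl = ℕ.<-irrefl (cong toℕ (alone w z∼w)) w<P
    rtl : Alone P ρ → ∀ {z w} → z ρ.∼ w → ¬ (z Fin.< Q) × w Fin.< Q → ¬ (z Fin.< P) × w Fin.< P
    rtl alone {z} {w} z∼w (z≮Q , w<Q) = (λ z<P → z≮Q (ℕ.<-trans z<P P<Q)) , ℕ.≤∧≢⇒< (<Q⇒≤P w w<Q) w≢P
      where
      w≢P : toℕ w ≢ toℕ P
      w≢P eq with Fin.toℕ-injective eq
      ... | refl = z≮Q (subst (Fin._< Q) (sym (alone z (ρ.∼-sym z∼w))) P<Q)

  module _ (σ τ : NoncrossingPartition m) (σ⊑τ : σ ⊑ τ) (supp : Supported τ)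
    (joined : Joined τ) (alone : Alone Q σ) where

    private
      κ = K τ σ
      P∼Q : Joined κ
      P∼Q = Equivalence.from (joined-K τ σ (supp ∘ σ⊑τ) joined) alone
      supp-κ : Supported κ
      supp-κ = supp ∘ complement-⊑ ascending τ σ
      κ≤Q : ∀ {x} → rel κ Q x → x Fin.≤ Q
      κ≤Q Q∼x with supp-κ Q∼x
      ... | inj₁ refl = ℕ.≤-refl
      ... | inj₂ (_ , x≤Q) = x≤Q
      module R = Reflect P Q Q≡1+P κ κ≤Q P∼Q

    reflection : Automorphism κ
    reflection = record
      { to = R.reflect ; from = R.reflect
      ; to-monotone = λ {π} {π′} → R.reflect-monotone {π} {π′}
      ; from-monotone = λ {π} {π′} → R.reflect-monotone {π} {π′}
      ; to-⊑ = λ π _ → R.reflect-⊑ π ; from-⊑ = λ π _ → R.reflect-⊑ π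
      ; from-to = λ π → R.reflect-involutive {π} ; to-from = λ π → R.reflect-involutive {π} }

    module D = Dual σ τ σ⊑τ reflection

    -- Write π for the partition to be reflected. The condition passes from P and Q joined in φ ρ,
    -- to {P} a block of the reflection of π, to {Q} a block of π, to P and Q joined in `K κ π`,
    -- which is `K τ ρ`, to {Q} a block of ρ.
    φ-joined : ∀ ρ → σ ⊑ ρ → ρ ⊑ τ → Joined (D.φ ρ) ⟺ Alone Q ρ
    φ-joined ρ σ⊑ρ ρ⊑τ = mk⇔
      (λ j → K⇒ (proj₁ (KK′ κ (K τ ρ) Kρ⊑κ) (Equivalence.from κ⇔ (Equivalence.to r⇔ (Equivalence.to o⇔ j)))))
      (λ a → Equivalence.from o⇔ (Equivalence.from r⇔ (Equivalence.to κ⇔ (proj₂ (KK′ κ (K τ ρ) Kρ⊑κ) (K⇐ a)))))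
      where
      Kρ⊑κ : K τ ρ ⊑ κ
      Kρ⊑κ = K-antitone τ {σ} {ρ} σ⊑ρ
      π = K′ κ (K τ ρ)
      π⊑κ : π ⊑ κ
      π⊑κ = complement-⊑ descending κ (K τ ρ)
      o⇔ = joined-K′ τ (R.reflect π) joined
      r⇔ = R.reflect-alone {π} π⊑κ
      κ⇔ = joined-K κ π (supp-κ ∘ π⊑κ) P∼Q
      K⇒ = Equivalence.to (joined-K τ ρ (supp ∘ ρ⊑τ) joined)
      K⇐ = Equivalence.from (joined-K τ ρ (supp ∘ ρ⊑τ) joined)

    -- Here `K′ τ` and `K′ κ` are applied to the same partition and pose the same condition at P,
    -- and the latter gives back y. The reflection enters only through mapping the pair of P and Q
    -- to itself.
    ψ-joined : ∀ ρ → σ ⊑ ρ → ρ ⊑ τ → Joined (D.ψ ρ) ⟺ Alone Q ρ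
    ψ-joined ρ σ⊑ρ ρ⊑τ = mk⇔
      (λ j → K⇒ (Equivalence.to r⇔ (proj₁ (K′K κ y y⊑κ) (Equivalence.from κ⇔ (Equivalence.to o⇔ j)))))
      (λ a → Equivalence.from o⇔ (Equivalence.to κ⇔ (proj₂ (K′K κ y y⊑κ) (Equivalence.from r⇔ (K⇐ a)))))
      where
      y = R.reflect (K τ ρ)
      y⊑κ : y ⊑ κ
      y⊑κ = R.reflect-⊑ (K τ ρ)
      o⇔ = joined-K′ τ (K κ y) joined
      κ⇔ = joined-K′ κ (K κ y) P∼Q
      r⇔ = R.reflect-joined {K τ ρ}
      K⇒ = Equivalence.to (joined-K τ ρ (supp ∘ ρ⊑τ) joined)
      K⇐ = Equivalence.from (joined-K τ ρ (supp ∘ ρ⊑τ) joined)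

-- Admissible partitions

pred-suc : ∀ (y : Fin m) → 0 < toℕ y → toℕ y ≡ suc (toℕ (Fin.pred y))
pred-suc (suc i) _ = cong suc (sym (Fin.toℕ-inject₁ i))

pred-≤ : ∀ (y : Fin m) → Fin.pred y Fin.≤ y
pred-≤ zero = ℕ.z≤n
pred-≤ (suc i) = ℕ.≤-trans (ℕ.≤-reflexive (Fin.toℕ-inject₁ i)) (ℕ.n≤1+n (toℕ i))

<⇒≤pred : ∀ {x y : Fin m} → x Fin.< y → x Fin.≤ Fin.pred y
<⇒≤pred {x = x} {y} x<y = ℕ.s≤s⁻¹ (subst (suc (toℕ x) ≤_) (pred-suc y (ℕ.≤-<-trans ℕ.z≤n x<y)) x<y)

Minimal : NoncrossingPartition m → Pred (Fin m) 0ℓ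
Minimal ρ y = ∀ z → rel ρ z y → y Fin.≤ z

minimal? : ∀ (ρ : NoncrossingPartition m) y → Dec (Minimal ρ y)
minimal? ρ y = Fin.all? λ z → NCP._∼?_ ρ z y →-dec (y Fin.≤? z)

-- Here Q is the index of the number k + 1, and P that of k.
module Admissibility {m} (Q : Fin m) (0<Q : 0 < toℕ Q) where

  P : Fin m
  P = Fin.pred Q

  open Consecutive P Q (pred-suc Q 0<Q) public

  Admissible : Pred (NoncrossingPartition m) 0ℓ
  Admissible ρ = ∀ y → Q Fin.< y → rel ρ (Fin.pred y) y ⊎ Minimal ρ y

  -- The restriction to {0, ..., Q} remains a partition of all of `Fin m`, with singletons above Q,
  -- so that complements need no change of ground set.
  base : NoncrossingPartition m → NoncrossingPartition m
  base ρ = mkNCP _∼_ isEq (λ x y → (x Fin.≟ y) ⊎-dec ((x Fin.≤? Q) ×-dec ((y Fin.≤? Q) ×-dec (x ρ.∼? y)))) cf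
    where
    module ρ = NCP ρ
    _∼_ : Rel (Fin m) 0ℓ
    x ∼ y = x ≡ y ⊎ (x Fin.≤ Q × y Fin.≤ Q × x ρ.∼ y)
    isEq : IsEquivalence _∼_
    isEq = record
      { refl  = inj₁ refl
      ; sym   = λ { (inj₁ eq) → inj₁ (sym eq) ; (inj₂ (p , q , r)) → inj₂ (q , p , ρ.∼-sym r) }
      ; trans = λ { (inj₁ refl) r → r ; r (inj₁ refl) → r
                  ; (inj₂ (p , _ , r)) (inj₂ (_ , q , r′)) → inj₂ (p , q , ρ.∼-trans r r′) }
      }
    cf : CrossingFree _∼_
    cf a<b b<c c<d (inj₁ refl) _ = contradiction (ℕ.<-trans a<b b<c) (ℕ.<-irrefl refl)
    cf a<b b<c c<d (inj₂ _) (inj₁ refl) = contradiction (ℕ.<-trans b<c c<d) (ℕ.<-irrefl refl)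
    cf a<b b<c c<d (inj₂ (a≤Q , _ , r)) (inj₂ (b≤Q , _ , r′)) = inj₂ (a≤Q , b≤Q , ρ.crossingFree a<b b<c c<d r r′)

  base-⊑ : ∀ ρ → base ρ ⊑ ρ
  base-⊑ ρ (inj₁ refl) = NCP.∼-refl ρ
  base-⊑ ρ (inj₂ (_ , _ , r)) = r

  base-monotone : Monotone base
  base-monotone ρ⊑ρ′ (inj₁ eq) = inj₁ eq
  base-monotone ρ⊑ρ′ (inj₂ (p , q , r)) = inj₂ (p , q , ρ⊑ρ′ r)

  base-supported : ∀ ρ → Supported (base ρ)
  base-supported ρ (inj₁ eq) = inj₁ eq
  base-supported ρ (inj₂ (p , q , _)) = inj₂ (p , q)

  joined-base : ∀ ρ → Joined (base ρ) ⟺ Joined ρ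
  joined-base ρ = mk⇔ (base-⊑ ρ) λ j → inj₂ (pred-≤ Q , ℕ.≤-refl , j)

  -- Everything above Q has been cut off, so a minimal Q has no partner left.
  alone-base : ∀ ρ → Alone Q (base ρ) ⟺ Minimal ρ Q
  alone-base ρ = mk⇔ to from
    where
    to : Alone Q (base ρ) → Minimal ρ Q
    to alone z z∼Q with z Fin.≤? Q
    ... | yes z≤Q = ℕ.≤-reflexive (cong toℕ (sym (alone z (inj₂ (ℕ.≤-refl , z≤Q , NCP.∼-sym ρ z∼Q)))))
    ... | no z≰Q  = ℕ.<⇒≤ (ℕ.≰⇒> z≰Q)
    from : Minimal ρ Q → Alone Q (base ρ)
    from min z (inj₁ eq) = sym eq
    from min z (inj₂ (_ , z≤Q , Q∼z)) = Fin.toℕ-injective (ℕ.≤-antisym z≤Q (min z (NCP.∼-sym ρ Q∼z)))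

  record Links : Set₁ where
    field
      Linked  : Pred (Fin m) 0ℓ
      linked? : ∀ y → Dec (Linked y)
      linked> : ∀ {y} → Linked y → Q Fin.< y

  links : NoncrossingPartition m → Links
  links ρ = record
    { Linked = λ y → Q Fin.< y × rel ρ (Fin.pred y) y
    ; linked? = λ y → (Q Fin.<? y) ×-dec (NCP._∼?_ ρ (Fin.pred y) y)
    ; linked> = proj₁
    }

  Linked : NoncrossingPartition m → Pred (Fin m) 0ℓ
  Linked ρ = Links.Linked (links ρ)

  module Extend (L : Links) where
    open Links L renaming (Linked to S)

    private
      unlinked : ∀ {y} → y Fin.≤ Q → ¬ S y
      unlinked y≤Q Sy = ℕ.<⇒≱ (linked> Sy) y≤Q

      search : ∀ y → ∃ λ u → (u Fin.≤ y × ¬ S u) × ∀ v → v Fin.≤ y × ¬ S v → v Fin.≤ u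
      search y with y Fin.≤? Q
      ... | yes y≤Q = maximum (λ u → (u Fin.≤? y) ×-dec ¬? (linked? u)) (ℕ.≤-refl {toℕ y} , unlinked y≤Q)
      ... | no y≰Q  = maximum (λ u → (u Fin.≤? y) ×-dec ¬? (linked? u))
        (ℕ.<⇒≤ (ℕ.≰⇒> y≰Q) , unlinked {Q} ℕ.≤-refl)

    -- The start of the run of consecutive links that ends at y. It exists because elements up to Q
    -- are unlinked.
    root : Fin m → Fin m
    root y = proj₁ (search y)

    root-≤ : ∀ y → root y Fin.≤ y
    root-≤ y = proj₁ (proj₁ (proj₂ (search y)))

    root-unlinked : ∀ y → ¬ S (root y)
    root-unlinked y = proj₂ (proj₁ (proj₂ (search y)))

    root-max : ∀ {u} y → u Fin.≤ y → ¬ S u → u Fin.≤ root y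
    root-max {u} y u≤y ¬Su = proj₂ (proj₂ (search y)) u (u≤y , ¬Su)

    root-fixed : ∀ {y} → ¬ S y → root y ≡ y
    root-fixed {y} ¬Sy = Fin.toℕ-injective (ℕ.≤-antisym (root-≤ y) (root-max y ℕ.≤-refl ¬Sy))

    root-step : ∀ {y} → S y → root y ≡ root (Fin.pred y)
    root-step {y} Sy = Fin.toℕ-injective (ℕ.≤-antisym
      (root-max (Fin.pred y) (<⇒≤pred (ℕ.≤∧≢⇒< (root-≤ y) (λ eq → root-unlinked y (subst S (sym (Fin.toℕ-injective eq)) Sy)))) (root-unlinked y))
      (root-max y (ℕ.≤-trans (root-≤ (Fin.pred y)) (pred-≤ y)) (root-unlinked (Fin.pred y))))

    root-monotone : ∀ {x y} → x Fin.≤ y → root x Fin.≤ root y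
    root-monotone {x} {y} x≤y = root-max y (ℕ.≤-trans (root-≤ x) x≤y) (root-unlinked x)

    root-∼ : ∀ ρ → (∀ {y} → S y → rel ρ (Fin.pred y) y) → ∀ y → rel ρ (root y) y
    root-∼ ρ link y = go (toℕ y) y ℕ.≤-refl
      where
      module ρ = NCP ρ
      go : ∀ n y → toℕ y ≤ n → rel ρ (root y) y
      go n y y≤n with linked? y
      go n y y≤n | no ¬Sy = ρ.∼-reflexive (root-fixed ¬Sy)
      go zero y y≤0 | yes Sy = contradiction (ℕ.<-≤-trans (linked> Sy) y≤0) λ ()
      go (suc n) y y≤n | yes Sy = subst (λ r → rel ρ r y) (sym (root-step Sy))
        (ρ.∼-trans (go n (Fin.pred y) (ℕ.s≤s⁻¹ (subst (_≤ suc n) (pred-suc y (ℕ.≤-<-trans ℕ.z≤n (linked> Sy))) y≤n))) (link Sy))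

    -- Pulling B back along `root` creates no crossing because `root` is monotone: four increasing
    -- points have weakly increasing roots, and if neighbouring roots coincide the conclusion is
    -- immediate.
    extend : NoncrossingPartition m → NoncrossingPartition m
    extend B = mkNCP (λ x y → root x B.∼ root y)
      (record { refl = B.∼-refl ; sym = B.∼-sym ; trans = B.∼-trans })
      (λ x y → root x B.∼? root y) cf
      where
      module B = NCP B
      cf : CrossingFree (λ x y → root x B.∼ root y)
      cf {a} {b} {c} {d} a<b b<c c<d a∼c b∼d with root a Fin.≟ root b | root b Fin.≟ root c | root c Fin.≟ root d
      ... | yes eq | _ | _ = B.∼-reflexive eq
      ... | no _ | yes eq | _ = B.∼-trans a∼c (B.∼-reflexive (sym eq))
      ... | no _ | no _ | yes eq = B.∼-trans a∼c (B.∼-trans (B.∼-reflexive eq) (B.∼-sym b∼d))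
      ... | no a≢b | no b≢c | no c≢d = B.crossingFree (strict a<b a≢b) (strict b<c b≢c) (strict c<d c≢d) a∼c b∼d
        where
        strict : ∀ {x y} → x Fin.< y → root x ≢ root y → root x Fin.< root y
        strict x<y ne = ℕ.≤∧≢⇒< (root-monotone (ℕ.<⇒≤ x<y)) (ne ∘ Fin.toℕ-injective)

    extend-⊑ : ∀ B ρ → B ⊑ ρ → (∀ {y} → S y → rel ρ (Fin.pred y) y) → extend B ⊑ ρ
    extend-⊑ B ρ B⊑ρ link {x} {y} r = ρ.∼-trans (ρ.∼-sym (root-∼ ρ link x)) (ρ.∼-trans (B⊑ρ r) (root-∼ ρ link y))
      where module ρ = NCP ρ

    base-extend : ∀ B → Supported B → base (extend B) ≈ₙ B
    base-extend B supp = to , from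
      where
      root≡ : ∀ {x} → x Fin.≤ Q → root x ≡ x
      root≡ x≤Q = root-fixed (unlinked x≤Q)
      to : base (extend B) ⊑ B
      to (inj₁ refl) = NCP.∼-refl B
      to (inj₂ (x≤Q , y≤Q , r)) = subst₂ (rel B) (root≡ x≤Q) (root≡ y≤Q) r
      from : B ⊑ base (extend B)
      from r with supp r
      ... | inj₁ eq = inj₁ eq
      ... | inj₂ (x≤Q , y≤Q) = inj₂ (x≤Q , y≤Q , subst₂ (rel B) (sym (root≡ x≤Q)) (sym (root≡ y≤Q)) r)

    extend-linked⁻ : ∀ B {y} → S y → rel (extend B) (Fin.pred y) y
    extend-linked⁻ B Sy = NCP.∼-reflexive B (sym (root-step Sy))

    extend-minimal : ∀ B → Supported B → ∀ {y} → Q Fin.< y → ¬ S y → Minimal (extend B) y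
    extend-minimal B supp {y} Q<y ¬Sy z r with supp (subst (rel B (root z)) (root-fixed ¬Sy) r)
    ... | inj₁ eq = ℕ.≤-trans (ℕ.≤-reflexive (cong toℕ (sym eq))) (root-≤ z)
    ... | inj₂ (_ , y≤Q) = contradiction Q<y (ℕ.≤⇒≯ y≤Q)

    extend-linked : ∀ B → Supported B → ∀ {y} → Linked (extend B) y → S y
    extend-linked B supp {y} (Q<y , r) with linked? y
    ... | yes Sy = Sy
    ... | no ¬Sy = contradiction (extend-minimal B supp Q<y ¬Sy (Fin.pred y) r)
      (ℕ.<⇒≱ (ℕ.≤-reflexive (sym (pred-suc y (ℕ.≤-<-trans ℕ.z≤n Q<y)))))

    extend-admissible : ∀ B → Supported B → Admissible (extend B)
    extend-admissible B supp y Q<y with linked? y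
    ... | yes Sy = inj₁ (extend-linked⁻ B Sy)
    ... | no ¬Sy = inj₂ (extend-minimal B supp Q<y ¬Sy)

  open Extend using (extend; extend-⊑; base-extend; extend-linked⁻; extend-linked; extend-admissible)

  -- A root above Q is unlinked, hence minimal by admissibility, so two related roots are both at
  -- most Q or equal. Together with `extend-⊑` this recovers ρ from its base and its links.
  ⊑-extend : ∀ ρ → Admissible ρ → ρ ⊑ extend (links ρ) (base ρ)
  ⊑-extend ρ adm {x} {y} x∼y = main (r x Fin.≤? Q) (r y Fin.≤? Q)
    where
    module ρ = NCP ρ
    open Extend (links ρ) renaming (root to r)
    r∼r : rel ρ (r x) (r y)
    r∼r = ρ.∼-trans (root-∼ ρ proj₂ x) (ρ.∼-trans x∼y (ρ.∼-sym (root-∼ ρ proj₂ y)))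
    root-minimal : ∀ x → ¬ (r x Fin.≤ Q) → Minimal ρ (r x)
    root-minimal x rx≰Q with adm (r x) (ℕ.≰⇒> rx≰Q)
    ... | inj₁ link = contradiction (ℕ.≰⇒> rx≰Q , link) (root-unlinked x)
    ... | inj₂ min  = min
    main : Dec (r x Fin.≤ Q) → Dec (r y Fin.≤ Q) → rel (base ρ) (r x) (r y)
    main (yes p) (yes q) = inj₂ (p , q , r∼r)
    main (no p) (yes q) = contradiction (ℕ.≤-trans (root-minimal x p (r y) (ρ.∼-sym r∼r)) q) p
    main (yes p) (no q) = contradiction (ℕ.≤-trans (root-minimal y q (r x) r∼r) p) q
    main (no p) (no q) = inj₁ (Fin.toℕ-injective (ℕ.≤-antisym
      (root-minimal x p (r y) (ρ.∼-sym r∼r)) (root-minimal y q (r x) r∼r)))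

  linked-monotone : ∀ ρ ρ′ → ρ ⊑ ρ′ → ∀ {y} → Linked ρ y → Linked ρ′ y
  linked-monotone ρ ρ′ ρ⊑ρ′ (Q<y , r) = Q<y , ρ⊑ρ′ r

  Between : (σ τ ρ : NoncrossingPartition m) → Set
  Between σ τ ρ = σ ⊑ ρ × ρ ⊑ τ

  -- Lifting a duality from the base to admissible partitions

  module Lift (σ τ : NoncrossingPartition m) (σ⊑τ : σ ⊑ τ) (adm-σ : Admissible σ) where

    dualLinks : NoncrossingPartition m → Links
    dualLinks ρ = record
      { Linked = λ y → Linked σ y ⊎ (Linked τ y × ¬ Linked ρ y)
      ; linked? = λ y → Links.linked? (links σ) y ⊎-dec (Links.linked? (links τ) y ×-dec ¬? (Links.linked? (links ρ) y))
      ; linked> = [ proj₁ , (λ p → proj₁ (proj₁ p)) ]′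
      }

    lift : (NoncrossingPartition m → NoncrossingPartition m) → NoncrossingPartition m → NoncrossingPartition m
    lift f ρ = extend (dualLinks ρ) (f (base ρ))

    record Reverses (f : NoncrossingPartition m → NoncrossingPartition m) : Set₁ where
      field
        antitone : Antitone f
        upper    : ∀ ρ → f ρ ⊑ base τ
        lower    : ∀ ρ → base σ ⊑ f ρ

      supported : ∀ ρ → Supported (f ρ)
      supported ρ = base-supported τ ∘ upper ρ

      base-lift : ∀ ρ → base (lift f ρ) ≈ₙ f (base ρ)
      base-lift ρ = base-extend (dualLinks ρ) (f (base ρ)) (supported (base ρ))

      ⊑-lift : ∀ ρ → f (base ρ) ⊑ lift f ρ
      ⊑-lift ρ = ⊑-trans (f (base ρ)) (base (lift f ρ)) (lift f ρ) (proj₂ (base-lift ρ)) (base-⊑ (lift f ρ))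

      lift-admissible : ∀ ρ → Admissible (lift f ρ)
      lift-admissible ρ = extend-admissible (dualLinks ρ) (f (base ρ)) (supported (base ρ))

      lift-linked : ∀ ρ {y} → Linked (lift f ρ) y → Links.Linked (dualLinks ρ) y
      lift-linked ρ = extend-linked (dualLinks ρ) (f (base ρ)) (supported (base ρ))

      lift-antitone : Antitone (lift f)
      lift-antitone {ρ} {ρ′} ρ⊑ρ′ {x} {y} = extend-⊑ (dualLinks ρ′) (f (base ρ′)) (lift f ρ)
        (⊑-trans (f (base ρ′)) (f (base ρ)) (lift f ρ)
          (antitone {base ρ} {base ρ′} (base-monotone {ρ} {ρ′} ρ⊑ρ′)) (⊑-lift ρ))
        (λ {y} → extend-linked⁻ (dualLinks ρ) (f (base ρ)) {y} ∘
          λ { (inj₁ l) → inj₁ l ; (inj₂ (l , ¬l)) → inj₂ (l , ¬l ∘ linked-monotone ρ ρ′ ρ⊑ρ′) }) {x} {y}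

      lift-⊑ : ∀ ρ → lift f ρ ⊑ τ
      lift-⊑ ρ {x} {y} = extend-⊑ (dualLinks ρ) (f (base ρ)) τ
        (⊑-trans (f (base ρ)) (base τ) τ (upper (base ρ)) (base-⊑ τ))
        [ (λ l → σ⊑τ (proj₂ l)) , (λ l → proj₂ (proj₁ l)) ]′ {x} {y}

      lift-⊒ : ∀ ρ → σ ⊑ lift f ρ
      lift-⊒ ρ = ⊑-trans σ (extend (links σ) (base σ)) (lift f ρ) (⊑-extend σ adm-σ)
        (λ {x} {y} → extend-⊑ (links σ) (base σ) (lift f ρ)
          (⊑-trans (base σ) (f (base ρ)) (lift f ρ) (lower (base ρ)) (⊑-lift ρ))
          (extend-linked⁻ (dualLinks ρ) (f (base ρ)) ∘ inj₁) {x} {y})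

    -- `extend-⊑` and `⊑-extend` reduce both inclusions to bases and links. The bases agree because
    -- g inverts f there, the links because complementing twice between those of σ and those of τ
    -- gives them back, decidability removing the double negation.
    lift-inverse : ∀ f g → Reverses f → Reverses g →
      (∀ ρ → base σ ⊑ ρ → ρ ⊑ base τ → g (f ρ) ≈ₙ ρ) →
      ∀ ρ → Admissible ρ → Between σ τ ρ → lift g (lift f ρ) ≈ₙ ρ
    lift-inverse f g F G gf ρ adm (σ⊑ρ , ρ⊑τ) =
      (λ {x} {y} → extend-⊑ (dualLinks (lift f ρ)) (g (base (lift f ρ))) ρ
        (⊑-trans (g (base (lift f ρ))) (base ρ) ρ (proj₁ gf-base) (base-⊑ ρ)) (proj₂ ∘ to) {x} {y}) ,
      ⊑-trans ρ (extend (links ρ) (base ρ)) (lift g (lift f ρ)) (⊑-extend ρ adm)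
        (λ {x} {y} → extend-⊑ (links ρ) (base ρ) (lift g (lift f ρ))
          (⊑-trans (base ρ) (g (base (lift f ρ))) (lift g (lift f ρ)) (proj₂ gf-base) (G.⊑-lift (lift f ρ)))
          (extend-linked⁻ (dualLinks (lift f ρ)) (g (base (lift f ρ))) ∘ from) {x} {y})
      where
      module F = Reverses F
      module G = Reverses G
      gf-base : g (base (lift f ρ)) ≈ₙ base ρ
      gf-base = ≈-trans (g (base (lift f ρ))) (g (f (base ρ))) (base ρ)
        (antitone-cong {f = g} (λ {a} {b} → G.antitone {a} {b}) (base (lift f ρ)) (f (base ρ)) (F.base-lift ρ))
        (gf (base ρ) (base-monotone {σ} {ρ} σ⊑ρ) (base-monotone {ρ} {τ} ρ⊑τ))
      to : ∀ {y} → Linked σ y ⊎ (Linked τ y × ¬ Linked (lift f ρ) y) → Linked ρ y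
      to (inj₁ l) = linked-monotone σ ρ σ⊑ρ l
      to {y} (inj₂ (l , ¬l)) = decidable-stable (Links.linked? (links ρ) y) λ ¬lρ →
        ¬l (proj₁ l , extend-linked⁻ (dualLinks ρ) (f (base ρ)) (inj₂ (l , ¬lρ)))
      from : ∀ {y} → Linked ρ y → Linked σ y ⊎ (Linked τ y × ¬ Linked (lift f ρ) y)
      from {y} l with Links.linked? (links σ) y
      ... | yes lσ = inj₁ lσ
      ... | no ¬lσ = inj₂ (linked-monotone ρ τ ρ⊑τ l , λ l′ → case F.lift-linked ρ l′ of λ
        { (inj₁ lσ) → ¬lσ lσ ; (inj₂ (_ , ¬l)) → ¬l l })

  -- The last two fields are asked for only when Q is minimal in σ and joined to P in τ. In any
  -- other interval the extra clause of `⪯` is vacuous, minimality of Q passing down to σ and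
  -- joining passing up to τ.
  record Duality (σ τ : NoncrossingPartition m) : Set₁ where
    field
      dual            : NoncrossingPartition m → NoncrossingPartition m
      dual-admissible : ∀ ρ → Admissible (dual ρ)
      dual-between    : ∀ ρ → Between σ τ (dual ρ)
      dual-antitone   : Antitone dual
      dual-joined     : Minimal σ Q → Joined τ → ∀ ρ → Admissible ρ → Between σ τ ρ → Joined (dual ρ) ⟺ Minimal ρ Q
      dual-minimal    : Minimal σ Q → Joined τ → ∀ ρ → Admissible ρ → Between σ τ ρ → Minimal (dual ρ) Q ⟺ Joined ρ

  record DualPair (σ τ : NoncrossingPartition m) : Set₁ where
    field
      to from : Duality σ τ
      from-to : ∀ ρ → Admissible ρ → Between σ τ ρ → Duality.dual from (Duality.dual to ρ) ≈ₙ ρ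
      to-from : ∀ ρ → Admissible ρ → Between σ τ ρ → Duality.dual to (Duality.dual from ρ) ≈ₙ ρ

  dualPair : ∀ σ τ → σ ⊑ τ → Admissible σ → DualPair σ τ
  dualPair σ τ σ⊑τ adm-σ = main (minimal? σ Q ×-dec NCP._∼?_ τ P Q)
    where
    open Lift σ τ σ⊑τ adm-σ
    bσ⊑bτ : base σ ⊑ base τ
    bσ⊑bτ = base-monotone {σ} {τ} σ⊑τ

    module _ (A : Automorphism (K (base τ) (base σ))) where
      module Δ = Dual (base σ) (base τ) bσ⊑bτ A
      reverses-φ : Reverses Δ.φ
      reverses-φ = record { antitone = λ {a} {b} → Δ.φ-antitone {a} {b} ; upper = Δ.φ-⊑ ; lower = Δ.φ-⊒ }
      reverses-ψ : Reverses Δ.ψ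
      reverses-ψ = record { antitone = λ {a} {b} → Δ.ψ-antitone {a} {b} ; upper = Δ.ψ-⊑ ; lower = Δ.ψ-⊒ }

      Exchange : (NoncrossingPartition m → NoncrossingPartition m) → Set₁
      Exchange f = Minimal σ Q → Joined τ → ∀ ρ → base σ ⊑ ρ → ρ ⊑ base τ → Joined (f ρ) ⟺ Alone Q ρ

      lift-joined : ∀ f → Reverses f → Exchange f → Minimal σ Q → Joined τ → ∀ ρ → Between σ τ ρ →
        Joined (lift f ρ) ⟺ Minimal ρ Q
      lift-joined f F ex min join ρ (σ⊑ρ , ρ⊑τ) = mk⇔
        (λ j → E.to (alone-base ρ) (E.to ex-ρ (proj₁ (Reverses.base-lift F ρ) (E.from (joined-base (lift f ρ)) j))))
        (λ a → E.to (joined-base (lift f ρ)) (proj₂ (Reverses.base-lift F ρ) (E.from ex-ρ (E.from (alone-base ρ) a))))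
        where
        module E = Equivalence
        ex-ρ = ex min join (base ρ) (base-monotone {σ} {ρ} σ⊑ρ) (base-monotone {ρ} {τ} ρ⊑τ)

      -- By the exchange property of g, minimality of Q in the image amounts to P and Q being joined
      -- after g is applied in turn, and that returns ρ. This is why φ and ψ each need an exchange
      -- property.
      lift-minimal : ∀ f g → Reverses f → Reverses g → Exchange g →
        (∀ ρ → base σ ⊑ ρ → ρ ⊑ base τ → g (f ρ) ≈ₙ ρ) →
        Minimal σ Q → Joined τ → ∀ ρ → Admissible ρ → Between σ τ ρ → Minimal (lift f ρ) Q ⟺ Joined ρ
      lift-minimal f g F G ex gf min join ρ adm btw = mk⇔
        (λ a → proj₁ inv (Equivalence.from ex-lift a)) (λ j → Equivalence.to ex-lift (proj₂ inv j))
        where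
        inv = lift-inverse f g F G gf ρ adm btw
        ex-lift = lift-joined g G ex min join (lift f ρ) (Reverses.lift-⊒ F ρ , Reverses.lift-⊑ F ρ)

      duality : ∀ f g → Reverses f → Reverses g → Exchange f → Exchange g →
        (∀ ρ → base σ ⊑ ρ → ρ ⊑ base τ → g (f ρ) ≈ₙ ρ) → Duality σ τ
      duality f g F G ex-f ex-g gf = record
        { dual = lift f
        ; dual-admissible = Reverses.lift-admissible F
        ; dual-between = λ ρ → Reverses.lift-⊒ F ρ , Reverses.lift-⊑ F ρ
        ; dual-antitone = λ {ρ} {ρ′} → Reverses.lift-antitone F {ρ} {ρ′}
        ; dual-joined = λ min join ρ _ → lift-joined f F ex-f min join ρ
        ; dual-minimal = lift-minimal f g F G ex-g gf
        }

      pair : Exchange Δ.φ → Exchange Δ.ψ → DualPair σ τ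
      pair ex-φ ex-ψ = record
        { to = duality Δ.φ Δ.ψ reverses-φ reverses-ψ ex-φ ex-ψ Δ.ψφ
        ; from = duality Δ.ψ Δ.φ reverses-ψ reverses-φ ex-ψ ex-φ Δ.φψ
        ; from-to = lift-inverse Δ.φ Δ.ψ reverses-φ reverses-ψ Δ.ψφ
        ; to-from = lift-inverse Δ.ψ Δ.φ reverses-ψ reverses-φ Δ.φψ
        }

    main : Dec (Minimal σ Q × Joined τ) → DualPair σ τ
    -- Outside the exceptional case the exchange properties hold vacuously.
    main (no ¬p) = pair (identity (K (base τ) (base σ)))
      (λ min join → contradiction (min , join) ¬p) (λ min join → contradiction (min , join) ¬p)
    main (yes (min , join)) = pair (reflection (base σ) (base τ) bσ⊑bτ (base-supported τ) j a)
      (λ _ _ → φ-joined (base σ) (base τ) bσ⊑bτ (base-supported τ) j a)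
      (λ _ _ → ψ-joined (base σ) (base τ) bσ⊑bτ (base-supported τ) j a)
      where
      j : Joined (base τ)
      j = Equivalence.from (joined-base τ) join
      a : Alone Q (base σ)
      a = Equivalence.from (alone-base σ) min

-- Covering relations

Block : NoncrossingPartition m → Fin m → Fin m → Pred (Fin m) 0ℓ
Block σ x y i = rel σ x i ⊎ rel σ y i

-- `HasLabel` in normal form: q is the minimum of B₂ and l the last element of B₁ before q, so the
-- label is l + 1. The minimum of B₁ is determined by l.
record Merge (σ τ : NoncrossingPartition m) (l q : Fin m) : Set where
  field
    l<q     : l Fin.< q
    minimal : Minimal σ q
    merged  : ∀ i j → rel τ i j ⟺ (rel σ i j ⊎ (Block σ l q i × Block σ l q j))
    largest : ∀ i → rel σ l i → i Fin.< q → i Fin.≤ l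

  private
    module σ = NCP σ
    module τ = NCP τ

  ⊑-merged : σ ⊑ τ
  ⊑-merged {i} {j} r = Equivalence.from (merged i j) (inj₁ r)

  l∼q : l τ.∼ q
  l∼q = Equivalence.from (merged l q) (inj₂ (inj₁ σ.∼-refl , inj₂ σ.∼-refl))

  l≁q : ¬ l σ.∼ q
  l≁q r = ℕ.<⇒≱ l<q (minimal l r)

  not-minimal : ¬ Minimal τ q
  not-minimal min = ℕ.<⇒≱ l<q (min l l∼q)

  q≤ : ∀ {i} → q σ.∼ i → q Fin.≤ i
  q≤ {i} r = minimal i (σ.∼-sym r)

  -- As l < q, the merged block has its minimum in the block of l, so q is the only block minimum
  -- that a merge destroys.
  others-minimal : ∀ {y} → y ≢ q → Minimal σ y → Minimal τ y
  others-minimal {y} y≢q min z z∼y with Equivalence.to (merged z y) z∼y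
  ... | inj₁ r = min z r
  ... | inj₂ (_ , inj₂ q∼y) = contradiction (Fin.toℕ-injective (ℕ.≤-antisym (min q q∼y) (q≤ q∼y))) y≢q
  ... | inj₂ (inj₁ l∼z , inj₁ l∼y) = min z (σ.∼-trans (σ.∼-sym l∼z) l∼y)
  ... | inj₂ (inj₂ q∼z , inj₁ l∼y) = ℕ.≤-trans (min l l∼y) (ℕ.≤-trans (ℕ.<⇒≤ l<q) (q≤ q∼z))

minimal-antitone : ∀ (σ τ : NoncrossingPartition m) → σ ⊑ τ → ∀ {y} → Minimal τ y → Minimal σ y
minimal-antitone σ τ σ⊑τ min z r = min z (σ⊑τ r)

merge-respˡ : ∀ {σ σ′ τ : NoncrossingPartition m} {l q} → σ ≈ₙ σ′ → Merge σ τ l q → Merge σ′ τ l q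
merge-respˡ {σ = σ} {σ′} {τ} {l} {q} (f , g) M = record
  { l<q = l<q
  ; minimal = minimal-antitone σ′ σ g minimal
  ; merged = λ i j → mk⇔
      (λ r → [ inj₁ ∘ f , (λ (p , p′) → inj₂ (block σ σ′ f p , block σ σ′ f p′)) ]′ (Equivalence.to (merged i j) r))
      (λ r → Equivalence.from (merged i j) ([ inj₁ ∘ g , (λ (p , p′) → inj₂ (block σ′ σ g p , block σ′ σ g p′)) ]′ r))
  ; largest = λ i r → largest i (g r)
  }
  where
  open Merge M
  block : ∀ ρ ρ′ → ρ ⊑ ρ′ → ∀ {i} → Block ρ l q i → Block ρ′ l q i
  block _ _ f (inj₁ r) = inj₁ (f r)
  block _ _ f (inj₂ r) = inj₂ (f r)

merge⇒label : ∀ {σ τ : NoncrossingPartition m} {l q} → Merge σ τ l q → HasLabel σ τ (suc (toℕ l))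
merge⇒label {σ = σ} {τ} {l} {q} M with minimum (NCP._∼?_ σ l) (NCP.∼-refl σ {l})
... | p , l∼p , p-min = record
  { p = p ; q = q
  ; distinct = λ p∼q → l≁q (σ.∼-trans l∼p p∼q)
  ; merged = λ i j → mk⇔
      (λ r → [ inj₁ , (λ (b , b′) → inj₂ (block (σ.∼-sym l∼p) b , block (σ.∼-sym l∼p) b′)) ]′ (Equivalence.to (merged i j) r))
      (λ r → Equivalence.from (merged i j) ([ inj₁ , (λ (b , b′) → inj₂ (block l∼p b , block l∼p b′)) ]′ r))
  ; p-minimum = λ { i (inj₁ p∼i) → p-min i (σ.∼-trans l∼p p∼i)
                  ; i (inj₂ q∼i) → ℕ.≤-trans (p-min l σ.∼-refl) (ℕ.≤-trans (ℕ.<⇒≤ l<q) (q≤ q∼i)) }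
  ; l = l
  ; l∈B₁ = σ.∼-sym l∼p
  ; l-below = λ j q∼j → ℕ.<-≤-trans l<q (q≤ q∼j)
  ; l-largest = λ i p∼i below → largest i (σ.∼-trans l∼p p∼i) (below q σ.∼-refl)
  ; label≡l = refl
  }
  where
  open Merge M
  module σ = NCP σ
  block : ∀ {x y i} → rel σ x y → Block σ y q i → Block σ x q i
  block x∼y (inj₁ r) = inj₁ (σ.∼-trans x∼y r)
  block x∼y (inj₂ r) = inj₂ r

label⇒merge : ∀ {σ τ : NoncrossingPartition m} {v} → HasLabel σ τ v → ∃₂ λ l q → Merge σ τ l q × v ≡ suc (toℕ l)
label⇒merge {σ = σ} {τ} H with minimum (NCP._∼?_ σ (HasLabel.q H)) (NCP.∼-refl σ {HasLabel.q H})
... | b , q∼b , b-min = l , b , record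
  { l<q = l-below b q∼b
  ; minimal = λ z z∼b → b-min z (σ.∼-trans q∼b (σ.∼-sym z∼b))
  ; merged = λ i j → mk⇔
      (λ r → [ inj₁ , (λ (c , c′) → inj₂ (to c , to c′)) ]′ (Equivalence.to (merged i j) r))
      (λ r → Equivalence.from (merged i j) ([ inj₁ , (λ (c , c′) → inj₂ (from c , from c′)) ]′ r))
  ; largest = λ i l∼i i<b → l-largest i (σ.∼-trans l∈B₁ l∼i) (λ j q∼j → ℕ.<-≤-trans i<b (b-min j q∼j))
  } , label≡l
  where
  open HasLabel H hiding (module σ; module τ)
  module σ = NCP σ
  to : ∀ {i} → B i → Block σ l b i
  to (inj₁ p∼i) = inj₁ (σ.∼-trans (σ.∼-sym l∈B₁) p∼i)
  to (inj₂ q∼i) = inj₂ (σ.∼-trans (σ.∼-sym q∼b) q∼i)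
  from : ∀ {i} → Block σ l b i → B i
  from (inj₁ l∼i) = inj₁ (σ.∼-trans l∈B₁ l∼i)
  from (inj₂ b∼i) = inj₂ (σ.∼-trans q∼b b∼i)

-- A partition in between either joins l and q, and then contains all of τ, or does not, and then
-- adds nothing to σ.
merge⇒covers : ∀ {n} {σ τ : NoncrossingPartition (suc n)} {l q} → Merge σ τ l q → Covers (NC (suc n)) σ τ
merge⇒covers {n} {σ} {τ} {l} {q} M = ((λ {x} {y} → ⊑-merged {x} {y}) , λ (_ , g) → l≁q (g l∼q)) , nothing-between
  where
  open Merge M
  module σ = NCP σ
  nothing-between : ∀ ρ → ¬ (σ <ₙ ρ × ρ <ₙ τ)
  nothing-between ρ ((σ⊑ρ , σ≉ρ) , (ρ⊑τ , ρ≉τ)) with NCP._∼?_ ρ l q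
  ... | yes l∼q = ρ≉τ ((λ {x} {y} → ρ⊑τ {x} {y}) , λ {i} {j} r → [ σ⊑ρ , (λ (b , b′) → ρ.∼-trans (ρ.∼-sym (in-block b)) (in-block b′)) ]′ (Equivalence.to (merged i j) r))
    where
    module ρ = NCP ρ
    in-block : ∀ {i} → Block σ l q i → l ρ.∼ i
    in-block (inj₁ l∼i) = σ⊑ρ l∼i
    in-block (inj₂ q∼i) = ρ.∼-trans l∼q (σ⊑ρ q∼i)
  ... | no l≁q = σ≉ρ ((λ {x} {y} → σ⊑ρ {x} {y}) , ρ⊑σ)
    where
    module ρ = NCP ρ
    ρ⊑σ : ρ ⊑ σ
    ρ⊑σ {i} {j} r with Equivalence.to (merged i j) (ρ⊑τ r)
    ... | inj₁ r′ = r′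
    ... | inj₂ (inj₁ p , inj₁ p′) = σ.∼-trans (σ.∼-sym p) p′
    ... | inj₂ (inj₂ p , inj₂ p′) = σ.∼-trans (σ.∼-sym p) p′
    ... | inj₂ (inj₁ p , inj₂ p′) = contradiction (ρ.∼-trans (σ⊑ρ p) (ρ.∼-trans r (ρ.∼-sym (σ⊑ρ p′)))) l≁q
    ... | inj₂ (inj₂ p , inj₁ p′) = contradiction (ρ.∼-trans (σ⊑ρ p′) (ρ.∼-trans (ρ.∼-sym r) (ρ.∼-sym (σ⊑ρ p)))) l≁q

-- If q is minimal in its block of σ and l precedes q in its block of τ, then
-- merging the blocks of l and q in σ creates no crossing.
merge-exists : ∀ (σ τ : NoncrossingPartition m) → σ ⊑ τ → ∀ {q} → Minimal σ q → ¬ Minimal τ q →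
  ∃₂ λ l ρ → Merge σ ρ l q × rel τ l q × (∀ j → rel τ j q → j Fin.< q → j Fin.≤ l) × ρ ⊑ τ
merge-exists {m} σ τ σ⊑τ {q} q-min q-not-min = l , ρ , M , l∼q , (λ j r j<q → l-max j (j<q , r)) , ρ⊑τ
  where
  module σ = NCP σ
  module τ = NCP τ
  smaller : ∃ λ z → z Fin.< q × z τ.∼ q
  smaller with Fin.any? (λ z → (z Fin.<? q) ×-dec (z τ.∼? q))
  ... | yes r = r
  ... | no ¬r = contradiction (λ z z∼q → ℕ.≮⇒≥ (λ z<q → ¬r (z , z<q , z∼q))) q-not-min
  greatest = maximum (λ z → (z Fin.<? q) ×-dec (z τ.∼? q)) (proj₂ smaller)
  l = proj₁ greatest
  l<q : l Fin.< q
  l<q = proj₁ (proj₁ (proj₂ greatest))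
  l∼q : l τ.∼ q
  l∼q = proj₂ (proj₁ (proj₂ greatest))
  l-max : ∀ j → j Fin.< q × j τ.∼ q → j Fin.≤ l
  l-max = proj₂ (proj₂ greatest)
  B = Block σ l q
  B? : ∀ i → Dec (B i)
  B? i = (l σ.∼? i) ⊎-dec (q σ.∼? i)
  _∼_ : Rel (Fin m) 0ℓ
  i ∼ j = i σ.∼ j ⊎ (B i × B j)
  B-resp : ∀ {i j} → i σ.∼ j → B i → B j
  B-resp r (inj₁ p) = inj₁ (σ.∼-trans p r)
  B-resp r (inj₂ p) = inj₂ (σ.∼-trans p r)
  isEq : IsEquivalence _∼_
  isEq = record
    { refl = inj₁ σ.∼-refl
    ; sym = λ { (inj₁ r) → inj₁ (σ.∼-sym r) ; (inj₂ (p , p′)) → inj₂ (p′ , p) }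
    ; trans = λ { (inj₁ r) (inj₁ r′) → inj₁ (σ.∼-trans r r′)
                ; (inj₁ r) (inj₂ (p , p′)) → inj₂ (B-resp (σ.∼-sym r) p , p′)
                ; (inj₂ (p , p′)) (inj₁ r) → inj₂ (p , B-resp r p′)
                ; (inj₂ (p , _)) (inj₂ (_ , p′)) → inj₂ (p , p′) }
    }
  B⇒τ : ∀ {i} → B i → i τ.∼ q
  B⇒τ (inj₁ l∼i) = τ.∼-trans (τ.∼-sym (σ⊑τ l∼i)) l∼q
  B⇒τ (inj₂ q∼i) = τ.∼-sym (σ⊑τ q∼i)
  ∼⇒τ : ∀ {i j} → i ∼ j → i τ.∼ j
  ∼⇒τ (inj₁ r) = σ⊑τ r
  ∼⇒τ (inj₂ (p , p′)) = τ.∼-trans (B⇒τ p) (τ.∼-sym (B⇒τ p′))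
  q≤ : ∀ {i} → q σ.∼ i → q Fin.≤ i
  q≤ {i} r = q-min i (σ.∼-sym r)
  -- No element of the block of q in τ lies strictly between l and q, l being the predecessor there.
  -- An element of that block outside B is therefore left of l or right of q, where
  -- crossing-freeness of σ settles the mixed cases.
  data Side (i : Fin m) : Set where
    left  : i Fin.< l → Side i
    right : q Fin.< i → Side i
  side : ∀ {i} → i τ.∼ q → ¬ B i → Side i
  side {i} i∼q ¬Bi with Fin.<-cmp i q
  ... | tri< i<q _ _  = left (ℕ.≤∧≢⇒< (l-max i (i<q , i∼q)) λ eq → ¬Bi (inj₁ (σ.∼-reflexive (sym (Fin.toℕ-injective eq)))))
  ... | tri≈ _ refl _ = contradiction (inj₂ σ.∼-refl) ¬Bi
  ... | tri> _ _ q<i  = right q<i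
  cf : CrossingFree _∼_
  cf a<b b<c c<d (inj₁ r) (inj₁ r′) = inj₁ (σ.crossingFree a<b b<c c<d r r′)
  cf a<b b<c c<d (inj₂ (Ba , _)) (inj₂ (Bb , _)) = inj₂ (Ba , Bb)
  cf {a} {b} {c} {d} a<b b<c c<d (inj₂ (Ba , Bc)) (inj₁ b∼d) with B? b
  ... | yes Bb = inj₂ (Ba , Bb)
  ... | no ¬Bb = by-blocks Ba Bc
    where
    a∼b : a τ.∼ b
    a∼b = τ.crossingFree a<b b<c c<d (∼⇒τ (inj₂ (Ba , Bc))) (σ⊑τ b∼d)
    by-blocks : B a → B c → a ∼ b
    by-blocks (inj₁ l∼a) (inj₁ l∼c) = inj₁ (σ.crossingFree a<b b<c c<d (σ.∼-trans (σ.∼-sym l∼a) l∼c) b∼d)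
    by-blocks (inj₂ q∼a) (inj₂ q∼c) = inj₁ (σ.crossingFree a<b b<c c<d (σ.∼-trans (σ.∼-sym q∼a) q∼c) b∼d)
    by-blocks (inj₂ q∼a) (inj₁ l∼c) = contradiction
      (inj₁ (σ.crossingFree (ℕ.<-trans l<q (ℕ.≤-<-trans (q≤ q∼a) a<b)) b<c c<d l∼c b∼d)) ¬Bb
    by-blocks (inj₁ l∼a) (inj₂ q∼c) with side (τ.∼-trans (τ.∼-sym a∼b) (B⇒τ Ba)) ¬Bb
    ... | left b<l = contradiction
      (inj₁ (σ.∼-trans l∼a (σ.crossingFree a<b b<l (ℕ.<-trans l<q (ℕ.≤-<-trans (q≤ q∼c) c<d)) (σ.∼-sym l∼a) b∼d))) ¬Bb
    ... | right q<b = contradiction (inj₂ (σ.crossingFree q<b b<c c<d q∼c b∼d)) ¬Bb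
  cf {a} {b} {c} {d} a<b b<c c<d (inj₁ a∼c) (inj₂ (Bb , Bd)) with B? a
  ... | yes Ba = inj₂ (Ba , Bb)
  ... | no ¬Ba = by-blocks Bb Bd
    where
    ¬Bc : ¬ B c
    ¬Bc Bc = ¬Ba (B-resp (σ.∼-sym a∼c) Bc)
    a∼q : a τ.∼ q
    a∼q = τ.∼-trans (τ.crossingFree a<b b<c c<d (σ⊑τ a∼c) (∼⇒τ (inj₂ (Bb , Bd)))) (B⇒τ Bb)
    c∼q : c τ.∼ q
    c∼q = τ.∼-trans (τ.∼-sym (σ⊑τ a∼c)) a∼q
    by-blocks : B b → B d → a ∼ b
    by-blocks (inj₁ l∼b) (inj₁ l∼d) = inj₁ (σ.crossingFree a<b b<c c<d a∼c (σ.∼-trans (σ.∼-sym l∼b) l∼d))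
    by-blocks (inj₂ q∼b) (inj₂ q∼d) = inj₁ (σ.crossingFree a<b b<c c<d a∼c (σ.∼-trans (σ.∼-sym q∼b) q∼d))
    by-blocks (inj₁ l∼b) (inj₂ q∼d) with side c∼q ¬Bc | side a∼q ¬Ba
    ... | left c<l  | _ = inj₁ (σ.crossingFree a<b b<c c<l a∼c (σ.∼-sym l∼b))
    ... | right q<c | left a<l = contradiction (inj₂ (σ.∼-sym (σ.crossingFree (ℕ.<-trans a<l l<q) q<c c<d a∼c q∼d))) ¬Ba
    ... | right q<c | right q<a = contradiction (inj₁ (σ.crossingFree (ℕ.<-trans l<q q<a) a<b b<c l∼b a∼c)) ¬Ba
    by-blocks (inj₂ q∼b) (inj₁ l∼d) with side a∼q ¬Ba
    ... | left a<l = contradiction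
      (inj₁ (σ.∼-sym (σ.crossingFree a<l (ℕ.<-trans l<q (ℕ.≤-<-trans (q≤ q∼b) b<c)) c<d a∼c l∼d))) ¬Ba
    ... | right q<a = contradiction (inj₂ (σ.crossingFree q<a a<b b<c q∼b a∼c)) ¬Ba
  ρ : NoncrossingPartition m
  ρ = mkNCP _∼_ isEq (λ i j → (i σ.∼? j) ⊎-dec (B? i ×-dec B? j)) cf
  ρ⊑τ : ρ ⊑ τ
  ρ⊑τ = ∼⇒τ
  M : Merge σ ρ l q
  M = record
    { l<q = l<q ; minimal = q-min ; merged = λ i j → mk⇔ id id
    ; largest = λ i l∼i i<q → l-max i (i<q , B⇒τ (inj₁ l∼i)) }

-- Sequences of merges

stepwise : ∀ {ℓ} {A : Set₁} {R : Rel A ℓ} → (∀ x → R x x) → (∀ x y z → R x y → R y z → R x z) →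
  ∀ {r} (f : Fin (suc r) → A) → (∀ i → R (f (inject₁ i)) (f (suc i))) → ∀ i j → i Fin.≤ j → R (f i) (f j)
stepwise R-refl R-trans f step zero zero _ = R-refl (f zero)
stepwise R-refl R-trans {suc r} f step zero (suc j) _ =
  R-trans (f zero) (f (suc zero)) (f (suc j)) (step zero)
    (stepwise R-refl R-trans (f ∘ suc) (step ∘ suc) zero j ℕ.z≤n)
stepwise R-refl R-trans {suc r} f step (suc i) (suc j) i≤j =
  stepwise R-refl R-trans (f ∘ suc) (step ∘ suc) i j (ℕ.s≤s⁻¹ i≤j)

record IsMergeSequence {m r} (f : Fin (suc r) → NoncrossingPartition m) (l q : Fin r → Fin m) : Set where
  field merge : ∀ i → Merge (f (inject₁ i)) (f (suc i)) (l i) (q i)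

  monotone : ∀ i j → i Fin.≤ j → f i ⊑ f j
  monotone = stepwise {R = _⊑_} (λ _ → id) ⊑-trans f (λ i → Merge.⊑-merged (merge i))

  private
    -- A merge at q ends the minimality of q for good, while a merge at q needs it.
    q-distinct : ∀ {i j} → i Fin.< j → q i ≢ q j
    q-distinct {i} {j} i<j eq = Merge.not-minimal (merge i) (minimal-antitone (f (suc i)) (f (inject₁ j))
      (monotone (suc i) (inject₁ j) (subst (suc (toℕ i) ≤_) (sym (Fin.toℕ-inject₁ j)) i<j))
      (subst (Minimal (f (inject₁ j))) (sym eq) (Merge.minimal (merge j))))

  q-injective : ∀ {i j} → q i ≡ q j → i ≡ j
  q-injective {i} {j} eq with Fin.<-cmp i j
  ... | tri< i<j _ _ = contradiction eq (q-distinct i<j)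
  ... | tri≈ _ i≡j _ = i≡j
  ... | tri> _ _ j<i = contradiction (sym eq) (q-distinct j<i)

-- A merge destroys only its own q as a block minimum, so whatever loses minimality along the way
-- has been the q of some merge.
q-hits : ∀ {m r} {f : Fin (suc r) → NoncrossingPartition m} {l q} → IsMergeSequence f l q →
  ∀ j {y} → Minimal (f zero) y → ¬ Minimal (f j) y → ∃ λ i → suc i Fin.≤ j × q i ≡ y
q-hits S zero min ¬min = contradiction min ¬min
q-hits {r = suc r} {f} {l} {q} S (suc j) {y} min ¬min with y Fin.≟ q zero
... | yes eq = zero , ℕ.s≤s ℕ.z≤n , sym eq
... | no y≢q with q-hits {f = f ∘ suc} {l ∘ suc} {q ∘ suc} (record { merge = λ i → IsMergeSequence.merge S (suc i) }) j
                  (Merge.others-minimal (IsMergeSequence.merge S zero) y≢q min) ¬min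
...   | i , i<j , eq = suc i , ℕ.s≤s i<j , eq

-- Blocks are told apart by their minima: for two elements related in τ, the minima of their blocks
-- in σ are both minimal in the same block of τ, hence equal.
same-minima : ∀ (σ τ : NoncrossingPartition m) → σ ⊑ τ → (∀ q → Minimal σ q → Minimal τ q) → σ ≈ₙ τ
same-minima {m} σ τ σ⊑τ same = σ⊑τ , τ⊑σ
  where
  module σ = NCP σ
  module τ = NCP τ
  least : ∀ x → ∃ λ a → x σ.∼ a × Minimal τ a
  least x with minimum (x σ.∼?_) (σ.∼-refl {x})
  ... | a , x∼a , a-min = a , x∼a , same a λ z z∼a → a-min z (σ.∼-trans x∼a (σ.∼-sym z∼a))
  τ⊑σ : τ ⊑ σ
  τ⊑σ {x} {y} x∼y with least x | least y
  ... | a , x∼a , a-min | b , y∼b , b-min = σ.∼-trans x∼a (σ.∼-trans (σ.∼-reflexive a≡b) (σ.∼-sym y∼b))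
    where
    a∼b : a τ.∼ b
    a∼b = τ.∼-trans (τ.∼-sym (σ⊑τ x∼a)) (τ.∼-trans x∼y (σ⊑τ y∼b))
    a≡b : a ≡ b
    a≡b = Fin.toℕ-injective (ℕ.≤-antisym (a-min b (τ.∼-sym a∼b)) (b-min a a∼b))

-- Valid merges, paths and the order `⪯`

module Paths {m} (Q : Fin m) (0<Q : 0 < toℕ Q) where
  open Admissibility Q 0<Q public

  P<Q : P Fin.< Q
  P<Q = ℕ.≤-reflexive (sym (pred-suc Q 0<Q))

  Valid : Fin m → Fin m → Set
  Valid l q = (Q Fin.< q → l ≡ Fin.pred q) × (q ≡ Q → l ≢ P)

  infix 4 _⪯_

  _⪯_ : Rel (NoncrossingPartition m) (lsuc 0ℓ)
  σ ⪯ τ = σ ⊑ τ × (Minimal σ Q → Joined τ →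
    ∃ λ μ → Admissible μ × ¬ Minimal μ Q × ¬ Joined μ × σ ⊑ μ × μ ⊑ τ)

  joined⇒¬minimal : ∀ ρ → Joined ρ → ¬ Minimal ρ Q
  joined⇒¬minimal ρ join min = ℕ.<⇒≱ P<Q (min P join)

  ⪯-refl : ∀ ρ → ρ ⪯ ρ
  ⪯-refl ρ = id , λ min join → contradiction min (joined⇒¬minimal ρ join)

  -- If Q is still minimal in ρ, the clause of ρ ⪯ τ provides μ; if P and Q already share a block of
  -- ρ, that of σ ⪯ ρ does; otherwise ρ itself serves, which is where its admissibility enters.
  ⪯-trans : ∀ σ ρ τ → Admissible ρ → σ ⪯ ρ → ρ ⪯ τ → σ ⪯ τ
  ⪯-trans σ ρ τ adm (σ⊑ρ , h) (ρ⊑τ , h′) = ⊑-trans σ ρ τ σ⊑ρ ρ⊑τ , middle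
    where
    middle : Minimal σ Q → Joined τ → ∃ λ μ → Admissible μ × ¬ Minimal μ Q × ¬ Joined μ × σ ⊑ μ × μ ⊑ τ
    middle min join with minimal? ρ Q | NCP._∼?_ ρ P Q
    ... | yes min-ρ | _ = let μ , a , b , c , ρ⊑μ , μ⊑τ = h′ min-ρ join in μ , a , b , c , ⊑-trans σ ρ μ σ⊑ρ ρ⊑μ , μ⊑τ
    ... | no _ | yes join-ρ = let μ , a , b , c , σ⊑μ , μ⊑ρ = h min join-ρ in μ , a , b , c , σ⊑μ , ⊑-trans μ ρ τ μ⊑ρ ρ⊑τ
    ... | no ¬min-ρ | no ¬join-ρ = ρ , adm , ¬min-ρ , ¬join-ρ , σ⊑ρ , ρ⊑τ

  ≈⇒⪯ : ∀ σ τ → σ ≈ₙ τ → σ ⪯ τ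
  ≈⇒⪯ σ τ (σ⊑τ , τ⊑σ) = σ⊑τ , λ min join → contradiction min (joined⇒¬minimal σ (τ⊑σ join))

  admissible-resp : ∀ σ τ → σ ≈ₙ τ → Admissible σ → Admissible τ
  admissible-resp σ τ (σ⊑τ , τ⊑σ) adm y Q<y with adm y Q<y
  ... | inj₁ r = inj₁ (σ⊑τ r)
  ... | inj₂ min = inj₂ (minimal-antitone τ σ τ⊑σ min)

  module _ {σ τ l q} (M : Merge σ τ l q) (valid : Valid l q) where
    open Merge M

    step-admissible : Admissible σ → Admissible τ
    step-admissible adm y Q<y with y Fin.≟ q | adm y Q<y
    ... | yes refl | _        = inj₁ (subst (λ x → rel τ x q) (proj₁ valid Q<y) l∼q)
    ... | no _     | inj₁ r   = inj₁ (⊑-merged r)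
    ... | no y≢q   | inj₂ min = inj₂ (others-minimal y≢q min)

    -- The clause is vacuous for a single valid merge: it would have to be the merge at Q, with P in
    -- the block of l, and then l = P because l is the largest element of its block below Q.
    step-⪯ : σ ⪯ τ
    step-⪯ = ⊑-merged , λ min join → contradiction join (¬joined min)
      where
      ¬joined : Minimal σ Q → ¬ Joined τ
      ¬joined min join with Q Fin.≟ q
      ... | no Q≢q = joined⇒¬minimal τ join (others-minimal Q≢q min)
      ... | yes refl with Equivalence.to (merged P Q) join
      ...   | inj₁ r = joined⇒¬minimal σ r min
      ...   | inj₂ (inj₂ Q∼P , _) = ℕ.<⇒≱ P<Q (q≤ Q∼P)
      ...   | inj₂ (inj₁ l∼P , _) = proj₂ valid refl
        (Fin.toℕ-injective (ℕ.≤-antisym (<⇒≤pred {x = l} {Q} l<q) (largest P l∼P P<Q)))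

  ValidStep : Rel (NoncrossingPartition m) 0ℓ
  ValidStep σ τ = ∃₂ λ l q → Merge σ τ l q × Valid l q

  infixr 5 _∷_ _++ₚ_

  data Path : NoncrossingPartition m → NoncrossingPartition m → ℕ → Set₁ where
    done : ∀ {σ τ} → σ ≈ₙ τ → Path σ τ 0
    _∷_  : ∀ {σ ρ τ r} → ValidStep σ ρ → Path ρ τ r → Path σ τ (suc r)

  path-respˡ : ∀ {σ σ′ τ r} → σ ≈ₙ σ′ → Path σ τ r → Path σ′ τ r
  path-respˡ {σ} {σ′} {τ} eq (done eq′) = done (≈-trans σ′ σ τ (≈-sym σ σ′ eq) eq′)
  path-respˡ {σ} {σ′} eq (_∷_ {ρ = ρ} (l , q , M , v) p) = (l , q , merge-respˡ {σ = σ} {σ′} {ρ} eq M , v) ∷ p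

  _++ₚ_ : ∀ {σ ρ τ r s} → Path σ ρ r → Path ρ τ s → Path σ τ (r ℕ.+ s)
  _++ₚ_ {σ} {ρ} (done eq) p′ = path-respˡ (≈-sym σ ρ eq) p′
  (s ∷ p) ++ₚ p′ = s ∷ (p ++ₚ p′)

  private
    -- Take the least q that is a minimum in σ but not in τ and merge it with its predecessor l in
    -- the block of τ. Above Q, admissibility of τ makes l equal to q - 1; at Q itself, l = P is the
    -- excluded combination. The least such q grows at every step, which is what the fuel bound
    -- records.
    direct : ∀ fuel σ τ → Admissible τ → σ ⊑ τ → ¬ (Minimal σ Q × Joined τ) →
      (∀ q → Minimal σ q → ¬ Minimal τ q → m ≤ fuel ℕ.+ toℕ q) → ∃ (Path σ τ)
    direct fuel σ τ adm σ⊑τ ¬αγ bound with Fin.any? (λ q → minimal? σ q ×-dec ¬? (minimal? τ q))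
    ... | no ¬bad = 0 , done (same-minima σ τ σ⊑τ λ q min → decidable-stable (minimal? τ q) λ ¬min → ¬bad (q , min , ¬min))
    direct zero σ τ adm σ⊑τ ¬αγ bound | yes (q , min , ¬min) = contradiction (Fin.toℕ<n q) (ℕ.≤⇒≯ (bound q min ¬min))
    direct (suc fuel) σ τ adm σ⊑τ ¬αγ bound | yes (_ , bad)
      with minimum (λ q → minimal? σ q ×-dec ¬? (minimal? τ q)) bad
    ... | q , (min , ¬min) , q-least with merge-exists σ τ σ⊑τ min ¬min
    ...   | l , ρ , M , l∼q , l-max , ρ⊑τ = let r , p = rest in suc r , (l , q , M , above , at) ∷ p
      where
      open Merge M using (l<q; ⊑-merged; not-minimal)
      above : Q Fin.< q → l ≡ Fin.pred q
      above Q<q with adm q Q<q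
      ... | inj₂ min-τ = contradiction min-τ ¬min
      ... | inj₁ link = Fin.toℕ-injective (ℕ.≤-antisym (<⇒≤pred l<q)
        (l-max (Fin.pred q) link (ℕ.≤-reflexive (sym (pred-suc q (ℕ.≤-<-trans ℕ.z≤n Q<q))))))
      at : q ≡ Q → l ≢ P
      at refl refl = ¬αγ (min , l∼q)
      rest : ∃ (Path ρ τ)
      rest = direct fuel ρ τ adm ρ⊑τ
        (λ (min-ρ , join) → ¬αγ (minimal-antitone σ ρ ⊑-merged min-ρ , join))
        λ y min-ρ ¬min-τ → ℕ.≤-trans (bound q min ¬min) (subst (_≤ fuel ℕ.+ toℕ y) (ℕ.+-suc fuel (toℕ q))
          (ℕ.+-monoʳ-≤ fuel (ℕ.≤∧≢⇒< (q-least y (minimal-antitone σ ρ ⊑-merged min-ρ , ¬min-τ))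
            λ eq → not-minimal (subst (Minimal ρ) (sym (Fin.toℕ-injective eq)) min-ρ))))

    direct′ : ∀ σ τ → Admissible τ → σ ⊑ τ → ¬ (Minimal σ Q × Joined τ) → ∃ (Path σ τ)
    direct′ σ τ adm σ⊑τ ¬αγ = direct m σ τ adm σ⊑τ ¬αγ (λ q _ _ → ℕ.m≤m+n m (toℕ q))

  -- In the exceptional case the path goes through μ. The first half ends in a partition not joining
  -- P and Q, the second starts from one where Q is not minimal, so `direct′` applies to both.
  path : ∀ σ τ → Admissible τ → σ ⪯ τ → ∃ (Path σ τ)
  path σ τ adm (σ⊑τ , h) with minimal? σ Q ×-dec NCP._∼?_ τ P Q
  ... | no ¬αγ = direct′ σ τ adm σ⊑τ ¬αγ
  ... | yes (min , join) with h min join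
  ...   | μ , adm-μ , ¬min , ¬join , σ⊑μ , μ⊑τ =
    let r , p = direct′ σ μ adm-μ σ⊑μ (¬join ∘ proj₂)
        s , p′ = direct′ μ τ adm μ⊑τ (¬min ∘ proj₁)
    in r ℕ.+ s , p ++ₚ p′

  vertex : ∀ {σ τ r} → Path σ τ r → Fin (suc r) → NoncrossingPartition m
  vertex {σ} p zero = σ
  vertex (_ ∷ p) (suc i) = vertex p i

  step : ∀ {σ τ r} (p : Path σ τ r) i → ValidStep (vertex p (inject₁ i)) (vertex p (suc i))
  step (s ∷ p) zero = s
  step (s ∷ p) (suc i) = step p i

  vertex-last : ∀ {σ τ r} (p : Path σ τ r) → vertex p (fromℕ r) ≈ₙ τ
  vertex-last (done eq) = eq
  vertex-last (_ ∷ p) = vertex-last p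

  path-monotone : ∀ {σ τ r} → Path σ τ r → Admissible σ → Admissible τ × σ ⪯ τ
  path-monotone {σ} {τ} (done eq) adm = admissible-resp σ τ eq adm , ≈⇒⪯ σ τ eq
  path-monotone {σ} {τ} (_∷_ {ρ = ρ} (_ , _ , M , v) p) adm =
    let adm-ρ = step-admissible M v adm
        adm-τ , ρ⪯τ = path-monotone p adm-ρ
    in adm-τ , ⪯-trans σ ρ τ adm-ρ (step-⪯ M v) ρ⪯τ

  module _ {σ τ r} (p : Path σ τ r) where
    pathLower pathUpper : Fin r → Fin m
    pathLower i = proj₁ (step p i)
    pathUpper i = proj₁ (proj₂ (step p i))

    isMergeSequence : IsMergeSequence (vertex p) pathLower pathUpper
    isMergeSequence = record { merge = λ i → proj₁ (proj₂ (proj₂ (step p i))) }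

    pathValid : ∀ i → Valid (pathLower i) (pathUpper i)
    pathValid i = proj₂ (proj₂ (proj₂ (step p i)))

-- Parking functions

sorting-permutation : ∀ {n} (a : Vector ℕ n) →
  ∃ λ (π : Permutation′ n) → ∀ i j → i Fin.≤ j → a (π ⟨$⟩ʳ i) ≤ a (π ⟨$⟩ʳ j)
sorting-permutation {zero} a = Perm.id , λ ()
sorting-permutation {suc n} a
  with Extremum.maximal (λ p q → ℕ.<-trans q p) (flip-cmp ℕ.<-cmp) a {λ _ → ⊤} (λ _ → yes tt) {zero} tt
... | m , _ , least with sorting-permutation (λ i → a (Perm.transpose zero m ⟨$⟩ʳ suc i))
...   | π , sorted = Perm.lift₀ π Perm.∘ₚ Perm.transpose zero m , λ
        { zero j _ → ℕ.≮⇒≥ (least _ tt)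
        ; (suc i) (suc j) i≤j → sorted i j (ℕ.s≤s⁻¹ i≤j) }

private
  opposite-antitone : ∀ {n} {i j : Fin n} → i Fin.≤ j → Fin.opposite j Fin.≤ Fin.opposite i
  opposite-antitone {n} {i} {j} i≤j = subst₂ _≤_ (sym (Fin.opposite-prop j)) (sym (Fin.opposite-prop i))
    (ℕ.∸-monoʳ-≤ n (ℕ.s≤s i≤j))

  opposite-injective : ∀ {n} {i j : Fin n} → Fin.opposite i ≡ Fin.opposite j → i ≡ j
  opposite-injective {i = i} {j} eq =
    trans (sym (Fin.opposite-involutive i)) (trans (cong Fin.opposite eq) (Fin.opposite-involutive j))

-- Sorting a, some entry at a position j ≥ i is bounded by 1 + i, as q is
-- injective; hence so is the entry at position i.
parking-criterion : ∀ {n} (a : Vector ℕ n) (q : Fin n → Fin n) → (∀ {i j} → q i ≡ q j → i ≡ j) →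
  (∀ i → 1 ≤ a i) → (∀ i → a i ≤ suc (toℕ (q i))) → IsParkingFunction a
parking-criterion {n} a q q-injective positive bounded with sorting-permutation a
... | π , sorted = positive , π , sorted , λ i → bound i
  where
  f : Fin n → Fin n
  f j = Fin.opposite (q (π ⟨$⟩ʳ Fin.opposite j))
  f-injective : ∀ {i j} → f i ≡ f j → i ≡ j
  f-injective {i} {j} eq = opposite-injective (trans (sym (Perm.inverseˡ π))
    (trans (cong (π ⟨$⟩ˡ_) (q-injective (opposite-injective eq))) (Perm.inverseˡ π)))
  bound : ∀ i → a (π ⟨$⟩ʳ i) ≤ suc (toℕ i)
  -- The pivot lemma yields j ≤ i with i ≤ f j. Reversing arguments and values by `Fin.opposite`
  -- turns this into a position at or after i whose q is at most i.
  bound i with Fin.injective⇒existsPivot f-injective (Fin.opposite i)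
  ... | j , j≤ , ≤fj = ℕ.≤-trans (sorted i (Fin.opposite j) (subst (Fin._≤ Fin.opposite j) (Fin.opposite-involutive i) (opposite-antitone j≤)))
    (ℕ.≤-trans (bounded (π ⟨$⟩ʳ Fin.opposite j))
      (ℕ.s≤s (subst₂ Fin._≤_ (Fin.opposite-involutive (q (π ⟨$⟩ʳ Fin.opposite j))) (Fin.opposite-involutive i) (opposite-antitone ≤fj))))

-- Chains with labels in PF n k

module Chains (n k : ℕ) (1<k : 1 < k) (k≤n : k ≤ n) where

  Q : Fin (suc n)
  Q = Fin.fromℕ< (ℕ.s≤s k≤n)

  toℕ-Q : toℕ Q ≡ k
  toℕ-Q = Fin.toℕ-fromℕ< (ℕ.s≤s k≤n)

  0<Q : 0 < toℕ Q
  0<Q = subst (0 <_) (sym toℕ-Q) (ℕ.<-trans ℕ.z<s 1<k)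

  open Paths Q 0<Q

  suc-P : suc (toℕ P) ≡ k
  suc-P = trans (sym (pred-suc Q 0<Q)) toℕ-Q

  private
    N = NoncrossingPartition (suc n)

  discrete full : N
  discrete = mkNCP _≡_ isEquivalence Fin._≟_ λ { a<b b<c _ refl _ → contradiction (ℕ.<-trans a<b b<c) (ℕ.<-irrefl refl) }
  full = mkNCP (λ _ _ → 0 ≡ 0) (record { refl = refl ; sym = λ _ → refl ; trans = λ _ _ → refl }) (λ _ _ → yes refl)
    λ _ _ _ _ _ → refl

  discrete-⊑ : ∀ ρ → discrete ⊑ ρ
  discrete-⊑ ρ refl = NCP.∼-refl ρ

  ⊑-full : ∀ ρ → ρ ⊑ full
  ⊑-full ρ _ = refl

  discrete-minimal : ∀ y → Minimal discrete y
  discrete-minimal y z refl = ℕ.≤-refl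

  discrete-admissible : Admissible discrete
  discrete-admissible y _ = inj₂ (discrete-minimal y)

  full-¬minimal : ∀ (y : Fin n) → ¬ Minimal full (suc y)
  full-¬minimal y min = contradiction (min zero refl) λ ()

  module FullPath {r} (p : Path discrete full r) where
    open IsMergeSequence (isMergeSequence p)

    private
      l = pathLower p
      q = pathUpper p

      0<q : ∀ i → 0 < toℕ (q i)
      0<q i = ℕ.≤-<-trans ℕ.z≤n (Merge.l<q (merge i))

    q⁻ : Fin r → Fin n
    q⁻ i = Fin.lower₁ (Fin.pred (q i)) λ n≡ → ℕ.<⇒≱ (Fin.toℕ<n (q i))
      (subst (_≤ toℕ (q i)) (cong suc (sym n≡)) (ℕ.≤-reflexive (sym (pred-suc (q i) (0<q i)))))

    toℕ-q : ∀ i → toℕ (q i) ≡ suc (toℕ (q⁻ i))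
    toℕ-q i = trans (pred-suc (q i) (0<q i)) (cong suc (sym (Fin.toℕ-lower₁ _ _)))

    q⁻-injective : ∀ {i j} → q⁻ i ≡ q⁻ j → i ≡ j
    q⁻-injective {i} {j} eq = q-injective (Fin.toℕ-injective (trans (toℕ-q i) (trans (cong (suc ∘ toℕ) eq) (sym (toℕ-q j)))))

    hit : ∀ (y : Fin n) → ∃ λ i → q i ≡ suc y
    hit y = let i , _ , eq = q-hits {f = vertex p} (isMergeSequence p) (fromℕ r) (discrete-minimal (suc y))
                  (full-¬minimal y ∘ minimal-antitone full (vertex p (fromℕ r)) (proj₂ (vertex-last p)))
            in i , eq

    -- No minimum is destroyed twice, and each nonzero element starts as a minimum and ends as none.
    -- The q's of a full path are thus the nonzero elements, each once.
    length≡ : r ≡ n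
    length≡ = ℕ.≤-antisym (Fin.injective⇒≤ q⁻-injective) (Fin.injective⇒≤ {f = proj₁ ∘ hit} λ {x} {y} eq →
      Fin.suc-injective (trans (sym (proj₂ (hit x))) (trans (cong q eq) (proj₂ (hit y)))))

    labels : Vector ℕ r
    labels i = suc (toℕ (l i))

    labels-parking : IsParkingFunction {r} labels
    labels-parking = parking (length≡)
      where
      parking : r ≡ n → IsParkingFunction {r} labels
      parking refl = parking-criterion labels q⁻ q⁻-injective (λ _ → ℕ.s≤s ℕ.z≤n)
        λ i → subst (suc (toℕ (l i)) ≤_) (toℕ-q i) (Merge.l<q (merge i))

    -- Label k means l = P. A merge at q < Q has l < P, the one at Q avoids P by validity, and those
    -- above Q have l = q - 1, which is at least Q.
    labels-∌ : k ∉ IsEntryOf labels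
    labels-∌ (i , eq) with Fin.<-cmp (q i) Q
    ... | tri< q<Q _ _ = ℕ.<⇒≱ (Merge.l<q (merge i))
      (subst (toℕ (q i) ≤_) (ℕ.suc-injective (trans suc-P (sym eq))) (<⇒≤pred q<Q))
    ... | tri≈ _ q≡Q _ = proj₂ (pathValid p i) q≡Q (Fin.toℕ-injective (ℕ.suc-injective (trans eq (sym suc-P))))
    ... | tri> _ _ Q<q = ℕ.<-irrefl (trans toℕ-Q (sym eq))
      (subst (λ x → toℕ Q < suc (toℕ x)) (sym (proj₁ (pathValid p i) Q<q)) (ℕ.s≤s (<⇒≤pred Q<q)))

    labels-∋ : ∀ j → k < j → j ≤ n → j ∈ IsEntryOf labels
    labels-∋ (suc j) k<j j≤n with hit (Fin.fromℕ< j≤n)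
    ... | i , eq = i , trans (cong (suc ∘ toℕ) (proj₁ (pathValid p i) Q<q)) (trans (sym (pred-suc (q i) (0<q i))) toℕ≡)
      where
      toℕ≡ : toℕ (q i) ≡ suc j
      toℕ≡ = trans (cong toℕ eq) (cong suc (Fin.toℕ-fromℕ< j≤n))
      Q<q : Q Fin.< q i
      Q<q = subst₂ _<_ (sym toℕ-Q) (sym toℕ≡) k<j

  chain : Path discrete full n → MaximalChain n
  chain p = record
    { element = vertex p
    ; bottom = λ ρ → discrete-⊑ ρ
    ; top = λ ρ _ → proj₂ (vertex-last p) refl
    ; covers = λ i → merge⇒covers {n} {vertex p (inject₁ i)} {vertex p (suc i)} (IsMergeSequence.merge (isMergeSequence p) i)
    }

  chain-∈ : ∀ p → chain p ∈ ChainOf (PF n k)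
  chain-∈ p = labels , (labels-parking , labels-∌ , labels-∋) , λ i →
    merge⇒label {σ = vertex p (inject₁ i)} {vertex p (suc i)} (IsMergeSequence.merge (isMergeSequence p) i)
    where open FullPath p

  vertex-onChain : ∀ {r} (p : Path discrete full r) i {ρ} → vertex p i ≈ₙ ρ → OnChain (PF n k) ρ
  vertex-onChain p i eq with FullPath.length≡ p
  ... | refl = chain p , chain-∈ p , i , eq

  step-chainCover : ∀ {r} (p : Path discrete full r) i {σ τ} → vertex p (inject₁ i) ≈ₙ σ → vertex p (suc i) ≈ₙ τ →
    ChainCover (PF n k) σ τ
  step-chainCover p i eq eq′ with FullPath.length≡ p
  ... | refl = chain p , chain-∈ p , i , eq , eq′

  private
    ++-vertex : ∀ {σ ρ τ r s} (p : Path σ ρ r) (p′ : Path ρ τ s) → ∃ λ i → vertex (p ++ₚ p′) i ≈ₙ ρ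
    ++-vertex (done eq) p′ = zero , eq
    ++-vertex (s ∷ p) p′ = let i , eq = ++-vertex p p′ in suc i , eq

    ++-step : ∀ {σ ρ ρ′ τ r s} (p : Path σ ρ r) (st : ValidStep ρ ρ′) (p′ : Path ρ′ τ s) →
      ∃ λ i → vertex (p ++ₚ (st ∷ p′)) (inject₁ i) ≈ₙ ρ × vertex (p ++ₚ (st ∷ p′)) (suc i) ≈ₙ ρ′
    ++-step (done eq) st p′ = zero , eq , id , id
    ++-step (s ∷ p) st p′ = let i , eqs = ++-step p st p′ in suc i , eqs

  -- The two `⪯` conditions do not follow from admissibility: the partition with {P, Q} as its only
  -- block of more than one element is admissible, but no μ lies suitably between `discrete` and it.
  OnPath : Pred N (lsuc 0ℓ)
  OnPath ρ = Admissible ρ × discrete ⪯ ρ × ρ ⪯ full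

  full-admissible : Admissible full
  full-admissible _ _ = inj₁ refl

  onPath⇒onChain : ∀ ρ → OnPath ρ → OnChain (PF n k) ρ
  onPath⇒onChain ρ (adm , lo , hi) =
    let _ , p  = path discrete ρ adm lo
        _ , p′ = path ρ full full-admissible hi
        i , eq = ++-vertex p p′
    in vertex-onChain (p ++ₚ p′) i {ρ} eq

  _<⁺_ : Rel N (lsuc 0ℓ)
  _<⁺_ = TransClosure (ChainCover (PF n k))

  -- `OnPath` provides paths from `discrete` to σ and from ρ to `full`; joined by the given step
  -- they form a full path, hence a chain with labels in `PF n k`.
  step⇒cover : ∀ σ ρ → OnPath σ → OnPath ρ → ValidStep σ ρ → ChainCover (PF n k) σ ρ
  step⇒cover σ ρ (adm-σ , lo , _) (adm-ρ , _ , hi) st =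
    let _ , p  = path discrete σ adm-σ lo
        _ , p′ = path ρ full full-admissible hi
        i , eq , eq′ = ++-step p st p′
    in step-chainCover (p ++ₚ (st ∷ p′)) i {σ} {ρ} eq eq′

  path⇒≤ : ∀ {σ τ r} → Path σ τ r → OnPath σ → τ ⪯ full → σ <⁺ τ ⊎ σ ≈ₙ τ
  path⇒≤ (done eq) _ _ = inj₂ eq
  path⇒≤ {σ} {τ} (_∷_ {ρ = ρ} st@(_ , _ , M , v) p) on-σ@(adm-σ , lo , _) τ⪯full =
    inj₁ (first (path⇒≤ p on-ρ τ⪯full))
    where
    adm-ρ : Admissible ρ
    adm-ρ = step-admissible M v adm-σ
    on-ρ : OnPath ρ
    on-ρ = adm-ρ , ⪯-trans discrete σ ρ adm-σ lo (step-⪯ M v) ,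
      (let adm-τ , ρ⪯τ = path-monotone p adm-ρ in ⪯-trans ρ τ full adm-τ ρ⪯τ τ⪯full)
    first : ρ <⁺ τ ⊎ ρ ≈ₙ τ → σ <⁺ τ
    first (inj₁ ρ<τ) = step⇒cover σ ρ on-σ on-ρ st ∷ ρ<τ
    first (inj₂ ρ≈τ) with step⇒cover σ ρ on-σ on-ρ st
    ... | C , C∈ , i , eq , eq′ = [ C , C∈ , i , eq , ≈-trans (MaximalChain.element C (suc i)) ρ τ eq′ ρ≈τ ]

  ⪯⇒≤ : ∀ σ τ → OnPath σ → OnPath τ → σ ⪯ τ → σ <⁺ τ ⊎ σ ≈ₙ τ
  ⪯⇒≤ σ τ on-σ (adm-τ , _ , hi) σ⪯τ = path⇒≤ (proj₂ (path σ τ adm-τ σ⪯τ)) on-σ hi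

  module ChainIn (C : MaximalChain n) (C∈ : C ∈ ChainOf (PF n k)) where
    open MaximalChain C

    private
      a = proj₁ C∈
      k∉a : k ∉ IsEntryOf a
      k∉a = proj₁ (proj₂ (proj₁ (proj₂ C∈)))
      merges : ∀ i → ∃₂ λ l q → Merge (element (inject₁ i)) (element (suc i)) l q × a i ≡ suc (toℕ l)
      merges i = label⇒merge (proj₂ (proj₂ C∈) i)
      l q : Fin n → Fin (suc n)
      l i = proj₁ (merges i)
      q i = proj₁ (proj₂ (merges i))
      a≡l : ∀ i → a i ≡ suc (toℕ (l i))
      a≡l i = proj₂ (proj₂ (proj₂ (merges i)))
      isSequence : IsMergeSequence element l q
      isSequence = record { merge = λ i → proj₁ (proj₂ (proj₂ (merges i))) }
      open IsMergeSequence isSequence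

      -- Downward induction on y: the label y must come from a merge of y,
      -- the merges of all greater elements having other labels.
      label-of : ∀ d y → suc n ≤ d ℕ.+ toℕ y → Q Fin.< y → ∃ λ i → q i ≡ y × l i ≡ Fin.pred y
      label-of zero y bound _ = contradiction (Fin.toℕ<n y) (ℕ.≤⇒≯ bound)
      label-of (suc d) y bound Q<y
        with proj₂ (proj₂ (proj₁ (proj₂ C∈))) (toℕ y) (subst (_< toℕ y) toℕ-Q Q<y) (ℕ.s≤s⁻¹ (Fin.toℕ<n y))
      ... | i , aᵢ≡y = main (Fin.<-cmp y (q i))
        where
        0<y : 0 < toℕ y
        0<y = ℕ.≤-<-trans ℕ.z≤n Q<y
        y≡1+l : toℕ y ≡ suc (toℕ (l i))
        y≡1+l = trans (sym aᵢ≡y) (a≡l i)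
        l≡ : l i ≡ Fin.pred y
        l≡ = Fin.toℕ-injective (ℕ.suc-injective (trans (sym y≡1+l) (pred-suc y 0<y)))
        main : Tri (y Fin.< q i) (y ≡ q i) (q i Fin.< y) → ∃ λ i → q i ≡ y × l i ≡ Fin.pred y
        main (tri≈ _ y≡q _) = i , sym y≡q , l≡
        main (tri> _ _ q<y) = contradiction q<y (ℕ.≤⇒≯ (subst (_≤ toℕ (q i)) (sym y≡1+l) (Merge.l<q (merge i))))
        main (tri< y<q _ _) with label-of d (q i) (ℕ.≤-trans bound (subst (_≤ d ℕ.+ toℕ (q i)) (ℕ.+-suc d (toℕ y)) (ℕ.+-monoʳ-≤ d y<q))) (ℕ.<-trans Q<y y<q)
        ... | j , qj≡qi , lj≡ with q-injective qj≡qi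
        ...   | refl = contradiction
          (trans (pred-suc y 0<y) (trans (cong (suc ∘ toℕ) (trans (sym l≡) lj≡)) (sym (pred-suc (q i) (ℕ.≤-<-trans ℕ.z≤n y<q)))))
          (ℕ.<⇒≢ y<q)

      valid : ∀ i → Valid (l i) (q i)
      valid i = above , λ _ l≡P → k∉a (i , trans (a≡l i) (trans (cong (suc ∘ toℕ) l≡P) suc-P))
        where
        above : Q Fin.< q i → l i ≡ Fin.pred (q i)
        above Q<q with label-of (suc n) (q i) (ℕ.m≤m+n (suc n) (toℕ (q i))) Q<q
        ... | j , qj≡qi , lj≡ with q-injective qj≡qi
        ...   | refl = lj≡

      -- Admissibility and `⪯` are carried upwards together, since transitivity of `⪯` needs the
      -- middle partition to be admissible.
      R : Rel N (lsuc 0ℓ)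
      R σ τ = Admissible σ → Admissible τ × σ ⪯ τ

      R-step : ∀ i → R (element (inject₁ i)) (element (suc i))
      R-step i adm = step-admissible (merge i) (valid i) adm , step-⪯ (merge i) (valid i)

      R-refl : ∀ σ → R σ σ
      R-refl σ adm = adm , ⪯-refl σ

      R-trans : ∀ σ ρ τ → R σ ρ → R ρ τ → R σ τ
      R-trans σ ρ τ r r′ adm-σ =
        let adm-ρ , σ⪯ρ = r adm-σ
            adm-τ , ρ⪯τ = r′ adm-ρ
        in adm-τ , ⪯-trans σ ρ τ adm-ρ σ⪯ρ ρ⪯τ

      R-≤ : ∀ i j → i Fin.≤ j → R (element i) (element j)
      R-≤ = stepwise R-refl R-trans element R-step

      first≈ : element zero ≈ₙ discrete
      first≈ = bottom discrete , discrete-⊑ (element zero)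

      last≈ : element (fromℕ n) ≈ₙ full
      last≈ = ⊑-full (element (fromℕ n)) , top full

      first-admissible : Admissible (element zero)
      first-admissible = admissible-resp discrete (element zero) (≈-sym (element zero) discrete first≈) discrete-admissible

    element-admissible : ∀ i → Admissible (element i)
    element-admissible i = proj₁ (R-≤ zero i ℕ.z≤n first-admissible)

    element-step : ∀ i → element (inject₁ i) ⪯ element (suc i)
    element-step i = step-⪯ (merge i) (valid i)

    element-onPath : ∀ i → OnPath (element i)
    element-onPath i = element-admissible i ,
      ⪯-trans discrete (element zero) (element i) first-admissible
        (≈⇒⪯ discrete (element zero) (≈-sym (element zero) discrete first≈)) (proj₂ (R-≤ zero i ℕ.z≤n first-admissible)) ,
      ⪯-trans (element i) (element (fromℕ n)) full (element-admissible (fromℕ n))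
        (proj₂ (R-≤ i (fromℕ n) (Fin.≤fromℕ i) (element-admissible i))) (≈⇒⪯ (element (fromℕ n)) full last≈)

  onPath-resp : ∀ σ τ → σ ≈ₙ τ → OnPath σ → OnPath τ
  onPath-resp σ τ eq (adm , lo , hi) = admissible-resp σ τ eq adm ,
    ⪯-trans discrete σ τ adm lo (≈⇒⪯ σ τ eq) , ⪯-trans τ σ full adm (≈⇒⪯ τ σ (≈-sym σ τ eq)) hi

  onChain⇒onPath : ∀ ρ → OnChain (PF n k) ρ → OnPath ρ
  onChain⇒onPath ρ (C , C∈ , i , eq) =
    onPath-resp (MaximalChain.element C i) ρ eq (ChainIn.element-onPath C C∈ i)

  chainCover⇒⪯ : ∀ σ τ → ChainCover (PF n k) σ τ → Admissible σ × Admissible τ × σ ⪯ τ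
  chainCover⇒⪯ σ τ (C , C∈ , i , eq , eq′) =
    admissible-resp x σ eq (element-admissible (inject₁ i)) , admissible-resp y τ eq′ (element-admissible (suc i)) ,
    ⪯-trans σ x τ (element-admissible (inject₁ i)) (≈⇒⪯ σ x (≈-sym x σ eq))
      (⪯-trans x y τ (element-admissible (suc i)) (element-step i) (≈⇒⪯ y τ eq′))
    where
    open ChainIn C C∈
    x = MaximalChain.element C (inject₁ i)
    y = MaximalChain.element C (suc i)

  <⁺⇒⪯ : ∀ {σ τ} → σ <⁺ τ → σ ⪯ τ
  <⁺⇒⪯ {σ} {τ} [ c ] = proj₂ (proj₂ (chainCover⇒⪯ σ τ c))
  <⁺⇒⪯ {σ} {τ} (_∷_ {y = ρ} c r) = let _ , adm-ρ , σ⪯ρ = chainCover⇒⪯ σ ρ c in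
    ⪯-trans σ ρ τ adm-ρ σ⪯ρ (<⁺⇒⪯ r)

  ≤⇒⪯ : ∀ σ τ → σ <⁺ τ ⊎ σ ≈ₙ τ → σ ⪯ τ
  ≤⇒⪯ σ τ = [ <⁺⇒⪯ , ≈⇒⪯ σ τ ]′

-- Self-duality of the intervals

module SelfDuality (n k : ℕ) (1<k : 1 < k) (k≤n : k ≤ n) where
  open Chains n k 1<k k≤n
  open Paths Q 0<Q using (_⪯_; ⪯-trans; ≈⇒⪯; Admissible; Joined; Between; Duality; DualPair; dualPair)

  private
    N = NoncrossingPartition (suc n)

  module _ {σ τ : N} (D D⁻ : Duality σ τ)
    (inverse : ∀ ρ → Admissible ρ → Between σ τ ρ → Duality.dual D (Duality.dual D⁻ ρ) ≈ₙ ρ)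
    (on-σ : OnPath σ) (on-τ : OnPath τ) (σ⊑τ : σ ⊑ τ) where
    open Duality D

    -- The hypotheses of the clause for the images force Q minimal in σ and P, Q joined in τ, so the
    -- exchange properties apply. They turn these hypotheses into those of the clause for ρ ⪯ ρ′,
    -- and the image of the μ found there is the required one.
    dual-⪯ : ∀ {ρ ρ′} → Admissible ρ → Admissible ρ′ → Between σ τ ρ → Between σ τ ρ′ → ρ ⪯ ρ′ → dual ρ′ ⪯ dual ρ
    dual-⪯ {ρ} {ρ′} adm adm′ (σ⊑ρ , ρ⊑τ) (σ⊑ρ′ , ρ′⊑τ) (ρ⊑ρ′ , h) = dual-antitone {ρ} {ρ′} ρ⊑ρ′ , middle
      where
      middle : Minimal (dual ρ′) Q → Joined (dual ρ) →
        ∃ λ μ → Admissible μ × ¬ Minimal μ Q × ¬ Joined μ × dual ρ′ ⊑ μ × μ ⊑ dual ρ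
      middle min join = dualise (h (Equivalence.to (dual-joined min-σ join-τ ρ adm (σ⊑ρ , ρ⊑τ)) join)
                                   (Equivalence.to (dual-minimal min-σ join-τ ρ′ adm′ (σ⊑ρ′ , ρ′⊑τ)) min))
        where
        min-σ : Minimal σ Q
        min-σ = minimal-antitone σ (dual ρ′) (proj₁ (dual-between ρ′)) min
        join-τ : Joined τ
        join-τ = proj₂ (dual-between ρ) join
        dualise : (∃ λ μ → Admissible μ × ¬ Minimal μ Q × ¬ Joined μ × ρ ⊑ μ × μ ⊑ ρ′) →
          ∃ λ μ → Admissible μ × ¬ Minimal μ Q × ¬ Joined μ × dual ρ′ ⊑ μ × μ ⊑ dual ρ
        dualise (μ , adm-μ , ¬min , ¬join , ρ⊑μ , μ⊑ρ′) = dual μ , dual-admissible μ ,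
          ¬join ∘ Equivalence.to (dual-minimal min-σ join-τ μ adm-μ btw) ,
          ¬min ∘ Equivalence.to (dual-joined min-σ join-τ μ adm-μ btw) ,
          dual-antitone {μ} {ρ′} μ⊑ρ′ , dual-antitone {ρ} {μ} ρ⊑μ
          where
          btw : Between σ τ μ
          btw = ⊑-trans σ ρ μ σ⊑ρ ρ⊑μ , ⊑-trans μ ρ′ τ μ⊑ρ′ ρ′⊑τ

    private
      adm-σ = proj₁ on-σ
      adm-τ = proj₁ on-τ
      btw-σ : Between σ τ σ
      btw-σ = id , σ⊑τ
      btw-τ : Between σ τ τ
      btw-τ = σ⊑τ , id

    -- `dual-between` gives only refinement, whereas σ ⪯ `dual ρ` is needed. That comes from ρ ⪯ τ
    -- by `dual-⪯` once the image of τ is known to be σ, which holds because σ is the image of some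
    -- partition below τ.
    dual-top : dual τ ≈ₙ σ
    dual-top = ⊑-trans (dual τ) (dual (Duality.dual D⁻ σ)) σ
      (dual-antitone {Duality.dual D⁻ σ} {τ} (proj₂ (Duality.dual-between D⁻ σ)))
      (proj₁ (inverse σ adm-σ btw-σ)) , proj₁ (dual-between τ)

    dual-bottom : dual σ ≈ₙ τ
    dual-bottom = proj₂ (dual-between σ) , ⊑-trans τ (dual (Duality.dual D⁻ τ)) (dual σ)
      (proj₂ (inverse τ adm-τ btw-τ))
      (dual-antitone {σ} {Duality.dual D⁻ τ} (proj₁ (Duality.dual-between D⁻ τ)))

    module _ {ρ : N} (adm : Admissible ρ) (σ⪯ρ : σ ⪯ ρ) (ρ⪯τ : ρ ⪯ τ) where
      private
        btw : Between σ τ ρ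
        btw = proj₁ σ⪯ρ , proj₁ ρ⪯τ

      ⪯-dual : σ ⪯ dual ρ
      ⪯-dual = ⪯-trans σ (dual τ) (dual ρ) (dual-admissible τ)
        (≈⇒⪯ σ (dual τ) (≈-sym (dual τ) σ dual-top)) (dual-⪯ adm adm-τ btw btw-τ ρ⪯τ)

      dual-⪯-top : dual ρ ⪯ τ
      dual-⪯-top = ⪯-trans (dual ρ) (dual σ) τ (dual-admissible σ)
        (dual-⪯ adm-σ adm btw-σ btw σ⪯ρ) (≈⇒⪯ (dual σ) τ dual-bottom)

      dual-onPath : OnPath (dual ρ)
      dual-onPath = dual-admissible ρ ,
        ⪯-trans discrete σ (dual ρ) adm-σ (proj₁ (proj₂ on-σ)) ⪯-dual ,
        ⪯-trans (dual ρ) τ full adm-τ dual-⪯-top (proj₂ (proj₂ on-τ))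

  open Poset (PosetOf (PF n k)) using () renaming (Carrier to X; _≤_ to _≤ₚ_)

  selfDual : ∀ (x y : X) → x ≤ₚ y → SelfDual (interval (PosetOf (PF n k)) x y)
  selfDual x@(σ , σ∈) y@(τ , τ∈) x≤y = f D.to D.from D.to-from , record
    { isOrderMonomorphism = record
      { isOrderHomomorphism = record
        { cong = λ {u} {v} → dual-cong D.to u v
        ; mono = λ {u} {v} → f-antitone D.to D.from D.to-from u v }
      ; injective = λ {u} {v} eq → cancel-≈ u v (dual-cong D.from (to u) (to v) eq)
      -- Applying the inverse duality to r orders the round trips of u and v, which agree with u and
      -- v up to `≈ₙ`.
      ; cancel = λ {u} {v} r → ⪯⇒≤ (part u) (part v) (on u) (on v)
          (⪯-trans (part u) (back u) (part v) (proj₁ (on (from (to u)))) (≈⇒⪯ (part u) (back u) (≈-sym (back u) (part u) (from-to u)))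
            (⪯-trans (back u) (back v) (part v) (proj₁ (on (from (to v))))
              (≤⇒⪯ (back u) (back v) (f-antitone D.from D.to D.from-to (to v) (to u) r))
              (≈⇒⪯ (back v) (part v) (from-to v))))
      }
    ; surjective = λ u → from u , λ {v} eq → ≈-trans (part (to v)) (part (to (from u))) (part u)
        (dual-cong D.to v (from u) eq) (D.to-from (part u) (proj₁ (on u)) (btw u))
    }
    where
    I = Poset.Carrier (interval (PosetOf (PF n k)) x y)
    on-σ : OnPath σ
    on-σ = onChain⇒onPath σ σ∈
    on-τ : OnPath τ
    on-τ = onChain⇒onPath τ τ∈
    σ⊑τ : σ ⊑ τ
    σ⊑τ = proj₁ (≤⇒⪯ σ τ x≤y)
    module D = DualPair (dualPair σ τ σ⊑τ (proj₁ on-σ))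

    part : I → N
    part ((ρ , _) , _) = ρ
    on : ∀ u → OnPath (part u)
    on ((ρ , ρ∈) , _) = onChain⇒onPath ρ ρ∈
    lower : ∀ u → σ ⪯ part u
    lower ((ρ , _) , l , _) = ≤⇒⪯ σ ρ l
    upper : ∀ u → part u ⪯ τ
    upper ((ρ , _) , _ , r) = ≤⇒⪯ ρ τ r
    btw : ∀ u → Between σ τ (part u)
    btw u = proj₁ (lower u) , proj₁ (upper u)

    Inverse : Duality σ τ → Duality σ τ → Set₁
    Inverse D D⁻ = ∀ ρ → Admissible ρ → Between σ τ ρ → Duality.dual D (Duality.dual D⁻ ρ) ≈ₙ ρ

    f : (D D⁻ : Duality σ τ) → Inverse D D⁻ → I → I
    f D D⁻ inv u = (δ , onPath⇒onChain δ on-δ) ,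
      ⪯⇒≤ σ δ on-σ on-δ (⪯-dual D D⁻ inv on-σ on-τ σ⊑τ adm (lower u) (upper u)) ,
      ⪯⇒≤ δ τ on-δ on-τ (dual-⪯-top D D⁻ inv on-σ on-τ σ⊑τ adm (lower u) (upper u))
      where
      adm = proj₁ (on u)
      δ = Duality.dual D (part u)
      on-δ : OnPath δ
      on-δ = dual-onPath D D⁻ inv on-σ on-τ σ⊑τ adm (lower u) (upper u)

    to from : I → I
    to = f D.to D.from D.to-from
    from = f D.from D.to D.from-to

    back : I → N
    back u = part (from (to u))

    from-to : ∀ u → back u ≈ₙ part u
    from-to u = D.from-to (part u) (proj₁ (on u)) (btw u)

    dual-cong : ∀ D u v → part u ≈ₙ part v → Duality.dual D (part u) ≈ₙ Duality.dual D (part v)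
    dual-cong D u v = antitone-cong {f = Duality.dual D} (λ {a} {b} → Duality.dual-antitone D {a} {b}) (part u) (part v)

    cancel-≈ : ∀ u v → back u ≈ₙ back v → part u ≈ₙ part v
    cancel-≈ u v eq = ≈-trans (part u) (back u) (part v) (≈-sym (back u) (part u) (from-to u))
      (≈-trans (back u) (back v) (part v) eq (from-to v))

    f-antitone : ∀ D D⁻ (inv : Inverse D D⁻) u v → part u <⁺ part v ⊎ part u ≈ₙ part v →
      Duality.dual D (part v) <⁺ Duality.dual D (part u) ⊎ Duality.dual D (part v) ≈ₙ Duality.dual D (part u)
    f-antitone D D⁻ inv u v r = ⪯⇒≤ (Duality.dual D (part v)) (Duality.dual D (part u))
      (dual-onPath D D⁻ inv on-σ on-τ σ⊑τ (proj₁ (on v)) (lower v) (upper v))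
      (dual-onPath D D⁻ inv on-σ on-τ σ⊑τ (proj₁ (on u)) (lower u) (upper u))
      (dual-⪯ D D⁻ inv on-σ on-τ σ⊑τ (proj₁ (on u)) (proj₁ (on v)) (btw u) (btw v) (≤⇒⪯ (part u) (part v) r))

theorem2 : (n k : ℕ) → 1 < k → k ≤ n → LocallySelfDual (PosetOf (PF n k))
theorem2 n k 1<k k≤n = SelfDuality.selfDual n k 1<k k≤n
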